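{- Let $k$ and $n$ be positive integers with $n\geq 10^{46}k$, and let $x_1,\dots,x_n$ be real numbers such that $x_1+\dots+x_n\geq 0$. Then at least $\binom{n-1}{k-1}$ subsets $A\subseteq\{1,\dots,n\}$ with $|A|=k$ satisfy $\sum_{a\in A}x_a\geq 0$. -}

module Defs where

open import Level using (Level; _⊔_) renaming (suc to lsuc)
open import Algebra.Bundles using (CommutativeRing)
open import Relation.Binary.Core using (Rel)
open import Relation.Binary.Structures using (IsTotalOrder)
open import Relation.Nullary using (¬_)
open import Data.Product using (∃)
open import Data.Nat using (ℕ; zero; suc)
open import Data.Fin using (Fin)
import Data.Fin as Fin
open import Data.Bool using (true; false)
open import Data.Vec using ([]; _∷_)
open import Data.Fin.Subset using (Subset)

-- An ordered field (the real numbers ℝ are one; the paper's x_i are reals).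
-- The theorem is stated for every ordered field, hence in particular for ℝ.
record OrderedField (c ℓ₁ ℓ₂ : Level) : Set (lsuc (c ⊔ ℓ₁ ⊔ ℓ₂)) where
  field
    commutativeRing : CommutativeRing c ℓ₁
  open CommutativeRing commutativeRing public
  field
    _≤_          : Rel Carrier ℓ₂
    isTotalOrder : IsTotalOrder _≈_ _≤_
    0≉1          : ¬ (0# ≈ 1#)
    inverse      : ∀ x → ¬ (x ≈ 0#) → ∃ λ y → x * y ≈ 1#
    +-monoˡ-≤    : ∀ {x y} z → x ≤ y → (x + z) ≤ (y + z)
    *-nonneg     : ∀ {x y} → 0# ≤ x → 0# ≤ y → 0# ≤ (x * y)

module _ {c ℓ₁ ℓ₂} (F : OrderedField c ℓ₁ ℓ₂) where
  open OrderedField F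

  sumOver : ∀ {n} → Subset n → (Fin n → Carrier) → Carrier
  sumOver []          x = 0#
  sumOver (true ∷ p)  x = x Fin.zero + sumOver p (λ i → x (Fin.suc i))
  sumOver (false ∷ p) x = sumOver p (λ i → x (Fin.suc i))

  sumAll : ∀ {n} → (Fin n → Carrier) → Carrier
  sumAll {zero}  x = 0#
  sumAll {suc n} x = x Fin.zero + sumAll (λ i → x (Fin.suc i))

{-# OPTIONS --safe #-}

-- Call a k-set good if its weight is nonnegative, and let a be an element of
-- maximal weight.  A random k-subset sum is analysed at the scale at which the
-- truncated weights have variance comparable to the square of the scale.
--
-- If x a is at most this scale, the first, second and fourth moments of the
-- sum, tested against the quartic S (S + 15T)² (30T − S), show that a constant
-- proportion of all k-sets is good, which is far more than k / n of them.
-- Otherwise Chebyshev's inequality shows that at most a quarter of the k-sets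
-- containing a are bad, so in any case the proportion of good k-sets is at
-- least (3/4) k / n.
--
-- In the second case let F be the number of bad k-sets containing a and G the
-- number of good ones avoiding a; the claim is F ≤ G.  The complement of a bad
-- set has nonnegative weight, so (3/4) k / (n − k) of its k-subsets are good.
-- But the density of a family of k-sets on the complement of a random
-- (k − 1)-set has variance at most about (k / n)² times its mean density, so
-- if G < F this density is too rarely so large.
--
-- All of this is done for integer weights.  The order of an arbitrary ordered
-- field need not be decidable, so there the theorem is deduced from the integer
-- case through Gordan's alternative: if too few k-sets are known to be good,
-- some of the others cover every element equally often, hence have weight zero.
module Submission where

-- The weak bound is short by a factor 3/4, which the last step can afford, since it compares
-- densities only up to a constant. Let δ be the density of the good sets among the k-sets avoiding
-- a. The bad sets are at most a quarter of those through a, so G < F keeps δ below a quarter of k /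
-- (n - k), while each bad set sees at least three quarters of k / (n - k) on its complement. As the
-- variance is itself proportional to δ, Chebyshev's inequality gives F ≤ O(k / n) G, against G < F.
--
-- All weights are at most x a, so only very negative ones need truncation. At scale T a cut element
-- counts T² in the truncated second moment, which limits how many are cut, and since the total is
-- nonnegative it forces an extra T on the sum of the kept weights. Variance lost by cutting
-- therefore reappears as mean, which is why the spread case assumes a lower bound on q + T p and
-- not on q alone (p and q being the sums of the kept weights and of their squares).
--
-- Division is avoided throughout: centred weights are scaled by the size of the set, and densities
-- are compared with their binomial denominators multiplied across.

module NonnegativeSums where

  open import Defs
  open import Algebra.Bundles using (CommutativeRing)
  import Algebra.Properties.Monoid.Mult as MonoidMult
  import Algebra.Solver.Ring as RingSolver
  open import Algebra.Solver.Ring.AlmostCommutativeRing using (_-Raw-AlmostCommutative⟶_; fromCommutativeRing)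
  open import Algebra.Structures using (IsCommutativeRing)
  open import Data.Bool using (Bool; true; false; not; _∧_; _∨_)
  import Data.Bool.Properties as Bool
  open import Data.Empty using (⊥; ⊥-elim)
  open import Data.Fin using (Fin; zero; suc)
  open import Data.Fin.Subset using (Subset; ∣_∣; ⊤)
  open import Data.Fin.Subset.Properties using (∣⊤∣≡n)
  open import Data.Integer using (ℤ; +_; -[1+_]; 0ℤ; 1ℤ; _≤_; _<_; +≤+; +<+; _≤?_)
  import Data.Integer as ℤ
  import Data.Integer.Properties as ℤₚ
  open import Data.List using (List; []; _∷_; _++_; map; length; filter; cartesianProductWith)
  open import Data.List.Membership.Propositional using (_∈_)
  open import Data.List.Membership.Propositional.Properties using (∈-++⁻; ∈-++⁺ʳ; ∈-map⁺; ∈-map⁻; ∈-filter⁺; ∈-filter⁻; ∈-cartesianProductWith⁺; ∈-cartesianProductWith⁻)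
  open import Data.List.Properties using (length-++)
  open import Data.List.Relation.Unary.All as All using (All; []; _∷_)
  import Data.List.Relation.Unary.All.Properties as Allₚ
  open import Data.List.Relation.Unary.AllPairs using ([]; _∷_)
  open import Data.List.Relation.Unary.Any using (here; there)
  open import Data.List.Relation.Unary.Unique.Propositional using (Unique)
  import Data.List.Relation.Unary.Unique.Propositional.Properties as Uniqueₚ
  open import Data.Maybe using (Maybe; just; nothing)
  open import Data.Nat using (ℕ; zero; suc; z≤n; s≤s)
  import Data.Nat as ℕ
  open import Data.Nat.Combinatorics using (_C_; nCk+nC[k+1]≡[n+1]C[k+1]; nCk≡nC[n∸k]; nCn≡1; k>n⇒nCk≡0)
  import Data.Nat.Properties as ℕₚ
  open import Data.Product using (Σ; ∃; _×_; _,_; proj₁; proj₂)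
  open import Data.Sum using (_⊎_; inj₁; inj₂; [_,_]′)
  open import Data.Unit using (tt)
  open import Data.Vec using (Vec; []; _∷_; lookup; tabulate; zipWith; _[_]≔_)
  import Data.Vec as V
  open import Data.Vec.Properties using (lookup∘tabulate; lookup-map; lookup-replicate; lookup-zipWith; ≡-dec; ∷-injectiveʳ)
  open import Level using (0ℓ; _⊔_)
  open import Relation.Binary.Bundles using (Setoid)
  open import Relation.Binary.PropositionalEquality using (_≡_; refl; sym; trans; cong; cong₂; subst; subst₂; module ≡-Reasoning)
  import Relation.Binary.Reasoning.Setoid as SetoidReasoning
  open import Relation.Binary.Structures using (IsTotalOrder)
  open import Relation.Nullary using (¬_; Dec; yes; no; does)
  open ℤₚ using (≤-refl; ≤-trans; ≤-reflexive)

  private variable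
    n : ℕ
    Idx Idx′ : Set

  -- Integer inequalities and finite sums

  infixl 6 _+_ _-_
  infixl 7 _*_
  infix  8 -_

  -- Integer arithmetic is made opaque: otherwise the type checker unfolds
  -- the operations when it compares the two sides of a polynomial identity.
  opaque
    _+_ _*_ : ℤ → ℤ → ℤ
    _+_ = ℤ._+_
    _*_ = ℤ._*_

    -_ : ℤ → ℤ
    -_ = ℤ.-_

  _-_ : ℤ → ℤ → ℤ
  i - j = i + - j

  opaque
    unfolding _+_ _*_ -_

    isCommutativeRing : IsCommutativeRing _≡_ _+_ _*_ -_ 0ℤ 1ℤ
    isCommutativeRing = ℤₚ.+-*-isCommutativeRing

    +-ℤ : ∀ i j → i ℤ.+ j ≡ i + j
    +-ℤ i j = refl

    *-ℤ : ∀ i j → i ℤ.* j ≡ i * j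
    *-ℤ i j = refl

    neg-ℤ : ∀ i → ℤ.- i ≡ - i
    neg-ℤ i = refl

    +-mono-≤ : ∀ {a b c d} → a ≤ b → c ≤ d → a + c ≤ b + d
    +-mono-≤ = ℤₚ.+-mono-≤

    infixl 7 _⊗_
    _⊗_ : ∀ {a b} → 0ℤ ≤ a → 0ℤ ≤ b → 0ℤ ≤ a * b
    _⊗_ {+ a} {+ b} _ _ = subst (0ℤ ≤_) (ℤₚ.pos-* a b) (+≤+ z≤n)

    square-nonneg : ∀ a → 0ℤ ≤ a * a
    square-nonneg (+ a)    = subst (0ℤ ≤_) (ℤₚ.pos-* a a) (+≤+ z≤n)
    square-nonneg -[1+ a ] = +≤+ z≤n

    *-cancelˡ-≤ : ∀ {d a b} → 0ℤ < d → d * a ≤ d * b → a ≤ b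
    *-cancelˡ-≤ {+ suc d} {a} {b} _ = ℤₚ.*-cancelˡ-≤-pos a b (+ suc d)
    *-cancelˡ-≤ {+ zero} (+<+ ())

    *-pos : ∀ {a b} → 0ℤ < a → 0ℤ < b → 0ℤ < a * b
    *-pos {+ suc a} {+ suc b} _ _ = +<+ (s≤s z≤n)
    *-pos {+ zero} (+<+ ())
    *-pos {+ suc _} {+ zero} _ (+<+ ())

    pos-+ : ∀ m n → + (m ℕ.+ n) ≡ + m + + n
    pos-+ m n = refl

    pos-* : ∀ m n → + (m ℕ.* n) ≡ + m * + n
    pos-* = ℤₚ.pos-*

    <⇒+1≤ : ∀ {a b} → a < b → a + 1ℤ ≤ b
    <⇒+1≤ {a} {b} a<b = subst (_≤ b) (ℤₚ.+-comm 1ℤ a) (ℤₚ.i<j⇒suc[i]≤j a<b)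

    +1≤⇒< : ∀ {a b} → a + 1ℤ ≤ b → a < b
    +1≤⇒< {a} {b} h = ℤₚ.suc[i]≤j⇒i<j (subst (_≤ b) (ℤₚ.+-comm a 1ℤ) h)

  commutativeRing : CommutativeRing 0ℓ 0ℓ
  commutativeRing = record { isCommutativeRing = isCommutativeRing }

  ℤ-coefficients : CommutativeRing.rawRing ℤₚ.+-*-commutativeRing -Raw-AlmostCommutative⟶ fromCommutativeRing commutativeRing
  ℤ-coefficients = record
    { ⟦_⟧ = λ i → i ; +-homo = +-ℤ ; *-homo = *-ℤ ; -‿homo = neg-ℤ ; 0-homo = refl ; 1-homo = refl }

  coefficient≟ : (i j : ℤ) → Maybe (i ≡ j)
  coefficient≟ i j with i ℤₚ.≟ j
  ... | yes i≡j = just i≡j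
  ... | no  _   = nothing

  open RingSolver (CommutativeRing.rawRing ℤₚ.+-*-commutativeRing) (fromCommutativeRing commutativeRing) ℤ-coefficients coefficient≟
    using (solve; _:=_; _:+_; _:*_; _:-_; :-_; con)

  open CommutativeRing commutativeRing
    using (+-assoc; +-comm; +-identityˡ; +-identityʳ; *-assoc; *-comm; *-identityˡ; *-identityʳ; zeroˡ; zeroʳ; distribˡ)

  infixl 6 _⊕_
  _⊕_ : ∀ {a b} → 0ℤ ≤ a → 0ℤ ≤ b → 0ℤ ≤ a + b
  _⊕_ {a} {b} p q = subst (λ w → w ≤ a + b) (+-identityˡ 0ℤ) (+-mono-≤ p q)

  -- Inequalities are proved by exhibiting the difference of the two sides
  -- as a sum of products of nonnegative quantities.
  by-difference : ∀ {a b c} → b ≡ a + c → 0ℤ ≤ c → a ≤ b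
  by-difference {a} {b} {c} eq c≥0 =
    subst₂ _≤_ (+-identityʳ a) (sym eq) (+-mono-≤ (≤-refl {a}) c≥0)

  difference : ∀ {a b} → a ≤ b → 0ℤ ≤ b - a
  difference {a} {b} a≤b =
    subst (_≤ b - a) (solve 1 (λ a → a :- a := con 0ℤ) refl a) (+-mono-≤ a≤b (≤-refl { - a}))

  difference< : ∀ {a b} → a < b → 0ℤ ≤ b - a - 1ℤ
  difference< {a} {b} a<b = subst (0ℤ ≤_)
    (solve 2 (λ a b → b :- (a :+ con 1ℤ) := b :- a :- con 1ℤ) refl a b) (difference (<⇒+1≤ a<b))

  pos : ∀ n → 0ℤ ≤ + n
  pos n = +≤+ z≤n

  nonpos⇒neg-nonneg : ∀ {a} → a ≤ 0ℤ → 0ℤ ≤ - a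
  nonpos⇒neg-nonneg {a} a≤0 = subst (0ℤ ≤_) (solve 1 (λ a → con 0ℤ :- a := :- a) refl a) (difference a≤0)

  ∑ : List Idx → (Idx → ℤ) → ℤ
  ∑ []       f = 0ℤ
  ∑ (x ∷ xs) f = f x + ∑ xs f

  ∑-cong-All : ∀ {xs : List Idx} {f g} → All (λ x → f x ≡ g x) xs → ∑ xs f ≡ ∑ xs g
  ∑-cong-All []       = refl
  ∑-cong-All (p ∷ ps) = cong₂ _+_ p (∑-cong-All ps)

  ∑-cong : ∀ (xs : List Idx) {f g} → (∀ x → f x ≡ g x) → ∑ xs f ≡ ∑ xs g
  ∑-cong xs p = ∑-cong-All (All.universal p xs)

  ∑-mono-All : ∀ {xs : List Idx} {f g} → All (λ x → f x ≤ g x) xs → ∑ xs f ≤ ∑ xs g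
  ∑-mono-All []       = ≤-refl
  ∑-mono-All (p ∷ ps) = +-mono-≤ p (∑-mono-All ps)

  ∑-mono : ∀ (xs : List Idx) {f g} → (∀ x → f x ≤ g x) → ∑ xs f ≤ ∑ xs g
  ∑-mono xs p = ∑-mono-All (All.universal p xs)

  ∑-nonneg-All : ∀ {xs : List Idx} {f} → All (λ x → 0ℤ ≤ f x) xs → 0ℤ ≤ ∑ xs f
  ∑-nonneg-All []       = ≤-refl
  ∑-nonneg-All (p ∷ ps) = p ⊕ ∑-nonneg-All ps

  ∑-nonneg : ∀ (xs : List Idx) {f} → (∀ x → 0ℤ ≤ f x) → 0ℤ ≤ ∑ xs f
  ∑-nonneg xs p = ∑-nonneg-All (All.universal p xs)

  ∑-zero : ∀ (xs : List Idx) → ∑ xs (λ _ → 0ℤ) ≡ 0ℤ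
  ∑-zero []       = refl
  ∑-zero (x ∷ xs) = trans (+-identityˡ _) (∑-zero xs)

  ∑-+ : ∀ (xs : List Idx) f g → ∑ xs (λ x → f x + g x) ≡ ∑ xs f + ∑ xs g
  ∑-+ []       f g = sym (+-identityˡ 0ℤ)
  ∑-+ (x ∷ xs) f g = trans (cong (λ w → (f x + g x) + w) (∑-+ xs f g))
    (solve 4 (λ a b c d → a :+ b :+ (c :+ d) := a :+ c :+ (b :+ d)) refl (f x) (g x) (∑ xs f) (∑ xs g))

  ∑-* : ∀ (xs : List Idx) c f → ∑ xs (λ x → c * f x) ≡ c * ∑ xs f
  ∑-* []       c f = sym (zeroʳ c)
  ∑-* (x ∷ xs) c f = trans (cong (λ w → c * f x + w) (∑-* xs c f)) (sym (distribˡ c (f x) (∑ xs f)))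

  ∑-neg : ∀ (xs : List Idx) f → ∑ xs (λ x → - f x) ≡ - ∑ xs f
  ∑-neg []       f = solve 0 (con 0ℤ := :- con 0ℤ) refl
  ∑-neg (x ∷ xs) f = trans (cong (λ w → - f x + w) (∑-neg xs f))
    (solve 2 (λ a b → :- a :+ :- b := :- (a :+ b)) refl (f x) (∑ xs f))

  ∑-minus : ∀ (xs : List Idx) f g → ∑ xs (λ x → f x - g x) ≡ ∑ xs f - ∑ xs g
  ∑-minus xs f g = trans (∑-+ xs f (λ x → - g x)) (cong (λ w → ∑ xs f + w) (∑-neg xs g))

  ∑-const : ∀ (xs : List Idx) c → ∑ xs (λ _ → c) ≡ c * ∑ xs (λ _ → 1ℤ)
  ∑-const xs c = trans (∑-cong xs (λ _ → sym (*-identityʳ c))) (∑-* xs c (λ _ → 1ℤ))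

  ∑-swap : ∀ (xs : List Idx) (ys : List Idx′) (f : Idx → Idx′ → ℤ) → ∑ xs (λ x → ∑ ys (f x)) ≡ ∑ ys (λ y → ∑ xs (λ x → f x y))
  ∑-swap []       ys f = sym (∑-zero ys)
  ∑-swap (x ∷ xs) ys f = trans (cong (λ w → ∑ ys (f x) + w) (∑-swap xs ys f)) (sym (∑-+ ys (f x) _))

  ∑-map : ∀ (g : Idx → Idx′) xs f → ∑ (map g xs) f ≡ ∑ xs (λ x → f (g x))
  ∑-map g []       f = refl
  ∑-map g (x ∷ xs) f = cong (λ w → f (g x) + w) (∑-map g xs f)

  ∑-++ : ∀ (xs ys : List Idx) f → ∑ (xs ++ ys) f ≡ ∑ xs f + ∑ ys f
  ∑-++ []       ys f = sym (+-identityˡ _)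
  ∑-++ (x ∷ xs) ys f = trans (cong (λ w → f x + w) (∑-++ xs ys f)) (sym (+-assoc (f x) _ _))


  -- Subsets of a finite set

  fins : ∀ n → List (Fin n)
  fins zero    = []
  fins (suc n) = zero ∷ map suc (fins n)

  ind : Bool → ℤ
  ind true  = 1ℤ
  ind false = 0ℤ

  χ : Subset n → Fin n → ℤ
  χ U a = ind (lookup U a)

  wt : Subset n → (Fin n → ℤ) → ℤ
  wt {n} U e = ∑ (fins n) (λ a → χ U a * e a)

  size : Subset n → ℤ
  size {n} U = ∑ (fins n) (χ U)

  del ins : Subset n → Fin n → Subset n
  del U a = U [ a ]≔ false
  ins Z a = Z [ a ]≔ true

  subs : Subset n → ℕ → List (Subset n)
  subs []          zero    = [] ∷ []
  subs []          (suc k) = []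
  subs (false ∷ U) k       = map (false ∷_) (subs U k)
  subs (true ∷ U)  zero    = map (false ∷_) (subs U zero)
  subs (true ∷ U)  (suc k) = map (true ∷_) (subs U k) ++ map (false ∷_) (subs U (suc k))

  infix 4 _⊑_
  -- Inclusion is an equation between indicators, so that it can be rewritten inside integer sums.
  _⊑_ : Subset n → Subset n → Set
  Z ⊑ U = ∀ a → χ Z a * χ U a ≡ χ Z a

  N : Subset n → ℕ → ℤ
  N U k = ∑ (subs U k) (λ _ → 1ℤ)

  ∑-fins : ∀ (f : Fin (suc n) → ℤ) → ∑ (fins (suc n)) f ≡ f zero + ∑ (fins n) (λ a → f (suc a))
  ∑-fins {n} f = cong (λ w → f zero + w) (∑-map suc (fins n) f)

  size-wt : (U : Subset n) → size U ≡ wt U (λ _ → 1ℤ)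
  size-wt {n} U = ∑-cong (fins n) (λ a → sym (*-identityʳ (χ U a)))

  size-∣∣ : (U : Subset n) → size U ≡ + ∣ U ∣
  size-∣∣ []          = refl
  size-∣∣ (true ∷ U)  = trans (∑-fins (χ (true ∷ U))) (trans (cong (λ w → 1ℤ + w) (size-∣∣ U)) (sym (pos-+ 1 ∣ U ∣)))
  size-∣∣ (false ∷ U) = trans (∑-fins (χ (false ∷ U))) (trans (+-identityˡ _) (size-∣∣ U))

  χ-nonneg : (U : Subset n) (a : Fin n) → 0ℤ ≤ χ U a
  χ-nonneg U a with lookup U a
  ... | true  = pos 1
  ... | false = pos 0

  χ≤1 : (U : Subset n) (a : Fin n) → χ U a ≤ 1ℤ
  χ≤1 U a with lookup U a
  ... | true  = ≤-refl
  ... | false = pos 1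

  wt-ins : (Z : Subset n) (a : Fin n) (e : Fin n → ℤ) → wt (ins Z a) e ≡ wt Z e + (1ℤ - χ Z a) * e a
  wt-ins (b ∷ Z) zero e = trans (∑-fins (λ i → χ (true ∷ Z) i * e i)) (trans
    (solve 3 (λ b x w → con 1ℤ :* x :+ w := b :* x :+ w :+ (con 1ℤ :- b) :* x) refl (ind b) (e zero) (wt Z (λ i → e (suc i))))
    (cong (_+ (1ℤ - ind b) * e zero) (sym (∑-fins (λ i → χ (b ∷ Z) i * e i)))))
  wt-ins (b ∷ Z) (suc a) e = trans (∑-fins (λ i → χ (b ∷ ins Z a) i * e i)) (trans
    (cong (λ w → ind b * e zero + w) (wt-ins Z a (λ i → e (suc i)))) (trans
    (sym (+-assoc _ _ _))
    (cong (_+ (1ℤ - χ Z a) * e (suc a)) (sym (∑-fins (λ i → χ (b ∷ Z) i * e i))))))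

  wt-del : (U : Subset n) (a : Fin n) (e : Fin n → ℤ) → wt (del U a) e ≡ wt U e - χ U a * e a
  wt-del (b ∷ U) zero e = trans (∑-fins (λ i → χ (false ∷ U) i * e i)) (trans
    (solve 3 (λ b x w → con 0ℤ :* x :+ w := b :* x :+ w :- b :* x) refl (ind b) (e zero) (wt U (λ i → e (suc i))))
    (cong (_- ind b * e zero) (sym (∑-fins (λ i → χ (b ∷ U) i * e i)))))
  wt-del (b ∷ U) (suc a) e = trans (∑-fins (λ i → χ (b ∷ del U a) i * e i)) (trans
    (cong (λ w → ind b * e zero + w) (wt-del U a (λ i → e (suc i)))) (trans
    (sym (+-assoc _ _ _))
    (cong (_- χ U a * e (suc a)) (sym (∑-fins (λ i → χ (b ∷ U) i * e i))))))

  size-del : (U : Subset n) (a : Fin n) → lookup U a ≡ true → size (del U a) ≡ size U - 1ℤ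
  size-del U a a∈U = trans (size-wt (del U a)) (trans (wt-del U a (λ _ → 1ℤ))
    (cong₂ _-_ (sym (size-wt U)) (trans (*-identityʳ _) (cong ind a∈U))))

  χ-ins-self : (Z : Subset n) (a : Fin n) → χ (ins Z a) a ≡ 1ℤ
  χ-ins-self (b ∷ Z) zero    = refl
  χ-ins-self (b ∷ Z) (suc a) = χ-ins-self Z a

  χ-del-self : (Z : Subset n) (a : Fin n) → χ (del Z a) a ≡ 0ℤ
  χ-del-self (b ∷ Z) zero    = refl
  χ-del-self (b ∷ Z) (suc a) = χ-del-self Z a

  ⊑-∷ : ∀ {Z U : Subset n} {b c} → ind b * ind c ≡ ind b → Z ⊑ U → (b ∷ Z) ⊑ (c ∷ U)
  ⊑-∷ p q zero    = p
  ⊑-∷ p q (suc a) = q a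

  IsSub : Subset n → ℕ → Subset n → Set
  IsSub U k Z = Z ⊑ U × size Z ≡ + k

  subs-spec : (U : Subset n) (k : ℕ) → All (IsSub U k) (subs U k)
  subs-spec []          zero    = ((λ ()) , refl) ∷ []
  subs-spec []          (suc k) = []
  subs-spec (false ∷ U) k = Allₚ.map⁺ (All.map
    (λ {Z} (p , q) → ⊑-∷ (zeroʳ 0ℤ) p , trans (∑-fins (χ (false ∷ Z))) (trans (+-identityˡ _) q)) (subs-spec U k))
  subs-spec (true ∷ U) zero = Allₚ.map⁺ (All.map
    (λ {Z} (p , q) → ⊑-∷ (zeroˡ 1ℤ) p , trans (∑-fins (χ (false ∷ Z))) (trans (+-identityˡ _) q)) (subs-spec U zero))
  subs-spec (true ∷ U) (suc k) = Allₚ.++⁺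
    (Allₚ.map⁺ (All.map
      (λ {Z} (p , q) → ⊑-∷ (*-identityʳ 1ℤ) p , trans (∑-fins (χ (true ∷ Z))) (trans (cong (λ w → 1ℤ + w) q) (sym (pos-+ 1 k))))
      (subs-spec U k)))
    (Allₚ.map⁺ (All.map
      (λ {Z} (p , q) → ⊑-∷ (zeroˡ 1ℤ) p , trans (∑-fins (χ (false ∷ Z))) (trans (+-identityˡ _) q))
      (subs-spec U (suc k))))

  ∑ˢ-cong : ∀ (U : Subset n) k {φ ψ} → (∀ Z → IsSub U k Z → φ Z ≡ ψ Z) → ∑ (subs U k) φ ≡ ∑ (subs U k) ψ
  ∑ˢ-cong U k h = ∑-cong-All (All.map (λ {Z} → h Z) (subs-spec U k))

  ∑ˢ-mono : ∀ (U : Subset n) k {φ ψ} → (∀ Z → IsSub U k Z → φ Z ≤ ψ Z) → ∑ (subs U k) φ ≤ ∑ (subs U k) ψ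
  ∑ˢ-mono U k h = ∑-mono-All (All.map (λ {Z} → h Z) (subs-spec U k))

  subs-zero : (U : Subset n) (a : Fin n) → subs (del U a) 0 ≡ subs U 0
  subs-zero (true ∷ U)  zero    = refl
  subs-zero (false ∷ U) zero    = refl
  subs-zero (true ∷ U)  (suc a) = cong (map (false ∷_)) (subs-zero U a)
  subs-zero (false ∷ U) (suc a) = cong (map (false ∷_)) (subs-zero U a)

  ∑-subs-true : ∀ (U : Subset n) k φ →
    ∑ (subs (true ∷ U) (suc k)) φ ≡ ∑ (subs U k) (λ Z → φ (true ∷ Z)) + ∑ (subs U (suc k)) (λ Z → φ (false ∷ Z))
  ∑-subs-true U k φ = trans (∑-++ (map (true ∷_) (subs U k)) _ φ) (cong₂ _+_ (∑-map _ (subs U k) φ) (∑-map _ (subs U (suc k)) φ))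

  ∑-split : ∀ (U : Subset n) a k φ → lookup U a ≡ true →
    ∑ (subs U (suc k)) φ ≡ ∑ (subs (del U a) k) (λ Z → φ (ins Z a)) + ∑ (subs (del U a) (suc k)) φ
  ∑-split (true ∷ U) zero k φ refl = trans (∑-subs-true U k φ)
    (sym (cong₂ _+_ (∑-map (false ∷_) (subs U k) _) (∑-map (false ∷_) (subs U (suc k)) _)))
  ∑-split (false ∷ U) (suc a) k φ a∈U = trans (∑-map _ (subs U (suc k)) φ) (trans (∑-split U a k (λ Z → φ (false ∷ Z)) a∈U)
    (sym (cong₂ _+_ (∑-map (false ∷_) (subs (del U a) k) _) (∑-map (false ∷_) (subs (del U a) (suc k)) _))))
  ∑-split (true ∷ U) (suc a) zero φ a∈U = trans (∑-subs-true U 0 φ) (trans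
    (cong₂ _+_ (cong (λ l → ∑ l (λ Z → φ (true ∷ Z))) (sym (subs-zero U a))) (∑-split U a 0 (λ Z → φ (false ∷ Z)) a∈U)) (trans
    (solve 3 (λ x y z → x :+ (y :+ z) := y :+ (x :+ z)) refl _ _ _)
    (sym (cong₂ _+_ (∑-map (false ∷_) (subs (del U a) 0) _) (∑-subs-true (del U a) 0 φ)))))
  ∑-split (true ∷ U) (suc a) (suc k) φ a∈U = trans (∑-subs-true U (suc k) φ) (trans
    (cong₂ _+_ (∑-split U a k (λ Z → φ (true ∷ Z)) a∈U) (∑-split U a (suc k) (λ Z → φ (false ∷ Z)) a∈U)) (trans
    (solve 4 (λ x y z w → x :+ y :+ (z :+ w) := x :+ z :+ (y :+ w)) refl _ _ _ _)
    (sym (cong₂ _+_ (∑-subs-true (del U a) k (λ Z → φ (ins Z (suc a)))) (∑-subs-true (del U a) (suc k) φ)))))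

  χ-⊑-del : (U Z : Subset n) (a : Fin n) → Z ⊑ del U a → χ Z a ≡ 0ℤ
  χ-⊑-del U Z a p = trans (sym (p a)) (trans (cong (χ Z a *_) (χ-del-self U a)) (zeroʳ _))

  -- The right side runs over a list that depends on `a`; the left side runs over the fixed list
  -- `subs U k` and can be interchanged with a sum over `a`.
  ∑-avoiding : ∀ (U : Subset n) a k (φ : Subset n → ℤ) → lookup U a ≡ true →
    ∑ (subs U k) (λ Z → (1ℤ - χ Z a) * φ Z) ≡ ∑ (subs (del U a) k) φ
  ∑-avoiding {n} U a k φ a∈U = trans (drop-a k) (∑ˢ-cong (del U a) k λ Z (p , _) →
      trans (cong (λ c → (1ℤ - c) * φ Z) (χ-⊑-del U Z a p)) (solve 1 (λ x → (con 1ℤ :- con 0ℤ) :* x := x) refl (φ Z)))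
    where
    ψ : Subset n → ℤ
    ψ Z = (1ℤ - χ Z a) * φ Z
    drop-a : ∀ k → ∑ (subs U k) ψ ≡ ∑ (subs (del U a) k) ψ
    drop-a zero    = cong (λ l → ∑ l ψ) (sym (subs-zero U a))
    drop-a (suc k) = trans (∑-split U a k ψ a∈U) (trans
      (cong (_+ ∑ (subs (del U a) (suc k)) ψ) (trans
        (∑-cong (subs (del U a) k) (λ Z → trans (cong (λ c → (1ℤ - c) * φ (ins Z a)) (χ-ins-self Z a))
          (solve 1 (λ x → (con 1ℤ :- con 1ℤ) :* x := con 0ℤ) refl (φ (ins Z a)))))
        (∑-zero (subs (del U a) k))))
      (+-identityˡ _))

  ∑-containing : ∀ (U : Subset n) a k (φ : Subset n → ℤ) → lookup U a ≡ true →
    ∑ (subs U (suc k)) (λ Z → χ Z a * φ Z) ≡ ∑ (subs (del U a) k) (λ Z → φ (ins Z a))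
  ∑-containing U a k φ a∈U = trans (∑-split U a k (λ Z → χ Z a * φ Z) a∈U) (trans (cong₂ _+_
      (∑-cong (subs (del U a) k) (λ Z → trans (cong (λ c → c * φ (ins Z a)) (χ-ins-self Z a)) (*-identityˡ (φ (ins Z a)))))
      (trans (∑ˢ-cong (del U a) (suc k) λ Z (p , _) → trans (cong (λ c → c * φ Z) (χ-⊑-del U Z a p)) (zeroˡ (φ Z)))
        (∑-zero (subs (del U a) (suc k)))))
    (+-identityʳ _))

  -- Double counting of pairs of a (k+1)-set and one of its elements, listed by the k-set that
  -- remains without the element. Every recurrence in `k` below, for counts, moments and deletions,
  -- is an instance.
  ∑-exchange : ∀ (U : Subset n) k (φ : Subset n → ℤ) →
    (1ℤ + + k) * ∑ (subs U (suc k)) φ ≡ ∑ (subs U k) (λ Z → ∑ (fins n) (λ a → χ U a * ((1ℤ - χ Z a) * φ (ins Z a))))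
  ∑-exchange {n} U k φ = begin
    (1ℤ + + k) * ∑ (subs U (suc k)) φ
      ≡⟨ cong (λ c → c * ∑ (subs U (suc k)) φ) (pos-+ 1 k) ⟨
    + suc k * ∑ (subs U (suc k)) φ
      ≡⟨ ∑-* (subs U (suc k)) (+ suc k) φ ⟨
    ∑ (subs U (suc k)) (λ Z → + suc k * φ Z)
      ≡⟨ ∑ˢ-cong U (suc k) count ⟩
    ∑ (subs U (suc k)) (λ Z → ∑ (fins n) (λ a → χ U a * (χ Z a * φ Z)))
      ≡⟨ ∑-swap (subs U (suc k)) (fins n) _ ⟩
    ∑ (fins n) (λ a → ∑ (subs U (suc k)) (λ Z → χ U a * (χ Z a * φ Z)))
      ≡⟨ ∑-cong (fins n) at ⟩
    ∑ (fins n) (λ a → ∑ (subs U k) (λ Z → χ U a * ((1ℤ - χ Z a) * φ (ins Z a))))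
      ≡⟨ ∑-swap (subs U k) (fins n) _ ⟨
    ∑ (subs U k) (λ Z → ∑ (fins n) (λ a → χ U a * ((1ℤ - χ Z a) * φ (ins Z a)))) ∎
    where
    open ≡-Reasoning
    count : ∀ Z → IsSub U (suc k) Z → + suc k * φ Z ≡ ∑ (fins n) (λ a → χ U a * (χ Z a * φ Z))
    count Z (p , q) = trans (cong (_* φ Z) (sym q)) (trans (*-comm (size Z) (φ Z)) (trans (sym (∑-* (fins n) (φ Z) (χ Z)))
      (∑-cong (fins n) (λ a → trans (cong (φ Z *_) (sym (p a)))
        (solve 3 (λ f z u → f :* (z :* u) := u :* (z :* f)) refl (φ Z) (χ Z a) (χ U a))))))
    at : ∀ a → ∑ (subs U (suc k)) (λ Z → χ U a * (χ Z a * φ Z)) ≡ ∑ (subs U k) (λ Z → χ U a * ((1ℤ - χ Z a) * φ (ins Z a)))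
    at a with lookup U a in a∈U
    ... | false = trans (∑-cong (subs U (suc k)) (λ Z → zeroˡ (χ Z a * φ Z))) (trans (∑-zero (subs U (suc k)))
                    (sym (trans (∑-cong (subs U k) (λ Z → zeroˡ ((1ℤ - χ Z a) * φ (ins Z a)))) (∑-zero (subs U k)))))
    ... | true  = trans (∑-cong (subs U (suc k)) (λ Z → *-identityˡ (χ Z a * φ Z))) (trans (∑-containing U a k φ a∈U)
                    (trans (sym (∑-avoiding U a k (λ Z → φ (ins Z a)) a∈U)) (∑-cong (subs U k) (λ Z → sym (*-identityˡ ((1ℤ - χ Z a) * φ (ins Z a)))))))

  ∑-exchange-wt : ∀ (U : Subset n) k (F : ℤ → ℤ) e →
    (1ℤ + + k) * ∑ (subs U (suc k)) (λ Z → F (wt Z e)) ≡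
    ∑ (subs U k) (λ Z → ∑ (fins n) (λ a → χ U a * ((1ℤ - χ Z a) * F (wt Z e + e a))))
  ∑-exchange-wt {n} U k F e = trans (∑-exchange U k (λ Z → F (wt Z e)))
    (∑-cong (subs U k) λ Z → ∑-cong (fins n) λ a → cong (χ U a *_) (trans (cong (λ w → (1ℤ - χ Z a) * F w) (wt-ins Z a e)) (at Z a)))
    where
    at : ∀ Z a → (1ℤ - χ Z a) * F (wt Z e + (1ℤ - χ Z a) * e a) ≡ (1ℤ - χ Z a) * F (wt Z e + e a)
    at Z a with lookup Z a
    ... | true  = solve 2 (λ x y → (con 1ℤ :- con 1ℤ) :* x := (con 1ℤ :- con 1ℤ) :* y) refl _ _
    ... | false = cong (λ w → (1ℤ - 0ℤ) * F (wt Z e + w)) (solve 1 (λ x → (con 1ℤ :- con 0ℤ) :* x := x) refl (e a))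

  ∑-outside : ∀ (U Z : Subset n) e → Z ⊑ U → ∑ (fins n) (λ a → χ U a * ((1ℤ - χ Z a) * e a)) ≡ wt U e - wt Z e
  ∑-outside {n} U Z e p = trans (∑-cong (fins n) (λ a → trans
      (solve 3 (λ u z x → u :* ((con 1ℤ :- z) :* x) := u :* x :- z :* u :* x) refl (χ U a) (χ Z a) (e a))
      (cong (λ c → χ U a * e a - c * e a) (p a))))
    (∑-minus (fins n) (λ a → χ U a * e a) (λ a → χ Z a * e a))

  ∑-outside-1 : ∀ (U Z : Subset n) k → IsSub U k Z → ∑ (fins n) (λ a → χ U a * (1ℤ - χ Z a)) ≡ size U - + k
  ∑-outside-1 {n} U Z k (p , q) = trans (∑-cong (fins n) (λ a → cong (χ U a *_) (sym (*-identityʳ _))))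
    (trans (∑-outside U Z (λ _ → 1ℤ) p) (cong₂ _-_ (sym (size-wt U)) (trans (sym (size-wt Z)) q)))

  N-step : (U : Subset n) (k : ℕ) → (1ℤ + + k) * N U (suc k) ≡ (size U - + k) * N U k
  N-step {n} U k = trans (∑-exchange U k (λ _ → 1ℤ)) (trans
    (∑ˢ-cong U k λ Z s → trans (∑-cong (fins n) (λ a → cong (χ U a *_) (*-identityʳ _))) (∑-outside-1 U Z k s))
    (∑-const (subs U k) (size U - + k)))

  nC0≡1 : ∀ n → n C 0 ≡ 1
  nC0≡1 n = trans (nCk≡nC[n∸k] {0} {n} z≤n) (nCn≡1 n)

  N-C : (U : Subset n) (k : ℕ) → N U k ≡ + (∣ U ∣ C k)
  N-C []          zero    = +-identityʳ 1ℤ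
  N-C []          (suc k) = cong +_ (sym (k>n⇒nCk≡0 {0} {suc k} (s≤s z≤n)))
  N-C (false ∷ U) k       = trans (∑-map _ (subs U k) _) (N-C U k)
  N-C (true ∷ U)  zero    = trans (∑-map _ (subs U 0) _) (trans (N-C U 0) (cong +_ (trans (nC0≡1 ∣ U ∣) (sym (nC0≡1 (suc ∣ U ∣))))))
  N-C (true ∷ U)  (suc k) = trans (∑-subs-true U k _) (trans (cong₂ _+_ (N-C U k) (N-C U (suc k)))
    (trans (sym (pos-+ _ _)) (cong +_ (nCk+nC[k+1]≡[n+1]C[k+1] ∣ U ∣ k))))

  N-nonneg : (U : Subset n) (k : ℕ) → 0ℤ ≤ N U k
  N-nonneg U k = ∑-nonneg (subs U k) (λ _ → pos 1)

  ∑-subset-mono : ∀ (V U : Subset n) k φ → V ⊑ U → (∀ Z → 0ℤ ≤ φ Z) → ∑ (subs V k) φ ≤ ∑ (subs U k) φ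
  ∑-subset-mono [] [] k φ p h = ≤-refl
  ∑-subset-mono (true ∷ V) (false ∷ U) k φ p h with trans (sym (zeroʳ 1ℤ)) (p zero)
  ... | ()
  ∑-subset-mono (false ∷ V) (false ∷ U) k φ p h = subst₂ _≤_ (sym (∑-map _ (subs V k) φ)) (sym (∑-map _ (subs U k) φ))
    (∑-subset-mono V U k _ (λ a → p (suc a)) (λ Z → h (false ∷ Z)))
  ∑-subset-mono (false ∷ V) (true ∷ U) zero φ p h = subst₂ _≤_ (sym (∑-map _ (subs V 0) φ)) (sym (∑-map _ (subs U 0) φ))
    (∑-subset-mono V U 0 _ (λ a → p (suc a)) (λ Z → h (false ∷ Z)))
  ∑-subset-mono (true ∷ V) (true ∷ U) zero φ p h = subst₂ _≤_ (sym (∑-map _ (subs V 0) φ)) (sym (∑-map _ (subs U 0) φ))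
    (∑-subset-mono V U 0 _ (λ a → p (suc a)) (λ Z → h (false ∷ Z)))
  ∑-subset-mono (false ∷ V) (true ∷ U) (suc k) φ p h = subst₂ _≤_
    (trans (+-identityˡ _) (sym (∑-map _ (subs V (suc k)) φ))) (sym (∑-subs-true U k φ))
    (+-mono-≤ (∑-nonneg (subs U k) (λ Z → h (true ∷ Z))) (∑-subset-mono V U (suc k) _ (λ a → p (suc a)) (λ Z → h (false ∷ Z))))
  ∑-subset-mono (true ∷ V) (true ∷ U) (suc k) φ p h = subst₂ _≤_ (sym (∑-subs-true V k φ)) (sym (∑-subs-true U k φ))
    (+-mono-≤ (∑-subset-mono V U k _ (λ a → p (suc a)) (λ Z → h (true ∷ Z)))
              (∑-subset-mono V U (suc k) _ (λ a → p (suc a)) (λ Z → h (false ∷ Z))))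

  -- Moments of a random k-subset sum

  out : Subset n → Subset n → (Fin n → ℤ) → ℤ
  out {n} V Z f = ∑ (fins n) (λ a → χ V a * ((1ℤ - χ Z a) * f a))

  out-+ : ∀ (V Z : Subset n) f g → out V Z (λ a → f a + g a) ≡ out V Z f + out V Z g
  out-+ {n} V Z f g = trans (∑-cong (fins n) (λ a →
      solve 4 (λ u z x y → u :* (z :* (x :+ y)) := u :* (z :* x) :+ u :* (z :* y)) refl (χ V a) (1ℤ - χ Z a) (f a) (g a)))
    (∑-+ (fins n) _ _)

  out-* : ∀ (V Z : Subset n) c f → out V Z (λ a → c * f a) ≡ c * out V Z f
  out-* {n} V Z c f = trans (∑-cong (fins n) (λ a →
      solve 4 (λ u z c x → u :* (z :* (c :* x)) := c :* (u :* (z :* x))) refl (χ V a) (1ℤ - χ Z a) c (f a)))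
    (∑-* (fins n) c _)

  out-const : ∀ (V Z : Subset n) k c → IsSub V k Z → out V Z (λ _ → c) ≡ c * (size V - + k)
  out-const {n} V Z k c s = trans (∑-cong (fins n) (λ a →
      solve 3 (λ u z c → u :* (z :* c) := c :* (u :* z)) refl (χ V a) (1ℤ - χ Z a) c))
    (trans (∑-* (fins n) c _) (cong (λ w → c * w) (∑-outside-1 V Z k s)))

  out-linear : ∀ (V Z : Subset n) k c e → IsSub V k Z → out V Z (λ a → c + e a) ≡ c * (size V - + k) + (wt V e - wt Z e)
  out-linear V Z k c e s = trans (out-+ V Z (λ _ → c) e) (cong₂ _+_ (out-const V Z k c s) (∑-outside V Z e (proj₁ s)))

  out-quadratic : ∀ (V Z : Subset n) k c d₁ d₂ e f → IsSub V k Z →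
    out V Z (λ a → c + (d₁ * e a + d₂ * f a)) ≡ c * (size V - + k) + (d₁ * (wt V e - wt Z e) + d₂ * (wt V f - wt Z f))
  out-quadratic V Z k c d₁ d₂ e f s = trans (out-+ V Z (λ _ → c) _) (cong₂ _+_ (out-const V Z k c s)
    (trans (out-+ V Z (λ a → d₁ * e a) (λ a → d₂ * f a)) (cong₂ _+_
      (trans (out-* V Z d₁ e) (cong (λ w → d₁ * w) (∑-outside V Z e (proj₁ s))))
      (trans (out-* V Z d₂ f) (cong (λ w → d₂ * w) (∑-outside V Z f (proj₁ s)))))))

  out-mono : ∀ (V Z : Subset n) {f g : Fin n → ℤ} → (∀ a → χ V a * f a ≤ χ V a * g a) → out V Z f ≤ out V Z g
  out-mono {n} V Z {f} {g} h = ∑-mono (fins n) (λ a → by-difference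
    (solve 4 (λ u z x y → u :* (z :* y) := u :* (z :* x) :+ z :* (u :* y :- u :* x)) refl (χ V a) (1ℤ - χ Z a) (f a) (g a))
    (difference (χ≤1 Z a) ⊗ difference (h a)))

  wt-nonneg : (V : Subset n) (f : Fin n → ℤ) → (∀ a → 0ℤ ≤ f a) → 0ℤ ≤ wt V f
  wt-nonneg {n} V f h = ∑-nonneg (fins n) (λ a → χ-nonneg V a ⊗ h a)

  sq : (Fin n → ℤ) → Fin n → ℤ
  sq e a = e a * e a

  wt-sq-nonneg : (V : Subset n) (e : Fin n → ℤ) → 0ℤ ≤ wt V (sq e)
  wt-sq-nonneg V e = wt-nonneg V (sq e) (λ a → square-nonneg (e a))

  wt-subs-zero : (V : Subset n) (e : Fin n → ℤ) → All (λ Z → wt Z e ≡ 0ℤ) (subs V 0)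
  wt-subs-zero []          e = refl ∷ []
  wt-subs-zero (true ∷ V)  e = Allₚ.map⁺ (All.map (λ {Z} p → trans (∑-fins (λ a → χ (false ∷ Z) a * e a))
    (trans (cong₂ _+_ (zeroˡ (e zero)) p) (+-identityˡ 0ℤ))) (wt-subs-zero V (λ a → e (suc a))))
  wt-subs-zero (false ∷ V) e = Allₚ.map⁺ (All.map (λ {Z} p → trans (∑-fins (λ a → χ (false ∷ Z) a * e a))
    (trans (cong₂ _+_ (zeroˡ (e zero)) p) (+-identityˡ 0ℤ))) (wt-subs-zero V (λ a → e (suc a))))

  ∑-moment-zero : ∀ (V : Subset n) e (F : ℤ → ℤ) → F 0ℤ ≡ 0ℤ → ∑ (subs V 0) (λ Z → F (wt Z e)) ≡ 0ℤ
  ∑-moment-zero V e F F0 = trans (∑-cong-All (All.map (λ p → trans (cong F p) F0) (wt-subs-zero V e))) (∑-zero (subs V 0))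

  pow₄ : ℤ → ℤ
  pow₄ t = t * t * (t * t)

  M₁ M₂ M₄ : Subset n → (Fin n → ℤ) → ℕ → ℤ
  M₁ V e k = ∑ (subs V k) (λ Z → wt Z e)
  M₂ V e k = ∑ (subs V k) (λ Z → wt Z e * wt Z e)
  M₄ V e k = ∑ (subs V k) (λ Z → pow₄ (wt Z e))

  0<1+ : ∀ k → 0ℤ < 1ℤ + + k
  0<1+ k = subst (0ℤ <_) (pos-+ 1 k) (+<+ (s≤s z≤n))

  *-cancelˡ-≡ : ∀ {d a b} → 0ℤ < d → d * a ≡ d * b → a ≡ b
  *-cancelˡ-≡ d>0 eq = ℤₚ.≤-antisym (*-cancelˡ-≤ d>0 (≤-reflexive eq)) (*-cancelˡ-≤ d>0 (≤-reflexive (sym eq)))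

  M₁-formula : ∀ (V : Subset n) e k → size V * M₁ V e k ≡ + k * wt V e * N V k
  M₁-formula V e zero = trans (cong (λ w → size V * w) (∑-moment-zero V e (λ t → t) refl))
    (solve 3 (λ v p m → v :* con 0ℤ := con 0ℤ :* p :* m) refl (size V) (wt V e) (N V 0))
  M₁-formula V e (suc j) = *-cancelˡ-≡ (0<1+ j) (begin
    J₁ * (v * F′)                             ≡⟨ solve 3 (λ J v F → J :* (v :* F) := v :* (J :* F)) refl J₁ v F′ ⟩
    v * (J₁ * F′)                             ≡⟨ cong (λ w → v * w) step ⟩
    v * (F * (v - J - 1ℤ) + p * M)            ≡⟨ solve 5 (λ v J F p M → v :* (F :* (v :- J :- con 1ℤ) :+ p :* M) := (v :- J :- con 1ℤ) :* (v :* F) :+ v :* p :* M) refl v J F p M ⟩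
    (v - J - 1ℤ) * (v * F) + v * p * M        ≡⟨ cong (λ w → (v - J - 1ℤ) * w + v * p * M) (M₁-formula V e j) ⟩
    (v - J - 1ℤ) * (J * p * M) + v * p * M    ≡⟨ solve 4 (λ v J p M → (v :- J :- con 1ℤ) :* (J :* p :* M) :+ v :* p :* M := (con 1ℤ :+ J) :* p :* ((v :- J) :* M)) refl v J p M ⟩
    (1ℤ + J) * p * ((v - J) * M)              ≡⟨ cong (λ w → (1ℤ + J) * p * w) (N-step V j) ⟨
    (1ℤ + J) * p * (J₁ * M′)                  ≡⟨ solve 3 (λ J p M → J :* p :* (J :* M) := J :* (J :* p :* M)) refl J₁ p M′ ⟩
    J₁ * (J₁ * p * M′)                        ≡⟨ cong (λ w → J₁ * (w * p * M′)) (pos-+ 1 j) ⟨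
    J₁ * (+ suc j * p * M′)                   ∎)
    where
    open ≡-Reasoning
    v = size V ; J = + j ; J₁ = 1ℤ + + j ; p = wt V e ; F = M₁ V e j ; F′ = M₁ V e (suc j) ; M = N V j ; M′ = N V (suc j)
    step : J₁ * F′ ≡ F * (v - J - 1ℤ) + p * M
    step = trans (∑-exchange-wt V j (λ t → t) e) (trans (∑ˢ-cong V j λ Z s → trans (out-linear V Z j (wt Z e) e s)
        (solve 4 (λ S v J p → S :* (v :- J) :+ (p :- S) := (v :- J :- con 1ℤ) :* S :+ p) refl (wt Z e) v J p))
      (trans (∑-+ (subs V j) (λ Z → (v - J - 1ℤ) * wt Z e) (λ _ → p)) (cong₂ _+_
        (trans (∑-* (subs V j) (v - J - 1ℤ) (λ Z → wt Z e)) (*-comm (v - J - 1ℤ) F)) (∑-const (subs V j) p))))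

  -- The final bracket is the sum of squares outside Z: an element already in Z cannot be added
  -- again.
  M₂-step : ∀ (V : Subset n) e j → (1ℤ + + j) * M₂ V e (suc j) ≡
    (size V - + j - + 2) * M₂ V e j + (+ 2 * wt V e) * M₁ V e j + (wt V (sq e) * N V j - M₁ V (sq e) j)
  M₂-step V e j = trans (∑-exchange-wt V j (λ t → t * t) e) (trans (∑ˢ-cong V j λ Z s → trans
      (∑-cong (fins _) (λ a → cong (λ w → χ V a * ((1ℤ - χ Z a) * w))
        (solve 2 (λ S y → (S :+ y) :* (S :+ y) := S :* S :+ (con (+ 2) :* S :* y :+ con 1ℤ :* (y :* y))) refl (wt Z e) (e a))))
      (trans (out-quadratic V Z j (wt Z e * wt Z e) (+ 2 * wt Z e) 1ℤ e (sq e) s)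
      (solve 6 (λ S v J p q r → S :* S :* (v :- J) :+ (con (+ 2) :* S :* (p :- S) :+ con 1ℤ :* (q :- r))
          := (v :- J :- con (+ 2)) :* (S :* S) :+ (con (+ 2) :* p) :* S :+ (q :- r)) refl
        (wt Z e) (size V) (+ j) (wt V e) (wt V (sq e)) (wt Z (sq e)))))
    (trans (∑-+ (subs V j) _ (λ Z → wt V (sq e) - wt Z (sq e))) (cong₂ _+_
      (trans (∑-+ (subs V j) _ (λ Z → (+ 2 * wt V e) * wt Z e)) (cong₂ _+_
        (∑-* (subs V j) (size V - + j - + 2) (λ Z → wt Z e * wt Z e))
        (∑-* (subs V j) (+ 2 * wt V e) (λ Z → wt Z e))))
      (trans (∑-minus (subs V j) (λ _ → wt V (sq e)) (λ Z → wt Z (sq e)))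
        (cong (λ w → w - M₁ V (sq e) j) (∑-const (subs V j) (wt V (sq e))))))))

  M₂-nonneg : ∀ (V : Subset n) e k → 0ℤ ≤ M₂ V e k
  M₂-nonneg V e k = ∑-nonneg (subs V k) (λ Z → square-nonneg (wt Z e))

  M₁-sq-nonneg : ∀ (V : Subset n) e k → 0ℤ ≤ M₁ V (sq e) k
  M₁-sq-nonneg V e k = ∑-nonneg (subs V k) (λ Z → wt-sq-nonneg Z e)

  -- Here D plays the role of size V − k.
  M₂-upper : ∀ (V : Subset n) e D k → wt V e ≡ 0ℤ → 0ℤ ≤ D → D + + k ≤ size V → D * M₂ V e k ≤ + k * wt V (sq e) * N V k
  M₂-upper V e D zero p≡0 D≥0 D≤ = ≤-reflexive (trans
    (cong (λ w → D * w) (∑-moment-zero V e (λ t → t * t) (zeroˡ 0ℤ)))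
    (solve 3 (λ v p m → v :* con 0ℤ := con 0ℤ :* p :* m) refl D (wt V (sq e)) (N V 0)))
  M₂-upper V e D (suc j) p≡0 D≥0 D≤ = *-cancelˡ-≤ (0<1+ j) (by-difference
    (begin
      J₁ * (+ suc j * q * M′)  ≡⟨ cong (λ w → J₁ * (w * q * M′)) (pos-+ 1 j) ⟩
      J₁ * (J₁ * q * M′)       ≡⟨ solve 3 (λ J q M → J :* (J :* q :* M) := J :* q :* (J :* M)) refl J₁ q M′ ⟩
      J₁ * q * (J₁ * M′)       ≡⟨ cong (λ w → J₁ * q * w) (N-step V j) ⟩
      J₁ * q * ((v - J) * M)   ≡⟨ solve 7 (λ v J D q M B B′ → (con 1ℤ :+ J) :* q :* ((v :- J) :* M)
          := (con 1ℤ :+ J) :* (D :* B′) :+ (D :* ((v :- J) :* B :+ q :* M :- (con 1ℤ :+ J) :* B′) :+ (v :- J) :* (J :* q :* M :- D :* B) :+ (v :- J :- D) :* (q :* M))) refl v J D q M B B′ ⟩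
      J₁ * (D * B′) + (D * ((v - J) * B + q * M - J₁ * B′) + (v - J) * (J * q * M - D * B) + (v - J - D) * (q * M)) ∎)
    (D≥0 ⊗ difference step ⊕ v-J≥0 ⊗ difference (M₂-upper V e D j p≡0 D≥0 D+j≤v) ⊕ v-J-D≥0 ⊗ (wt-sq-nonneg V e ⊗ N-nonneg V j)))
    where
    open ≡-Reasoning
    v = size V ; J = + j ; J₁ = 1ℤ + + j ; q = wt V (sq e) ; M = N V j ; M′ = N V (suc j) ; B = M₂ V e j ; B′ = M₂ V e (suc j)
    -- `D` stays fixed along the induction on `k`, so its hypothesis only weakens.
    D+j≤v : D + + j ≤ size V
    D+j≤v = ≤-trans (by-difference (trans (cong (λ w → D + w) (pos-+ 1 j))
      (solve 2 (λ D J → D :+ (con 1ℤ :+ J) := D :+ J :+ con 1ℤ) refl D J)) (pos 1)) D≤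
    v-J-D≥0 : 0ℤ ≤ v - J - D
    v-J-D≥0 = subst (0ℤ ≤_) (solve 3 (λ v J D → v :- (D :+ J) := v :- J :- D) refl v J D) (difference D+j≤v)
    v-J≥0 : 0ℤ ≤ v - J
    v-J≥0 = subst (0ℤ ≤_) (solve 3 (λ v J D → v :- J :- D :+ D := v :- J) refl v J D) (v-J-D≥0 ⊕ D≥0)
    Q = M₁ V (sq e) j
    -- With total weight zero, the exact recurrence differs from this bound by `+ 2 * B + Q`, a sum
    -- of nonnegative moments.
    step : J₁ * B′ ≤ (v - J) * B + q * M
    step = by-difference
      (sym (trans (cong (λ w → w + (+ 2 * B + Q)) (trans (M₂-step V e j) (cong (λ p → (v - J - + 2) * B + (+ 2 * p) * M₁ V e j + (q * M - Q)) p≡0)))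
       (solve 7 (λ v J B F q M Q → (v :- J :- con (+ 2)) :* B :+ (con (+ 2) :* con 0ℤ) :* F :+ (q :* M :- Q) :+ (con (+ 2) :* B :+ Q) := (v :- J) :* B :+ q :* M) refl v J B (M₁ V e j) q M Q)))
      (pos 2 ⊗ M₂-nonneg V e j ⊕ M₁-sq-nonneg V e j)

  -- The exact mean square is (k/v) q (v - k)/(v - 1) plus a nonnegative multiple of p², and
  -- `3 k ≤ v` keeps more than half of the first factor (k/v) q. Total weight zero is not assumed,
  -- because p² only helps.
  M₂-lower : ∀ (V : Subset n) e k → 0ℤ ≤ size V → + 3 * + k ≤ size V → + k * wt V (sq e) * N V k ≤ + 2 * size V * M₂ V e k
  M₂-lower V e zero v≥0 _ = ≤-reflexive (sym (trans
    (cong (λ w → + 2 * size V * w) (∑-moment-zero V e (λ t → t * t) (zeroˡ 0ℤ)))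
    (solve 3 (λ v p m → con (+ 2) :* v :* con 0ℤ := con 0ℤ :* p :* m) refl (size V) (wt V (sq e)) (N V 0))))
  M₂-lower V e (suc j) v≥0 3k≤v = *-cancelˡ-≤ (0<1+ j) (by-difference
    (begin
      J₁ * (+ 2 * v * B′)
        ≡⟨ solve 3 (λ J v B → J :* (con (+ 2) :* v :* B) := con (+ 2) :* v :* (J :* B)) refl J₁ v B′ ⟩
      + 2 * v * (J₁ * B′)
        ≡⟨ cong (λ w → + 2 * v * w) (M₂-step V e j) ⟩
      + 2 * v * ((v - J - + 2) * B + (+ 2 * p) * F + (q * M - Q))
        ≡⟨ solve 8 (λ v J B p F q M Q → con (+ 2) :* v :* ((v :- J :- con (+ 2)) :* B :+ (con (+ 2) :* p) :* F :+ (q :* M :- Q))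
           := con (+ 2) :* v :* ((v :- J :- con (+ 2)) :* B :+ q :* M) :+ con (+ 4) :* p :* (v :* F) :- con (+ 2) :* (v :* Q)) refl v J B p F q M Q ⟩
      + 2 * v * ((v - J - + 2) * B + q * M) + + 4 * p * (v * F) - + 2 * (v * Q)
        ≡⟨ cong₂ (λ f q′ → + 2 * v * ((v - J - + 2) * B + q * M) + + 4 * p * f - + 2 * q′) (M₁-formula V e j) (M₁-formula V (sq e) j) ⟩
      + 2 * v * ((v - J - + 2) * B + q * M) + + 4 * p * (J * p * M) - + 2 * (J * q * M)
        ≡⟨ solve 6 (λ v J B p q M → con (+ 2) :* v :* ((v :- J :- con (+ 2)) :* B :+ q :* M) :+ con (+ 4) :* p :* (J :* p :* M) :- con (+ 2) :* (J :* q :* M)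
           := (con 1ℤ :+ J) :* q :* ((v :- J) :* M) :+ ((v :- con (+ 3) :* (con 1ℤ :+ J) :+ (con (+ 2) :* J :+ con 1ℤ)) :* (con (+ 2) :* v :* B :- J :* q :* M) :+ con (+ 4) :* J :* (p :* p) :* M :+ (v :- con (+ 3) :* (con 1ℤ :+ J) :+ con (+ 3)) :* (q :* M))) refl v J B p q M ⟩
      J₁ * q * ((v - J) * M) + R
        ≡⟨ cong (λ w → J₁ * q * w + R) (N-step V j) ⟨
      J₁ * q * (J₁ * M′) + R
        ≡⟨ cong (λ w → w + R) (solve 3 (λ J q M → J :* q :* (J :* M) := J :* (J :* q :* M)) refl J₁ q M′) ⟩
      J₁ * (J₁ * q * M′) + R
        ≡⟨ cong (λ w → J₁ * (w * q * M′) + R) (pos-+ 1 j) ⟨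
      J₁ * (+ suc j * q * M′) + R ∎)
    ((v-3k≥0 ⊕ (pos 2 ⊗ pos j ⊕ pos 1)) ⊗ difference (M₂-lower V e j v≥0 (≤-trans 3j≤3k 3k≤v))
      ⊕ pos 4 ⊗ pos j ⊗ square-nonneg p ⊗ N-nonneg V j ⊕ (v-3k≥0 ⊕ pos 3) ⊗ (wt-sq-nonneg V e ⊗ N-nonneg V j)))
    where
    open ≡-Reasoning
    v = size V ; J = + j ; J₁ = 1ℤ + + j ; p = wt V e ; q = wt V (sq e) ; M = N V j ; M′ = N V (suc j)
    B = M₂ V e j ; B′ = M₂ V e (suc j) ; F = M₁ V e j ; Q = M₁ V (sq e) j
    R = (v - + 3 * (1ℤ + J) + (+ 2 * J + 1ℤ)) * (+ 2 * v * B - J * q * M) + + 4 * J * (p * p) * M + (v - + 3 * (1ℤ + J) + + 3) * (q * M)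
    v-3k≥0 : 0ℤ ≤ v - + 3 * (1ℤ + J)
    v-3k≥0 = difference (subst (λ w → + 3 * w ≤ v) (pos-+ 1 j) 3k≤v)
    3j≤3k : + 3 * + j ≤ + 3 * + suc j
    3j≤3k = by-difference (trans (cong (λ w → + 3 * w) (pos-+ 1 j)) (solve 1 (λ J → con (+ 3) :* (con 1ℤ :+ J) := con (+ 3) :* J :+ con (+ 3)) refl J)) (pos 3)

  -- From 4 S y³ ≤ 2 S² y² + 2 y⁴.
  pow₄-+-bound : ∀ S y → pow₄ (S + y) ≤ pow₄ S + (+ 4 * (S * S * S) * y + (+ 8 * (S * S) * (y * y) + + 3 * (y * y * (y * y))))
  pow₄-+-bound S y = by-difference
    (solve 2 (λ S y → S :* S :* (S :* S) :+ (con (+ 4) :* (S :* S :* S) :* y :+ (con (+ 8) :* (S :* S) :* (y :* y) :+ con (+ 3) :* (y :* y :* (y :* y))))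
       := (S :+ y) :* (S :+ y) :* ((S :+ y) :* (S :+ y)) :+ con (+ 2) :* ((S :* y :- y :* y) :* (S :* y :- y :* y))) refl S y)
    (pos 2 ⊗ square-nonneg (S * y - y * y))

  M₄-step : ∀ (V : Subset n) e R j → wt V e ≡ 0ℤ → 0ℤ ≤ R → (∀ a → χ V a * sq e a ≤ χ V a * R) →
    (1ℤ + + j) * M₄ V e (suc j) ≤ (size V - + j) * M₄ V e j + + 8 * wt V (sq e) * M₂ V e j + + 3 * R * wt V (sq e) * N V j
  M₄-step {n} V e R j p≡0 R≥0 bound = ≤-trans (≤-reflexive (∑-exchange-wt V j pow₄ e)) (≤-trans (∑ˢ-mono V j at)
    (≤-reflexive (trans (∑-+ (subs V j) _ (λ _ → + 3 * R * q)) (cong₂ _+_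
      (trans (∑-+ (subs V j) _ (λ Z → + 8 * q * (wt Z e * wt Z e))) (cong₂ _+_
        (∑-* (subs V j) (size V - + j) (λ Z → pow₄ (wt Z e)))
        (∑-* (subs V j) (+ 8 * q) (λ Z → wt Z e * wt Z e))))
      (∑-const (subs V j) (+ 3 * R * q))))))
    where
    q = wt V (sq e)
    at : ∀ Z → IsSub V j Z → out V Z (λ a → pow₄ (wt Z e + e a)) ≤ (size V - + j) * pow₄ (wt Z e) + + 8 * q * (wt Z e * wt Z e) + + 3 * R * q
    at Z s = ≤-trans (out-mono V Z pointwise) (≤-trans
      (≤-reflexive (out-quadratic V Z j (pow₄ S) (+ 4 * (S * S * S)) (+ 8 * (S * S) + + 3 * R) e (sq e) s))
      (by-difference
        (trans (solve 6 (λ S v J q r R → (v :- J) :* (S :* S :* (S :* S)) :+ con (+ 8) :* q :* (S :* S) :+ con (+ 3) :* R :* q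
            := S :* S :* (S :* S) :* (v :- J) :+ (con (+ 4) :* (S :* S :* S) :* (con 0ℤ :- S) :+ (con (+ 8) :* (S :* S) :+ con (+ 3) :* R) :* (q :- r))
               :+ (con (+ 4) :* (S :* S :* (S :* S)) :+ (con (+ 8) :* (S :* S) :+ con (+ 3) :* R) :* r)) refl S (size V) (+ j) q (wt Z (sq e)) R)
          (cong (λ w → pow₄ S * (size V - + j) + (+ 4 * (S * S * S) * (w - S) + (+ 8 * (S * S) + + 3 * R) * (q - wt Z (sq e)))
               + (+ 4 * pow₄ S + (+ 8 * (S * S) + + 3 * R) * wt Z (sq e))) (sym p≡0)))
        (pos 4 ⊗ square-nonneg (S * S) ⊕ (pos 8 ⊗ square-nonneg S ⊕ pos 3 ⊗ R≥0) ⊗ wt-sq-nonneg Z e)))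
      where
      S = wt Z e
      pointwise : ∀ a → χ V a * pow₄ (S + e a) ≤ χ V a * (pow₄ S + (+ 4 * (S * S * S) * e a + (+ 8 * (S * S) + + 3 * R) * sq e a))
      pointwise a = by-difference
        (solve 5 (λ u S y R p → u :* (S :* S :* (S :* S) :+ (con (+ 4) :* (S :* S :* S) :* y :+ (con (+ 8) :* (S :* S) :+ con (+ 3) :* R) :* (y :* y)))
           := u :* p :+ (u :* (S :* S :* (S :* S) :+ (con (+ 4) :* (S :* S :* S) :* y :+ (con (+ 8) :* (S :* S) :* (y :* y) :+ con (+ 3) :* (y :* y :* (y :* y)))) :- p)
              :+ con (+ 3) :* (y :* y) :* (u :* R :- u :* (y :* y)))) refl (χ V a) S (e a) R (pow₄ (S + e a)))
        (χ-nonneg V a ⊗ difference (pow₄-+-bound S (e a)) ⊕ pos 3 ⊗ square-nonneg (e a) ⊗ difference (bound a))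

  -- The recurrence contributes 8 q times a second moment of at most j q / D per set; summing 8 j
  -- over j < k gives the coefficient 4 of k².
  M₄-upper : ∀ (V : Subset n) e R D k → wt V e ≡ 0ℤ → 0ℤ ≤ R → (∀ a → χ V a * sq e a ≤ χ V a * R) → 0ℤ ≤ D → D + + k ≤ size V →
    D * D * M₄ V e k ≤ N V k * (+ 4 * (+ k * + k) * (wt V (sq e) * wt V (sq e)) + + 3 * + k * D * R * wt V (sq e))
  M₄-upper V e R D zero p≡0 R≥0 bound D≥0 D≤ = ≤-reflexive (trans
    (cong (λ w → D * D * w) (∑-moment-zero V e pow₄ (trans (cong (λ w → w * w) (zeroˡ 0ℤ)) (zeroˡ 0ℤ))))
    (solve 4 (λ D q m R → D :* D :* con 0ℤ := m :* (con (+ 4) :* (con 0ℤ :* con 0ℤ) :* (q :* q) :+ con (+ 3) :* con 0ℤ :* D :* R :* q)) refl D (wt V (sq e)) (N V 0) R))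
  M₄-upper V e R D (suc j) p≡0 R≥0 bound D≥0 D≤ = *-cancelˡ-≤ (0<1+ j) (by-difference
    (begin
      J₁ * (M′ * (+ 4 * (+ suc j * + suc j) * (q * q) + + 3 * + suc j * D * R * q))
        ≡⟨ cong (λ w → J₁ * (M′ * (+ 4 * (w * w) * (q * q) + + 3 * w * D * R * q))) (pos-+ 1 j) ⟩
      J₁ * (M′ * (+ 4 * (J₁ * J₁) * (q * q) + + 3 * J₁ * D * R * q))
        ≡⟨ *-assoc J₁ M′ _ ⟨
      J₁ * M′ * (+ 4 * (J₁ * J₁) * (q * q) + + 3 * J₁ * D * R * q)
        ≡⟨ cong (λ w → w * (+ 4 * (J₁ * J₁) * (q * q) + + 3 * J₁ * D * R * q)) (N-step V j) ⟩
      (v - J) * M * (+ 4 * (J₁ * J₁) * (q * q) + + 3 * J₁ * D * R * q)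
        ≡⟨ solve 9 (λ v J D R q M A A′ B → (v :- J) :* M :* (con (+ 4) :* ((con 1ℤ :+ J) :* (con 1ℤ :+ J)) :* (q :* q) :+ con (+ 3) :* (con 1ℤ :+ J) :* D :* R :* q)
           := (con 1ℤ :+ J) :* (D :* D :* A′)
           :+ (D :* D :* ((v :- J) :* A :+ con (+ 8) :* q :* B :+ con (+ 3) :* R :* q :* M :- (con 1ℤ :+ J) :* A′)
           :+ (v :- J) :* (M :* (con (+ 4) :* (J :* J) :* (q :* q) :+ con (+ 3) :* J :* D :* R :* q) :- D :* D :* A)
           :+ con (+ 8) :* q :* D :* (J :* q :* M :- D :* B)
           :+ (con (+ 8) :* J :* (q :* q) :* M :* (v :- J :- D) :+ con (+ 4) :* (v :- J) :* M :* (q :* q) :+ con (+ 3) :* D :* R :* q :* M :* (v :- J :- D)))) refl v J D R q M A A′ B ⟩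
      J₁ * (D * D * A′) + T ∎)
    (D≥0 ⊗ D≥0 ⊗ difference (M₄-step V e R j p≡0 R≥0 bound)
     ⊕ v-J≥0 ⊗ difference (M₄-upper V e R D j p≡0 R≥0 bound D≥0 D+j≤v)
     ⊕ pos 8 ⊗ q≥0 ⊗ D≥0 ⊗ difference (M₂-upper V e D j p≡0 D≥0 D+j≤v)
     ⊕ (pos 8 ⊗ pos j ⊗ (q≥0 ⊗ q≥0) ⊗ M≥0 ⊗ v-J-D≥0 ⊕ pos 4 ⊗ v-J≥0 ⊗ M≥0 ⊗ (q≥0 ⊗ q≥0) ⊕ pos 3 ⊗ D≥0 ⊗ R≥0 ⊗ q≥0 ⊗ M≥0 ⊗ v-J-D≥0)))
    where
    open ≡-Reasoning
    v = size V ; J = + j ; J₁ = 1ℤ + + j ; q = wt V (sq e) ; M = N V j ; M′ = N V (suc j)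
    A = M₄ V e j ; A′ = M₄ V e (suc j) ; B = M₂ V e j
    q≥0 = wt-sq-nonneg V e
    M≥0 = N-nonneg V j
    T = D * D * ((v - J) * A + + 8 * q * B + + 3 * R * q * M - J₁ * A′)
        + (v - J) * (M * (+ 4 * (J * J) * (q * q) + + 3 * J * D * R * q) - D * D * A)
        + + 8 * q * D * (J * q * M - D * B)
        + (+ 8 * J * (q * q) * M * (v - J - D) + + 4 * (v - J) * M * (q * q) + + 3 * D * R * q * M * (v - J - D))
    D+j≤v : D + + j ≤ size V
    D+j≤v = ≤-trans (by-difference (trans (cong (λ w → D + w) (pos-+ 1 j))
      (solve 2 (λ D J → D :+ (con 1ℤ :+ J) := D :+ J :+ con 1ℤ) refl D J)) (pos 1)) D≤
    v-J-D≥0 : 0ℤ ≤ v - J - D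
    v-J-D≥0 = subst (0ℤ ≤_) (solve 3 (λ v J D → v :- (D :+ J) := v :- J :- D) refl v J D) (difference D+j≤v)
    v-J≥0 : 0ℤ ≤ v - J
    v-J≥0 = subst (0ℤ ≤_) (solve 3 (λ v J D → v :- J :- D :+ D := v :- J) refl v J D) (v-J-D≥0 ⊕ D≥0)

  -- Weights spread over many elements

  nonneg : ℤ → ℤ
  nonneg t with 0ℤ ≤? t
  ... | yes _ = 1ℤ
  ... | no  _ = 0ℤ

  nonneg-cases : ∀ t → (0ℤ ≤ t × nonneg t ≡ 1ℤ) ⊎ (t < 0ℤ × nonneg t ≡ 0ℤ)
  nonneg-cases t with 0ℤ ≤? t
  ... | yes t≥0 = inj₁ (t≥0 , refl)
  ... | no  t≱0 = inj₂ (ℤₚ.≰⇒> t≱0 , refl)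

  nonneg-nonneg : ∀ t → 0ℤ ≤ nonneg t
  nonneg-nonneg t with 0ℤ ≤? t
  ... | yes _ = pos 1
  ... | no  _ = pos 0

  nonneg≤1 : ∀ t → nonneg t ≤ 1ℤ
  nonneg≤1 t with 0ℤ ≤? t
  ... | yes _ = ≤-refl
  ... | no  _ = pos 1

  wt-affine : ∀ (Z : Subset n) c d x → wt Z (λ a → c * x a - d) ≡ c * wt Z x - d * size Z
  wt-affine {n} Z c d x = trans (∑-cong (fins n) (λ a →
      solve 4 (λ z c x d → z :* (c :* x :- d) := c :* (z :* x) :- d :* z) refl (χ Z a) c (x a) d))
    (trans (∑-minus (fins n) _ _) (cong₂ _-_ (∑-* (fins n) c _) (∑-* (fins n) d (χ Z))))

  -- The deviation from the mean weight, multiplied by `size V` to remain an integer.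
  centred : Subset n → (Fin n → ℤ) → Fin n → ℤ
  centred V x a = size V * x a - wt V x

  wt-centred : (V : Subset n) (x : Fin n → ℤ) → wt V (centred V x) ≡ 0ℤ
  wt-centred V x = trans (wt-affine V (size V) (wt V x) x) (solve 2 (λ v p → v :* p :- p :* v := con 0ℤ) refl (size V) (wt V x))

  wt-centred-sub : ∀ (V Z : Subset n) x k → IsSub V k Z → wt Z (centred V x) ≡ size V * wt Z x - wt V x * + k
  wt-centred-sub V Z x k s = trans (wt-affine Z (size V) (wt V x) x) (cong (λ w → size V * wt Z x - wt V x * w) (proj₂ s))

  wt-sq-centred : (V : Subset n) (x : Fin n → ℤ) → wt V (sq (centred V x)) ≡ size V * size V * wt V (sq x) - size V * (wt V x * wt V x)
  wt-sq-centred {n} V x = begin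
    wt V (sq (centred V x))
      ≡⟨ ∑-cong (fins n) (λ a → solve 4 (λ z v x p → z :* ((v :* x :- p) :* (v :* x :- p))
           := v :* v :* (z :* (x :* x)) :+ ((:- (con (+ 2) :* v :* p)) :* (z :* x) :+ p :* p :* z)) refl (χ V a) v (x a) p) ⟩
    ∑ (fins n) (λ a → v * v * (χ V a * sq x a) + (- (+ 2 * v * p) * (χ V a * x a) + p * p * χ V a))
      ≡⟨ trans (∑-+ (fins n) _ _) (cong₂ _+_ (∑-* (fins n) (v * v) _)
           (trans (∑-+ (fins n) _ _) (cong₂ _+_ (∑-* (fins n) (- (+ 2 * v * p)) _) (∑-* (fins n) (p * p) _)))) ⟩
    v * v * q + (- (+ 2 * v * p) * p + p * p * v)
      ≡⟨ solve 3 (λ v q p → v :* v :* q :+ ((:- (con (+ 2) :* v :* p)) :* p :+ p :* p :* v) := v :* v :* q :- v :* (p :* p)) refl v q p ⟩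
    v * v * q - v * (p * p) ∎
    where
    open ≡-Reasoning
    v = size V ; p = wt V x ; q = wt V (sq x)

  size-nonneg : (V : Subset n) → 0ℤ ≤ size V
  size-nonneg {n} V = ∑-nonneg (fins n) (χ-nonneg V)

  wt-sq-centred-≤ : (V : Subset n) (x : Fin n → ℤ) → wt V (sq (centred V x)) ≤ size V * size V * wt V (sq x)
  wt-sq-centred-≤ V x = by-difference
    (trans (solve 3 (λ v q p → v :* v :* q := v :* v :* q :- v :* (p :* p) :+ v :* (p :* p)) refl (size V) (wt V (sq x)) (wt V x))
      (cong (λ w → w + size V * (wt V x * wt V x)) (sym (wt-sq-centred V x))))
    (size-nonneg V ⊗ square-nonneg (wt V x))

  -- `F` is meant as the indicator of an event that forces a squared deviation of at least `θ`.
  -- Centring only lowers the second moment, so the bound is stated with the uncentred one.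
  chebyshev : ∀ (V : Subset n) x k D θ (F : Subset n → ℤ) → 0ℤ ≤ D → D + + k ≤ size V →
    (∀ Z → IsSub V k Z → θ * F Z ≤ wt Z (centred V x) * wt Z (centred V x)) →
    D * (θ * ∑ (subs V k) F) ≤ + k * (size V * size V * wt V (sq x)) * N V k
  chebyshev V x k D θ F D≥0 D≤ h = ≤-trans
    (by-difference (solve 3 (λ D a b → D :* b := D :* a :+ D :* (b :- a)) refl D (θ * ∑ (subs V k) F) (M₂ V e k))
      (D≥0 ⊗ difference (≤-trans (≤-reflexive (sym (∑-* (subs V k) θ F))) (∑ˢ-mono V k h))))
    (≤-trans (M₂-upper V e D k (wt-centred V x) D≥0 D≤)
      (by-difference (solve 4 (λ k q y m → k :* y :* m := k :* q :* m :+ k :* m :* (y :- q)) refl (+ k) (wt V (sq e)) (size V * size V * wt V (sq x)) (N V k))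
        (pos k ⊗ N-nonneg V k ⊗ difference (wt-sq-centred-≤ V x))))
    where e = centred V x

  square-mono : ∀ {a b} → 0ℤ ≤ a → a ≤ b → a * a ≤ b * b
  square-mono {a} {b} a≥0 a≤b = by-difference
    (solve 2 (λ a b → b :* b := a :* a :+ (b :- a) :* (con (+ 2) :* a :+ (b :- a))) refl a b)
    (difference a≤b ⊗ (pos 2 ⊗ a≥0 ⊕ difference a≤b))

  ∑-complement : ∀ (V : Subset n) k (F : Subset n → ℤ) → ∑ (subs V k) (λ Z → 1ℤ - F Z) ≡ N V k - ∑ (subs V k) F
  ∑-complement V k F = ∑-minus (subs V k) (λ _ → 1ℤ) F

  -- `V` stands for the set left after truncation at scale `T`. The mean term in `q-lower` makes up
  -- for the variance carried by the elements that were cut.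
  module Spread (V : Subset n) (x : Fin n → ℤ) (k : ℕ) (T : ℤ) (T>0 : 0ℤ < T) (v>0 : 0ℤ < size V)
    (x≤T : ∀ a → χ V a * x a ≤ χ V a * T) (x²≤T² : ∀ a → χ V a * sq x a ≤ χ V a * (T * T))
    (p≥0 : 0ℤ ≤ wt V x) (3k≤v : + 3 * + k ≤ size V)
    (q-upper : + 20 * + k * wt V (sq x) ≤ T * T * size V)
    (q-lower : T * T * size V ≤ + 160 * + k * (wt V (sq x) + T * wt V x)) where

    private
      v = size V ; p = wt V x ; q = wt V (sq x) ; K = + k ; M = N V k ; D = size V - + k ; e = centred V x
      G = ∑ (subs V k) (λ Z → nonneg (wt Z x))
      T≥0 = ℤₚ.<⇒≤ T>0
      v≥0 = ℤₚ.<⇒≤ v>0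
      q≥0 = wt-sq-nonneg V x
      M≥0 = N-nonneg V k
      3D-2v : 0ℤ ≤ + 3 * D - + 2 * v
      3D-2v = subst (0ℤ ≤_) (solve 2 (λ v K → v :- con (+ 3) :* K := con (+ 3) :* (v :- K) :- con (+ 2) :* v) refl v K) (difference 3k≤v)
      D>0 : 0ℤ < D
      D>0 = ℤₚ.≰⇒> λ D≤0 → ℤₚ.<⇒≱ v>0 (*-cancelˡ-≤ {+ 2} (+<+ (s≤s z≤n))
        (by-difference (solve 2 (λ v D → con (+ 2) :* con 0ℤ := con (+ 2) :* v :+ ((con (+ 3) :* D :- con (+ 2) :* v) :+ con (+ 3) :* (:- D))) refl v D)
          (3D-2v ⊕ pos 3 ⊗ nonpos⇒neg-nonneg D≤0)))
      D≥0 = ℤₚ.<⇒≤ D>0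
      D+k≤v : D + + k ≤ v
      D+k≤v = ≤-reflexive (solve 2 (λ v K → v :- K :+ K := v) refl v K)

    -- A negative sum lies at least T below the mean K p / v. By `q-upper` and 2 v ≤ 3 D this
    -- happens for at most 3/40 of the sets.
    many-if-mean-large : v * T ≤ K * p → + 37 * M ≤ + 40 * G
    many-if-mean-large vT≤kp = *-cancelˡ-≤ D>0 (by-difference
      (solve 4 (λ D v M G → D :* (con (+ 40) :* G) := D :* (con (+ 37) :* M) :+ (con (+ 2) :* (v :* M :- con (+ 20) :* (D :* (M :- G))) :+ (con (+ 3) :* D :- con (+ 2) :* v) :* M)) refl D v M G)
      (pos 2 ⊗ difference fails ⊕ 3D-2v ⊗ M≥0))
      where
      θ = v * T * (v * T)
      cheb : D * (θ * (M - G)) ≤ K * (v * v * q) * M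
      cheb = subst (λ w → D * (θ * w) ≤ K * (v * v * q) * M) (∑-complement V k (λ Z → nonneg (wt Z x)))
        (chebyshev V x k D θ (λ Z → 1ℤ - nonneg (wt Z x)) D≥0 D+k≤v at)
        where
        at : ∀ Z → IsSub V k Z → θ * (1ℤ - nonneg (wt Z x)) ≤ wt Z e * wt Z e
        at Z s with nonneg-cases (wt Z x)
        ... | inj₁ (_ , eq) = subst (λ w → θ * (1ℤ - w) ≤ wt Z e * wt Z e) (sym eq)
                (subst (_≤ wt Z e * wt Z e) (solve 1 (λ t → con 0ℤ := t :* (con 1ℤ :- con 1ℤ)) refl θ) (square-nonneg (wt Z e)))
        ... | inj₂ (S<0 , eq) = subst (λ w → θ * (1ℤ - w) ≤ wt Z e * wt Z e) (sym eq)
                (subst₂ _≤_ (solve 1 (λ t → t := t :* (con 1ℤ :- con 0ℤ)) refl θ)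
                  (solve 1 (λ s → (:- s) :* (:- s) := s :* s) refl (wt Z e))
                  (square-mono (v≥0 ⊗ T≥0) (by-difference
                    (trans (cong -_ (wt-centred-sub V Z x k s))
                      (solve 5 (λ v S p K T → :- (v :* S :- p :* K) := v :* T :+ ((K :* p :- v :* T) :+ v :* (:- S))) refl v (wt Z x) p K T))
                    (difference vT≤kp ⊕ v≥0 ⊗ nonpos⇒neg-nonneg (ℤₚ.<⇒≤ S<0)))))
      fails : + 20 * (D * (M - G)) ≤ v * M
      fails = *-cancelˡ-≤ (*-pos (*-pos v>0 T>0) (*-pos v>0 T>0)) (by-difference
        (solve 7 (λ v T D M G K q → v :* T :* (v :* T) :* (v :* M) := v :* T :* (v :* T) :* (con (+ 20) :* (D :* (M :- G)))
           :+ (con (+ 20) :* (K :* (v :* v :* q) :* M :- D :* (v :* T :* (v :* T) :* (M :- G))) :+ (v :* v) :* M :* (T :* T :* v :- con (+ 20) :* K :* q))) refl v T D M G K q)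
        (pos 20 ⊗ difference cheb ⊕ v≥0 ⊗ v≥0 ⊗ M≥0 ⊗ difference q-upper))

    module _ (kp≤vT : K * p ≤ v * T) where
      private
        R = + 4 * (v * v * (T * T))
        R≥0 : 0ℤ ≤ R
        R≥0 = pos 4 ⊗ (v≥0 ⊗ v≥0 ⊗ (T≥0 ⊗ T≥0))
        p≤vT : p ≤ v * T
        p≤vT = ≤-trans (∑-mono (fins _) x≤T) (≤-reflexive (trans (∑-cong (fins _) (λ a → *-comm (χ V a) T)) (trans (∑-* (fins _) T (χ V)) (*-comm T v))))
        e²≤R : ∀ a → χ V a * sq e a ≤ χ V a * R
        e²≤R a = by-difference
          (solve 5 (λ u v T x p → u :* (con (+ 4) :* (v :* v :* (T :* T)))
             := u :* ((v :* x :- p) :* (v :* x :- p)) :+ (con (+ 2) :* (v :* v) :* (u :* (T :* T) :- u :* (x :* x)) :+ con (+ 2) :* u :* (v :* T :* (v :* T) :- p :* p) :+ u :* ((v :* x :+ p) :* (v :* x :+ p)))) refl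
            (χ V a) v T (x a) p)
          (pos 2 ⊗ (v≥0 ⊗ v≥0) ⊗ difference (x²≤T² a) ⊕ pos 2 ⊗ χ-nonneg V a ⊗ difference (square-mono p≥0 p≤vT) ⊕ χ-nonneg V a ⊗ square-nonneg _)
        A = M₄ V e k
        q° = wt V (sq e)
        -- In units of M K v³ T² q, the two terms of `M₄-upper` are at most 9/20 and 18, by 2 v ≤ 3
        -- D and `q-upper`.
        centred-fourth : A ≤ + 20 * (M * K * (v * v * v) * (T * T) * q)
        centred-fourth = *-cancelˡ-≤ (*-pos (+<+ {0} {20} (s≤s z≤n)) (*-pos v>0 D>0)) (by-difference
          (solve 8 (λ M K v T q D A q° → con (+ 20) :* (v :* D) :* (con (+ 20) :* (M :* K :* (v :* v :* v) :* (T :* T) :* q))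
            := con (+ 20) :* (v :* D) :* A :+ (con (+ 10) :* D :* A :* (con (+ 3) :* D :- con (+ 2) :* v)
             :+ con (+ 30) :* (M :* (con (+ 4) :* (K :* K) :* (q° :* q°) :+ con (+ 3) :* K :* D :* (con (+ 4) :* (v :* v :* (T :* T))) :* q°) :- D :* D :* A)
             :+ con (+ 30) :* M :* (con (+ 4) :* (K :* K) :* (v :* v :* q :+ q°) :+ con (+ 3) :* K :* D :* (con (+ 4) :* (v :* v :* (T :* T)))) :* (v :* v :* q :- q°)
             :+ con (+ 6) :* M :* K :* (v :* v :* v :* v) :* q :* (T :* T :* v :- con (+ 20) :* K :* q)
             :+ con (+ 3) :* M :* K :* (v :* v :* v :* v) :* q :* (T :* T) :* (con (+ 3) :* D :- con (+ 2) :* v)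
             :+ con (+ 31) :* M :* K :* (v :* v :* v :* v) :* q :* (T :* T) :* D)) refl M K v T q D A q°)
          (pos 10 ⊗ D≥0 ⊗ A≥0 ⊗ 3D-2v
           ⊕ pos 30 ⊗ difference (M₄-upper V e R D k (wt-centred V x) R≥0 e²≤R D≥0 D+k≤v)
           ⊕ pos 30 ⊗ M≥0 ⊗ (pos 4 ⊗ (pos k ⊗ pos k) ⊗ (v≥0 ⊗ v≥0 ⊗ q≥0 ⊕ wt-sq-nonneg V e) ⊕ pos 3 ⊗ pos k ⊗ D≥0 ⊗ R≥0) ⊗ difference (wt-sq-centred-≤ V x)
           ⊕ pos 6 ⊗ M≥0 ⊗ pos k ⊗ v⁴≥0 ⊗ q≥0 ⊗ difference q-upper
           ⊕ pos 3 ⊗ M≥0 ⊗ pos k ⊗ v⁴≥0 ⊗ q≥0 ⊗ (T≥0 ⊗ T≥0) ⊗ 3D-2v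
           ⊕ pos 31 ⊗ M≥0 ⊗ pos k ⊗ v⁴≥0 ⊗ q≥0 ⊗ (T≥0 ⊗ T≥0) ⊗ D≥0))
          where
          A≥0 : 0ℤ ≤ A
          A≥0 = ∑-nonneg (subs V k) (λ Z → square-nonneg _)
          v⁴≥0 = v≥0 ⊗ v≥0 ⊗ v≥0 ⊗ v≥0

        -- Here v S is its centred part plus K p. As K p ≤ v T, three of the four factors of (K p)⁴
        -- can be replaced by v T; what remains is linear in p and is later outweighed by the first
        -- moment.
        fourth : v * M₄ V x k ≤ + 8 * (M * K * (T * T)) * (+ 20 * q + T * p)
        fourth = *-cancelˡ-≤ (*-pos (*-pos v>0 v>0) v>0) (≤-trans (≤-reflexive
            (solve 2 (λ v a → v :* v :* v :* (v :* a) := v :* v :* (v :* v) :* a) refl v (M₄ V x k)))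
          (≤-trans expand (by-difference
            (solve 7 (λ M K v T q p A → v :* v :* v :* (con (+ 8) :* (M :* K :* (T :* T)) :* (con (+ 20) :* q :+ T :* p))
               := con (+ 8) :* A :+ con (+ 8) :* (K :* p :* (K :* p) :* (K :* p :* (K :* p))) :* M
                :+ (con (+ 8) :* (con (+ 20) :* (M :* K :* (v :* v :* v) :* (T :* T) :* q) :- A)
                  :+ con (+ 8) :* M :* (K :* p) :* (v :* T :- K :* p) :* (v :* T :* (v :* T) :+ v :* T :* (K :* p) :+ K :* p :* (K :* p)))) refl M K v T q p A)
            (pos 8 ⊗ difference centred-fourth
             ⊕ pos 8 ⊗ M≥0 ⊗ kp≥0 ⊗ difference kp≤vT ⊗ (v≥0 ⊗ T≥0 ⊗ (v≥0 ⊗ T≥0) ⊕ v≥0 ⊗ T≥0 ⊗ kp≥0 ⊕ kp≥0 ⊗ kp≥0)))))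
          where
          kp≥0 : 0ℤ ≤ K * p
          kp≥0 = pos k ⊗ p≥0
          pow₄-≤ : ∀ a b → pow₄ (a + b) ≤ + 8 * pow₄ a + + 8 * pow₄ b
          pow₄-≤ a b = by-difference
            (solve 2 (λ a b → con (+ 8) :* (a :* a :* (a :* a)) :+ con (+ 8) :* (b :* b :* (b :* b)) := (a :+ b) :* (a :+ b) :* ((a :+ b) :* (a :+ b))
              :+ ((a :- b) :* (a :- b) :* (con (+ 5) :* ((a :+ b) :* (a :+ b)) :+ con (+ 2) :* (a :* a :+ b :* b)))) refl a b)
            (square-nonneg (a - b) ⊗ (pos 5 ⊗ square-nonneg (a + b) ⊕ pos 2 ⊗ (square-nonneg a ⊕ square-nonneg b)))
          expand : v * v * (v * v) * M₄ V x k ≤ + 8 * A + + 8 * pow₄ (K * p) * M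
          expand = ≤-trans (≤-reflexive (sym (∑-* (subs V k) (v * v * (v * v)) _))) (≤-trans
            (∑ˢ-mono V k λ Z s → ≤-trans (≤-reflexive (trans
                (solve 4 (λ v S p K → v :* v :* (v :* v) :* (S :* S :* (S :* S)) := (v :* S :- p :* K :+ K :* p) :* (v :* S :- p :* K :+ K :* p) :* ((v :* S :- p :* K :+ K :* p) :* (v :* S :- p :* K :+ K :* p))) refl v (wt Z x) p K)
                (cong (λ w → pow₄ (w + K * p)) (sym (wt-centred-sub V Z x k s)))))
              (pow₄-≤ (wt Z e) (K * p)))
            (≤-reflexive (trans (∑-+ (subs V k) _ _) (cong₂ _+_ (∑-* (subs V k) (+ 8) _) (∑-const (subs V k) (+ 8 * pow₄ (K * p)))))))

        -- A test polynomial without a cubic term, as the third moment is not controlled. With a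
        -- root at cT and a factor S, this forces the double root to -cT/2, where it leaves the sign
        -- for S < 0 unaffected. The coefficient of S² is then 3c²/4. Half of it survives
        -- `M₂-lower`, the fourth moment costs 160 and `q-lower` needs another 160, so 3c²/8 ≥ 320;
        -- c = 30 is the least such integer.
        poly : ℤ → ℤ
        poly S = + 6750 * (T * T * T) * S + + 675 * (T * T) * (S * S) - pow₄ S

        -- poly S = S (S + 15T)² (30T − S), which is at most 30T · (45T)² · 30T on [0, 30T] and nonpositive elsewhere.
        poly-≤ : ∀ S → poly S ≤ + 1822500 * pow₄ T * nonneg S
        poly-≤ S with nonneg-cases S
        ... | inj₂ (S<0 , eq) = subst (λ w → poly S ≤ + 1822500 * pow₄ T * w) (sym eq) (by-difference
                (solve 2 (λ S T → con (+ 1822500) :* (T :* T :* (T :* T)) :* con 0ℤ := con (+ 6750) :* (T :* T :* T) :* S :+ con (+ 675) :* (T :* T) :* (S :* S) :- S :* S :* (S :* S)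
                   :+ (:- S) :* ((S :+ con (+ 15) :* T) :* (S :+ con (+ 15) :* T)) :* (con (+ 30) :* T :+ (:- S))) refl S T)
                (-S≥0 ⊗ square-nonneg _ ⊗ (pos 30 ⊗ T≥0 ⊕ -S≥0)))
                where -S≥0 = nonpos⇒neg-nonneg (ℤₚ.<⇒≤ S<0)
        ... | inj₁ (S≥0 , eq) with S ℤₚ.≤? (+ 30 * T)
        ...   | yes S≤30T = subst (λ w → poly S ≤ + 1822500 * pow₄ T * w) (sym eq) (by-difference
                (solve 2 (λ S T → con (+ 1822500) :* (T :* T :* (T :* T)) :* con 1ℤ := con (+ 6750) :* (T :* T :* T) :* S :+ con (+ 675) :* (T :* T) :* (S :* S) :- S :* S :* (S :* S)
                   :+ (con (+ 2025) :* (T :* T) :* (S :* S :+ S :* (con (+ 30) :* T :- S) :+ (con (+ 30) :* T :- S) :* (con (+ 30) :* T :- S))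
                     :+ S :* ((con (+ 30) :* T :- S) :* (con (+ 30) :* T :- S)) :* (S :+ con (+ 60) :* T))) refl S T)
                (pos 2025 ⊗ (T≥0 ⊗ T≥0) ⊗ (S≥0 ⊗ S≥0 ⊕ S≥0 ⊗ difference S≤30T ⊕ square-nonneg _)
                 ⊕ S≥0 ⊗ square-nonneg _ ⊗ (S≥0 ⊕ pos 60 ⊗ T≥0)))
        ...   | no S≰30T = subst (λ w → poly S ≤ + 1822500 * pow₄ T * w) (sym eq) (by-difference
                (solve 2 (λ S T → con (+ 1822500) :* (T :* T :* (T :* T)) :* con 1ℤ := con (+ 6750) :* (T :* T :* T) :* S :+ con (+ 675) :* (T :* T) :* (S :* S) :- S :* S :* (S :* S)
                   :+ (con (+ 1822500) :* (T :* T :* (T :* T)) :+ S :* ((S :+ con (+ 15) :* T) :* (S :+ con (+ 15) :* T)) :* (S :- con (+ 30) :* T))) refl S T)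
                (pos 1822500 ⊗ square-nonneg (T * T) ⊕ S≥0 ⊗ square-nonneg _ ⊗ difference (ℤₚ.<⇒≤ (ℤₚ.≰⇒> S≰30T))))

        poly-sum : + 6750 * (T * T * T) * M₁ V x k + + 675 * (T * T) * M₂ V x k - M₄ V x k ≤ + 1822500 * pow₄ T * G
        poly-sum = subst₂ _≤_
          (trans (∑-minus (subs V k) _ _) (cong (λ w → w - M₄ V x k) (trans (∑-+ (subs V k) _ _)
            (cong₂ _+_ (∑-* (subs V k) (+ 6750 * (T * T * T)) _) (∑-* (subs V k) (+ 675 * (T * T)) _)))))
          (∑-* (subs V k) (+ 1822500 * pow₄ T) _)
          (∑-mono (subs V k) (λ Z → poly-≤ (wt Z x)))

      -- The expectation of `poly` is at least (K T² / v) (6742 T p + 177.5 q), which by `q-lower`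
      -- exceeds T⁴. Its maximum is bounded by 1822500 T⁴, and 291600000 is 160 times 1822500.
      many-if-mean-small : M ≤ + 291600000 * G
      many-if-mean-small = *-cancelˡ-≤ (*-pos (*-pos (+<+ {0} {2} (s≤s z≤n)) v>0) (*-pos (*-pos T>0 T>0) (*-pos T>0 T>0))) (by-difference
        (solve 10 (λ v T M G K p q F B A → con (+ 2) :* v :* (T :* T :* (T :* T)) :* (con (+ 291600000) :* G)
           := con (+ 2) :* v :* (T :* T :* (T :* T)) :* M
           :+ (con (+ 320) :* v :* (con (+ 1822500) :* (T :* T :* (T :* T)) :* G :- (con (+ 6750) :* (T :* T :* T) :* F :+ con (+ 675) :* (T :* T) :* B :- A))
            :+ con (+ 2160000) :* (T :* T :* T) :* (v :* F :- K :* p :* M)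
            :+ con (+ 108000) :* (T :* T) :* (con (+ 2) :* v :* B :- K :* q :* M)
            :+ con (+ 320) :* (con (+ 8) :* (M :* K :* (T :* T)) :* (con (+ 20) :* q :+ T :* p) :- v :* A)
            :+ con (+ 2) :* (T :* T) :* M :* (con (+ 160) :* K :* (q :+ T :* p) :- T :* T :* v)
            :+ M :* K :* (T :* T) :* (con (+ 2157120) :* (T :* p) :+ con (+ 56480) :* q))) refl v T M G K p q (M₁ V x k) (M₂ V x k) (M₄ V x k))
        (pos 320 ⊗ v≥0 ⊗ difference poly-sum
         ⊕ pos 2160000 ⊗ (T≥0 ⊗ T≥0 ⊗ T≥0) ⊗ difference (≤-reflexive (sym (M₁-formula V x k)))
         ⊕ pos 108000 ⊗ (T≥0 ⊗ T≥0) ⊗ difference (M₂-lower V x k v≥0 3k≤v)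
         ⊕ pos 320 ⊗ difference fourth
         ⊕ pos 2 ⊗ (T≥0 ⊗ T≥0) ⊗ M≥0 ⊗ difference q-lower
         ⊕ M≥0 ⊗ pos k ⊗ (T≥0 ⊗ T≥0) ⊗ (pos 2157120 ⊗ (T≥0 ⊗ p≥0) ⊕ pos 56480 ⊗ q≥0)))

    many-nonneg : M ≤ + 291600000 * G
    many-nonneg with K * p ≤? v * T
    ... | yes kp≤vT = many-if-mean-small kp≤vT
    ... | no  kp≰vT = *-cancelˡ-≤ {+ 37} (+<+ (s≤s z≤n)) (by-difference
            (solve 2 (λ M G → con (+ 37) :* (con (+ 291600000) :* G) := con (+ 37) :* M :+ (con (+ 40) :* G :- con (+ 37) :* M :+ con (+ 10789199960) :* G)) refl M G)
            (difference (many-if-mean-large (ℤₚ.<⇒≤ (ℤₚ.≰⇒> kp≰vT))) ⊕ pos 10789199960 ⊗ ∑-nonneg (subs V k) (λ Z → nonneg-nonneg _)))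

  -- Truncation of very negative weights

  clip : ℤ → ℤ → ℤ
  clip T s with (- T) ≤? s
  ... | yes _ = s
  ... | no  _ = - T

  keep : ℤ → ℤ → Bool
  keep T s with (- T) ≤? s
  ... | yes _ = true
  ... | no  _ = false

  trunc : Subset n → (Fin n → ℤ) → ℤ → Subset n
  trunc U x T = tabulate (λ a → lookup U a ∧ keep T (x a))

  -- The three cases come with the values of all indicators as equations, ready for rewriting.
  data TruncView (U : Subset n) (x : Fin n → ℤ) (T : ℤ) (a : Fin n) : Set where
    outside : χ U a ≡ 0ℤ → χ (trunc U x T) a ≡ 0ℤ → TruncView U x T a
    kept    : lookup U a ≡ true → χ U a ≡ 1ℤ → χ (trunc U x T) a ≡ 1ℤ → - T ≤ x a → clip T (x a) ≡ x a → TruncView U x T a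
    cut     : χ U a ≡ 1ℤ → χ (trunc U x T) a ≡ 0ℤ → x a < - T → clip T (x a) ≡ - T → TruncView U x T a

  clip-cases : ∀ T s → (- T ≤ s × keep T s ≡ true × clip T s ≡ s) ⊎ (s < - T × keep T s ≡ false × clip T s ≡ - T)
  clip-cases T s with (- T) ≤? s
  ... | yes h = inj₁ (h , refl , refl)
  ... | no  h = inj₂ (ℤₚ.≰⇒> h , refl , refl)

  bool-cases : ∀ b → b ≡ true ⊎ b ≡ false
  bool-cases true  = inj₁ refl
  bool-cases false = inj₂ refl

  truncView : ∀ (U : Subset n) x T a → TruncView U x T a
  truncView U x T a with bool-cases (lookup U a) | clip-cases T (x a)
  ... | inj₂ a∉U | _ = outside (cong ind a∉U)
        (cong ind (trans (lookup∘tabulate _ a) (cong (λ b → b ∧ keep T (x a)) a∉U)))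
  ... | inj₁ a∈U | inj₁ (h , k , c) = kept a∈U (cong ind a∈U)
        (cong ind (trans (lookup∘tabulate _ a) (cong₂ _∧_ a∈U k))) h c
  ... | inj₁ a∈U | inj₂ (h , k , c) = cut (cong ind a∈U)
        (cong ind (trans (lookup∘tabulate _ a) (cong₂ _∧_ a∈U k))) h c

  trunc-⊑ : ∀ (U : Subset n) x T → trunc U x T ⊑ U
  trunc-⊑ U x T a with truncView U x T a
  ... | outside eU eV     rewrite eU | eV = zeroˡ 0ℤ
  ... | kept _ eU eV _ _  rewrite eU | eV = *-identityˡ 1ℤ
  ... | cut eU eV _ _     rewrite eU | eV = zeroˡ 1ℤ

  clipped : (Fin n → ℤ) → ℤ → Fin n → ℤ
  clipped x T a = clip T (x a)

  Bounded : Subset n → (Fin n → ℤ) → ℤ → Set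
  Bounded U x T = ∀ a → lookup U a ≡ true → x a ≤ T

  trunc-≤ : ∀ (U : Subset n) x T → Bounded U x T → ∀ a → χ (trunc U x T) a * x a ≤ χ (trunc U x T) a * T
  trunc-≤ U x T b a with truncView U x T a
  ... | outside _ eV       rewrite eV = ≤-reflexive (trans (zeroˡ (x a)) (sym (zeroˡ T)))
  ... | kept a∈U _ eV _ _ rewrite eV = subst₂ _≤_ (sym (*-identityˡ (x a))) (sym (*-identityˡ T)) (b a a∈U)
  ... | cut _ eV _ _       rewrite eV = ≤-reflexive (trans (zeroˡ (x a)) (sym (zeroˡ T)))

  trunc-sq-≤ : ∀ (U : Subset n) x T → Bounded U x T → ∀ a → χ (trunc U x T) a * sq x a ≤ χ (trunc U x T) a * (T * T)
  trunc-sq-≤ U x T b a with truncView U x T a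
  ... | outside _ eV       rewrite eV = ≤-reflexive (trans (zeroˡ (sq x a)) (sym (zeroˡ (T * T))))
  ... | kept a∈U _ eV h _ rewrite eV = by-difference
          (solve 2 (λ x T → con 1ℤ :* (T :* T) := con 1ℤ :* (x :* x) :+ (T :- x) :* (x :- :- T)) refl (x a) T)
          (difference (b a a∈U) ⊗ difference h)
  ... | cut _ eV _ _       rewrite eV = ≤-reflexive (trans (zeroˡ (sq x a)) (sym (zeroˡ (T * T))))

  -- Each cut element weighs less than -T, so removing it raises the sum by at least T.
  trunc-wt : ∀ (U : Subset n) x T → wt U x + (size U - size (trunc U x T)) * T ≤ wt (trunc U x T) x
  trunc-wt {n} U x T = ≤-trans (≤-reflexive (sym (trans (∑-+ (fins n) _ _) (cong (λ w → wt U x + w)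
      (trans (∑-cong (fins n) (λ a → *-comm (χ U a - χ V a) T)) (trans (∑-* (fins n) T _)
        (trans (cong (λ w → T * w) (∑-minus (fins n) (χ U) (χ V))) (*-comm T _))))))))
    (∑-mono (fins n) at)
    where
    V = trunc U x T
    at : ∀ a → χ U a * x a + (χ U a - χ V a) * T ≤ χ V a * x a
    at a with truncView U x T a
    ... | outside eU eV    rewrite eU | eV = ≤-reflexive (solve 2 (λ x T → con 0ℤ :* x :+ (con 0ℤ :- con 0ℤ) :* T := con 0ℤ :* x) refl (x a) T)
    ... | kept _ eU eV _ _ rewrite eU | eV = ≤-reflexive (solve 2 (λ x T → con 1ℤ :* x :+ (con 1ℤ :- con 1ℤ) :* T := con 1ℤ :* x) refl (x a) T)
    ... | cut eU eV h _    rewrite eU | eV = by-difference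
            (solve 2 (λ x T → con 0ℤ :* x := con 1ℤ :* x :+ (con 1ℤ :- con 0ℤ) :* T :+ (:- T :- x)) refl (x a) T) (difference (ℤₚ.<⇒≤ h))

  -- A single bound on the clipped second moment thus controls both the second moment of the kept
  -- weights and the number of cut elements.
  trunc-sq : ∀ (U : Subset n) x T → wt U (sq (clipped x T)) ≡ wt (trunc U x T) (sq x) + (size U - size (trunc U x T)) * (T * T)
  trunc-sq {n} U x T = trans (∑-cong (fins n) at) (trans (∑-+ (fins n) _ _) (cong (λ w → wt V (sq x) + w)
      (trans (∑-cong (fins n) (λ a → *-comm (χ U a - χ V a) (T * T))) (trans (∑-* (fins n) (T * T) _)
        (trans (cong (λ w → T * T * w) (∑-minus (fins n) (χ U) (χ V))) (*-comm (T * T) _))))))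
    where
    V = trunc U x T
    at : ∀ a → χ U a * sq (clipped x T) a ≡ χ V a * sq x a + (χ U a - χ V a) * (T * T)
    at a with truncView U x T a
    ... | outside eU eV    rewrite eU | eV = solve 3 (λ c x T → con 0ℤ :* (c :* c) := con 0ℤ :* (x :* x) :+ (con 0ℤ :- con 0ℤ) :* (T :* T)) refl (clip T (x a)) (x a) T
    ... | kept _ eU eV _ e rewrite eU | eV | e = solve 2 (λ x T → con 1ℤ :* (x :* x) := con 1ℤ :* (x :* x) :+ (con 1ℤ :- con 1ℤ) :* (T :* T)) refl (x a) T
    ... | cut eU eV _ e    rewrite eU | eV | e = solve 2 (λ x T → con 1ℤ :* ((:- T) :* (:- T)) := con 0ℤ :* (x :* x) :+ (con 1ℤ :- con 0ℤ) :* (T :* T)) refl (x a) T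

  ≤-neg : ∀ {s T} → s ≤ - T → T ≤ - s
  ≤-neg {s} {T} h = by-difference (solve 2 (λ s T → :- s := T :+ (:- T :- s)) refl s T) (difference h)

  -- Carries a lower bound on the clipped second moment from the scale `t` to the next scale
  -- `t + 1`.
  clip-sq-mono : ∀ s {T T′} → 0ℤ ≤ T → T ≤ T′ → clip T s * clip T s ≤ clip T′ s * clip T′ s
  clip-sq-mono s {T} {T′} T≥0 T≤T′ with (- T) ≤? s | (- T′) ≤? s
  ... | yes _ | yes _ = ≤-refl
  ... | yes p | no ¬p = ⊥-elim (¬p (≤-trans (by-difference (solve 2 (λ T T′ → :- T := :- T′ :+ (T′ :- T)) refl T T′) (difference T≤T′)) p))
  ... | no ¬p | yes _ = subst₂ _≤_ (solve 1 (λ T → T :* T := (:- T) :* (:- T)) refl T) (solve 1 (λ s → (:- s) :* (:- s) := s :* s) refl s)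
          (square-mono T≥0 (≤-neg (ℤₚ.<⇒≤ (ℤₚ.≰⇒> ¬p))))
  ... | no ¬p | no _  = subst₂ _≤_ (solve 1 (λ T → T :* T := (:- T) :* (:- T)) refl T) (solve 1 (λ T → T :* T := (:- T) :* (:- T)) refl T′)
          (square-mono T≥0 T≤T′)

  clip-sq-≤ : ∀ s {T} → 0ℤ ≤ T → clip T s * clip T s ≤ s * s
  clip-sq-≤ s {T} T≥0 with (- T) ≤? s
  ... | yes _ = ≤-refl
  ... | no ¬p = subst₂ _≤_ (solve 1 (λ T → T :* T := (:- T) :* (:- T)) refl T) (solve 1 (λ s → (:- s) :* (:- s) := s :* s) refl s)
          (square-mono T≥0 (≤-neg (ℤₚ.<⇒≤ (ℤₚ.≰⇒> ¬p))))

  wt-mono : ∀ (U : Subset n) {f g : Fin n → ℤ} → (∀ a → f a ≤ g a) → wt U f ≤ wt U g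
  wt-mono {n} U {f} {g} h = ∑-mono (fins n) (λ a → by-difference
    (solve 3 (λ u x y → u :* y := u :* x :+ u :* (y :- x)) refl (χ U a) (f a) (g a)) (χ-nonneg U a ⊗ difference (h a)))

  -- Binomial identities and the proportion of k-sets lost by removing elements

  N-absorption : ∀ (U : Subset n) a k → lookup U a ≡ true → (1ℤ + + k) * N U (suc k) ≡ size U * N (del U a) k
  N-absorption U a k a∈U = begin
    (1ℤ + K) * N U (suc k)                                ≡⟨ cong (λ w → (1ℤ + K) * w) (∑-split U a k (λ _ → 1ℤ) a∈U) ⟩
    (1ℤ + K) * (N U′ k + N U′ (suc k))                    ≡⟨ distribˡ (1ℤ + K) (N U′ k) (N U′ (suc k)) ⟩
    (1ℤ + K) * N U′ k + (1ℤ + K) * N U′ (suc k)           ≡⟨ cong (λ w → (1ℤ + K) * N U′ k + w) (N-step U′ k) ⟩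
    (1ℤ + K) * N U′ k + (size U′ - K) * N U′ k            ≡⟨ cong (λ w → (1ℤ + K) * N U′ k + (w - K) * N U′ k) (size-del U a a∈U) ⟩
    (1ℤ + K) * N U′ k + (size U - 1ℤ - K) * N U′ k        ≡⟨ solve 3 (λ K u m → (con 1ℤ :+ K) :* m :+ (u :- con 1ℤ :- K) :* m := u :* m) refl K (size U) (N U′ k) ⟩
    size U * N U′ k                                       ∎
    where
    open ≡-Reasoning
    U′ = del U a ; K = + k

  C-absorption : ∀ m k → (1ℤ + + k) * + (suc m C suc k) ≡ + suc m * + (m C k)
  C-absorption m k = begin
    (1ℤ + + k) * + (suc m C suc k)               ≡⟨ cong (λ l → (1ℤ + + k) * + (l C suc k)) (∣⊤∣≡n (suc m)) ⟨
    (1ℤ + + k) * + (∣ ⊤ {suc m} ∣ C suc k)       ≡⟨ cong (λ w → (1ℤ + + k) * w) (N-C (⊤ {suc m}) (suc k)) ⟨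
    (1ℤ + + k) * N (⊤ {suc m}) (suc k)           ≡⟨ N-absorption (⊤ {suc m}) zero k refl ⟩
    size (⊤ {suc m}) * N (false ∷ ⊤ {m}) k       ≡⟨ cong₂ _*_ (trans (size-∣∣ (⊤ {suc m})) (cong +_ (∣⊤∣≡n (suc m)))) (trans (N-C (false ∷ ⊤ {m}) k) (cong (λ l → + (l C k)) (∣⊤∣≡n m))) ⟩
    + suc m * + (m C k)                          ∎
    where open ≡-Reasoning

  -- A union bound: each of the `d` extra elements lies in a proportion k/(d + v) ≤ k/v of the
  -- k-sets. The induction adds them one at a time by Pascal's rule and absorption.
  C-ratio : ∀ v d k → + v * + ((d ℕ.+ v) C k) ≤ + v * + (v C k) + + d * (+ k * + ((d ℕ.+ v) C k))
  C-ratio v zero k = by-difference (solve 3 (λ v c k → v :* c :+ con 0ℤ :* (k :* c) := v :* c :+ con 0ℤ) refl (+ v) (+ (v C k)) (+ k)) ≤-refl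
  C-ratio v (suc d) zero = by-difference
    (trans (cong (λ c → + v * + c + + suc d * (0ℤ * + (suc (d ℕ.+ v) C 0))) (trans (nC0≡1 v) (sym (nC0≡1 (suc (d ℕ.+ v))))))
      (solve 3 (λ v c d → v :* c :+ d :* (con 0ℤ :* c) := v :* c :+ con 0ℤ) refl (+ v) (+ (suc (d ℕ.+ v) C 0)) (+ suc d))) ≤-refl
  C-ratio v (suc d) (suc k) = by-difference
    (begin
      V * c + + suc d * (+ suc k * c₁)          ≡⟨ cong₂ (λ D K → V * c + D * (K * c₁)) (pos-+ 1 d) (pos-+ 1 k) ⟩
      V * c + (1ℤ + D) * ((1ℤ + K) * c₁)        ≡⟨ solve 5 (λ V c D K c₁ → V :* c :+ (con 1ℤ :+ D) :* (K :* c₁) := V :* c :+ D :* (K :* c₁) :+ K :* c₁) refl V c D (1ℤ + K) c₁ ⟩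
      V * c + D * ((1ℤ + K) * c₁) + (1ℤ + K) * c₁ ≡⟨ cong₂ (λ a b → V * c + D * ((1ℤ + K) * a) + b) pascal (trans (C-absorption (d ℕ.+ v) k) (cong (λ w → w * b) (trans (pos-+ 1 (d ℕ.+ v)) (cong (λ w → 1ℤ + w) (pos-+ d v))))) ⟩
      V * c + D * ((1ℤ + K) * (b + c₀)) + (1ℤ + (D + V)) * b
        ≡⟨ solve 6 (λ V c D K b c₀ → V :* c :+ D :* (K :* (b :+ c₀)) :+ (con 1ℤ :+ (D :+ V)) :* b := V :* (b :+ c₀) :+ ((V :* c :+ D :* (K :* c₀) :- V :* c₀) :+ D :* (K :* b) :+ (con 1ℤ :+ D) :* b)) refl V c D (1ℤ + K) b c₀ ⟩
      V * (b + c₀) + rest                       ≡⟨ cong (λ w → V * w + rest) pascal ⟨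
      V * c₁ + rest ∎)
    (difference (subst (λ K → V * c₀ ≤ V * c + D * (K * c₀)) (pos-+ 1 k) (C-ratio v d (suc k))) ⊕ pos d ⊗ ((pos 1 ⊕ pos k) ⊗ pos _) ⊕ (pos 1 ⊕ pos d) ⊗ pos _)
    where
    open ≡-Reasoning
    V = + v ; D = + d ; K = + k ; c = + (v C suc k) ; c₁ = + (suc (d ℕ.+ v) C suc k) ; c₀ = + ((d ℕ.+ v) C suc k) ; b = + ((d ℕ.+ v) C k)
    rest = (V * c + D * ((1ℤ + K) * c₀) - V * c₀) + D * ((1ℤ + K) * b) + (1ℤ + D) * b
    pascal : c₁ ≡ b + c₀
    pascal = trans (cong +_ (sym (nCk+nC[k+1]≡[n+1]C[k+1] (d ℕ.+ v) k))) (pos-+ _ _)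

  χ-mono : ∀ {V U : Subset n} → V ⊑ U → ∀ a → χ V a ≤ χ U a
  χ-mono {V = V} {U} p a = by-difference
    (trans (solve 2 (λ u w → u := w :* u :+ u :* (con 1ℤ :- w)) refl (χ U a) (χ V a)) (cong (λ w → w + χ U a * (1ℤ - χ V a)) (p a)))
    (χ-nonneg U a ⊗ difference (χ≤1 V a))

  size-mono : ∀ {V U : Subset n} → V ⊑ U → size V ≤ size U
  size-mono {n} {V} {U} p = ∑-mono (fins n) (χ-mono {V = V} {U} p)

  N-ratio : ∀ (V U : Subset n) k → V ⊑ U → size V * N U k ≤ size V * N V k + (size U - size V) * (+ k * N U k)
  N-ratio V U k p rewrite N-C U k | N-C V k | size-∣∣ U | size-∣∣ V =
    subst₂ (λ m d → + ∣ V ∣ * + (m C k) ≤ + ∣ V ∣ * + (∣ V ∣ C k) + d * (+ k * + (m C k))) eq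
      (trans (solve 2 (λ d v → d := d :+ v :- v) refl (+ (∣ U ∣ ℕ.∸ ∣ V ∣)) (+ ∣ V ∣))
        (cong (λ w → w - + ∣ V ∣) (trans (sym (pos-+ _ _)) (cong +_ eq))))
      (C-ratio ∣ V ∣ (∣ U ∣ ℕ.∸ ∣ V ∣) k)
    where
    eq : ∣ U ∣ ℕ.∸ ∣ V ∣ ℕ.+ ∣ V ∣ ≡ ∣ U ∣
    eq = ℕₚ.m∸n+n≡m (ℤₚ.drop‿+≤+ (subst₂ _≤_ (size-∣∣ V) (size-∣∣ U) (size-mono {V = V} {U} p)))

  -- Failures among the sets containing a large weight

  suc≰0 : ∀ {m} → ¬ (+ suc m ≤ 0ℤ)
  suc≰0 (+≤+ ())

  -- Here `U` lacks the element of weight `M`, and Z ranges over the other elements of a set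
  -- containing it. Cutting the weights below -M loses at most 1/18 of the sets, Chebyshev's
  -- inequality on the rest another 1/14, and the sum is below 1/4.
  few-failures : ∀ (U : Subset n) x k M → 0ℤ < M → Bounded U x M → 0ℤ ≤ wt U x + M → + 100 * (1ℤ + + k) ≤ size U →
    + 20 * (1ℤ + + k) * wt U (sq (clipped x M)) ≤ M * M * size U →
    + 4 * (N U k - ∑ (subs U k) (λ Z → nonneg (M + wt Z x))) ≤ N U k
  few-failures U x k M M>0 x≤M p+M≥0 u-large Φ-small = *-cancelˡ-≤ {+ 126} (+<+ (s≤s z≤n)) (by-difference
      (solve 4 (λ N N′ G G′ → con (+ 126) :* N := con (+ 126) :* (con (+ 4) :* (N :- G))
        :+ (con (+ 28) :* (N :- con (+ 18) :* (N :- N′)) :+ con (+ 36) :* (N′ :- con (+ 14) :* (N′ :- G′)) :+ con (+ 504) :* (G :- G′) :+ con (+ 36) :* (N :- N′) :+ con (+ 62) :* N)) refl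
        (N U k) (N V k) G G′)
      (pos 28 ⊗ difference N-close ⊕ pos 36 ⊗ difference fails ⊕ pos 504 ⊗ difference G-mono ⊕ pos 36 ⊗ difference N-mono ⊕ pos 62 ⊗ N-nonneg U k))
    where
    V = trunc U x M
    u = size U ; v = size V ; K = + k ; D = size V - + k ; p = wt V x ; q = wt V (sq x) ; e = centred V x
    ok : Subset _ → ℤ
    ok Z = nonneg (M + wt Z x)
    G = ∑ (subs U k) ok
    G′ = ∑ (subs V k) ok
    M≥0 = ℤₚ.<⇒≤ M>0
    v≥0 = size-nonneg V
    u≥0 = size-nonneg U
    q≥0 = wt-sq-nonneg V x
    N-mono : N V k ≤ N U k
    N-mono = ∑-subset-mono V U k (λ _ → 1ℤ) (trunc-⊑ U x M) (λ _ → pos 1)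
    G-mono : G′ ≤ G
    G-mono = ∑-subset-mono V U k ok (trunc-⊑ U x M) (λ _ → nonneg-nonneg _)
    v≤u : v ≤ u
    v≤u = size-mono {V = V} {U} (trunc-⊑ U x M)
    Φ-small′ : + 20 * (1ℤ + K) * (q + (u - v) * (M * M)) ≤ M * M * u
    Φ-small′ = subst (λ w → + 20 * (1ℤ + K) * w ≤ M * M * u) (trunc-sq U x M) Φ-small
    few-cut : + 20 * (1ℤ + K) * (u - v) ≤ u
    few-cut = *-cancelˡ-≤ (*-pos M>0 M>0) (by-difference
      (solve 5 (λ M u v K q → M :* M :* u := M :* M :* (con (+ 20) :* (con 1ℤ :+ K) :* (u :- v))
        :+ ((M :* M :* u :- con (+ 20) :* (con 1ℤ :+ K) :* (q :+ (u :- v) :* (M :* M))) :+ con (+ 20) :* (con 1ℤ :+ K) :* q)) refl M u v K q)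
      (difference Φ-small′ ⊕ pos 20 ⊗ (pos 1 ⊕ pos k) ⊗ q≥0))
    9u≤10D : + 9 * u ≤ + 10 * D
    9u≤10D = *-cancelˡ-≤ {+ 2} (+<+ (s≤s z≤n)) (by-difference
      (solve 3 (λ u v K → con (+ 2) :* (con (+ 10) :* (v :- K)) := con (+ 2) :* (con (+ 9) :* u)
        :+ ((u :- con (+ 20) :* (con 1ℤ :+ K) :* (u :- v)) :+ con (+ 20) :* K :* (u :- v) :+ (u :- con (+ 100) :* (con 1ℤ :+ K)) :+ con (+ 80) :* K :+ con (+ 100))) refl u v K)
      (difference few-cut ⊕ pos 20 ⊗ pos k ⊗ difference v≤u ⊕ difference u-large ⊕ pos 80 ⊗ pos k ⊕ pos 100))
    D>0 : 0ℤ < D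
    D>0 = ℤₚ.≰⇒> λ D≤0 → suc≰0 (by-difference {+ 900} {0ℤ}
      (solve 3 (λ u D K → con 0ℤ := con (+ 900) :+ ((con (+ 10) :* D :- con (+ 9) :* u) :+ con (+ 9) :* (u :- con (+ 100) :* (con 1ℤ :+ K)) :+ con (+ 900) :* K :+ con (+ 10) :* (:- D))) refl u D K)
      (difference 9u≤10D ⊕ pos 9 ⊗ difference u-large ⊕ pos 900 ⊗ pos k ⊕ pos 10 ⊗ nonpos⇒neg-nonneg D≤0))
    D≥0 = ℤₚ.<⇒≤ D>0
    D+k≤v : D + + k ≤ v
    D+k≤v = ≤-reflexive (solve 2 (λ v K → v :- K :+ K := v) refl v K)
    v>0 : 0ℤ < v
    v>0 = ℤₚ.<-≤-trans D>0 (by-difference (solve 2 (λ v K → v := v :- K :+ K) refl v K) (pos k))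
    p+M≥0′ : 0ℤ ≤ p + M
    p+M≥0′ = subst (0ℤ ≤_) (solve 4 (λ w d p M → (p :- (w :+ d :* M)) :+ (w :+ M) :+ d :* M := p :+ M) refl (wt U x) (u - v) p M)
      (difference (trunc-wt U x M) ⊕ p+M≥0 ⊕ difference v≤u ⊗ M≥0)
    -- The total p of the kept weights may be as low as -M, so the scaled mean p K is only known to
    -- be at least -K M. A sum below -M then deviates by (v - K) M = D M, not by v M.
    θ = D * M * (D * M)
    F = N V k - G′
    cheb : D * (θ * F) ≤ K * (v * v * q) * N V k
    cheb = subst (λ w → D * (θ * w) ≤ K * (v * v * q) * N V k) (∑-complement V k ok)
      (chebyshev V x k D θ (λ Z → 1ℤ - ok Z) D≥0 D+k≤v at)
      where
      at : ∀ Z → IsSub V k Z → θ * (1ℤ - ok Z) ≤ wt Z e * wt Z e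
      at Z s with nonneg-cases (M + wt Z x)
      ... | inj₁ (_ , eq) = subst (λ w → θ * (1ℤ - w) ≤ wt Z e * wt Z e) (sym eq)
              (subst (_≤ wt Z e * wt Z e) (solve 1 (λ t → con 0ℤ := t :* (con 1ℤ :- con 1ℤ)) refl θ) (square-nonneg (wt Z e)))
      ... | inj₂ (h , eq) = subst (λ w → θ * (1ℤ - w) ≤ wt Z e * wt Z e) (sym eq)
              (subst₂ _≤_ (solve 1 (λ t → t := t :* (con 1ℤ :- con 0ℤ)) refl θ)
                (solve 1 (λ s → (:- s) :* (:- s) := s :* s) refl (wt Z e))
                (square-mono (D≥0 ⊗ M≥0) (by-difference
                  (trans (cong -_ (wt-centred-sub V Z x k s))
                    (solve 5 (λ v S p K M → :- (v :* S :- p :* K) := (v :- K) :* M :+ (v :* (:- (M :+ S)) :+ K :* (p :+ M))) refl v (wt Z x) p K M))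
                  (v≥0 ⊗ nonpos⇒neg-nonneg (ℤₚ.<⇒≤ h) ⊕ pos k ⊗ p+M≥0′))))
    F≥0 : 0ℤ ≤ F
    F≥0 = subst (0ℤ ≤_) (∑-complement V k ok) (∑-nonneg (subs V k) (λ Z → difference (nonneg≤1 (M + wt Z x))))
    -- With q ≤ M² u / (20 (K + 1)) and v ≤ u ≤ 10 D / 9, the failing proportion is at most (10/9)³
    -- / 20, which is less than 1/14.
    fails : + 14 * F ≤ N V k
    fails = *-cancelˡ-≤ (*-pos (+<+ {0} {1000} (s≤s z≤n)) (*-pos (*-pos D>0 D>0) (*-pos D>0 (*-pos M>0 M>0)))) (by-difference
      (solve 8 (λ D M N F u v K q → con (+ 1000) :* (D :* D :* (D :* (M :* M))) :* N := con (+ 1000) :* (D :* D :* (D :* (M :* M))) :* (con (+ 14) :* F)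
        :+ (M :* M :* N :* (con (+ 10) :* D :- con (+ 9) :* u) :* (con (+ 100) :* (D :* D) :+ con (+ 90) :* (D :* u) :+ con (+ 81) :* (u :* u))
         :+ con (+ 729) :* (M :* M) :* N :* u :* (u :- v) :* (u :+ v)
         :+ con (+ 729) :* (v :* v) :* N :* (M :* M :* u :- con (+ 20) :* (con 1ℤ :+ K) :* (q :+ (u :- v) :* (M :* M)))
         :+ con (+ 729) :* (v :* v) :* N :* (con (+ 20) :* q :+ con (+ 20) :* (con 1ℤ :+ K) :* ((u :- v) :* (M :* M)))
         :+ con (+ 14580) :* (K :* (v :* v :* q) :* N :- D :* (D :* M :* (D :* M) :* F))
         :+ con (+ 580) :* (D :* D :* (D :* (M :* M))) :* F)) refl D M (N V k) F u v K q)
      (M≥0 ⊗ M≥0 ⊗ N-nonneg V k ⊗ difference 9u≤10D ⊗ (pos 100 ⊗ (D≥0 ⊗ D≥0) ⊕ pos 90 ⊗ (D≥0 ⊗ u≥0) ⊕ pos 81 ⊗ (u≥0 ⊗ u≥0))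
       ⊕ pos 729 ⊗ (M≥0 ⊗ M≥0) ⊗ N-nonneg V k ⊗ u≥0 ⊗ difference v≤u ⊗ (u≥0 ⊕ v≥0)
       ⊕ pos 729 ⊗ (v≥0 ⊗ v≥0) ⊗ N-nonneg V k ⊗ difference Φ-small′
       ⊕ pos 729 ⊗ (v≥0 ⊗ v≥0) ⊗ N-nonneg V k ⊗ (pos 20 ⊗ q≥0 ⊕ pos 20 ⊗ (pos 1 ⊕ pos k) ⊗ (difference v≤u ⊗ (M≥0 ⊗ M≥0)))
       ⊕ pos 14580 ⊗ difference cheb
       ⊕ pos 580 ⊗ (D≥0 ⊗ D≥0 ⊗ (D≥0 ⊗ (M≥0 ⊗ M≥0))) ⊗ F≥0))
    -- The lost proportion is at most K (u - v) / v ≤ u / (20 v), and v ≥ D ≥ 9 u / 10.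
    N-close : + 18 * (N U k - N V k) ≤ N U k
    N-close = *-cancelˡ-≤ (*-pos (+<+ {0} {10} (s≤s z≤n)) v>0) (by-difference
      (solve 5 (λ u v K a b → con (+ 10) :* v :* a := con (+ 10) :* v :* (con (+ 18) :* (a :- b))
        :+ (con (+ 180) :* (v :* b :+ (u :- v) :* (K :* a) :- v :* a) :+ con (+ 9) :* a :* (u :- con (+ 20) :* (con 1ℤ :+ K) :* (u :- v)) :+ con (+ 180) :* a :* (u :- v)
         :+ a :* (con (+ 10) :* (v :- K) :- con (+ 9) :* u) :+ con (+ 10) :* a :* K)) refl u v K (N U k) (N V k))
      (pos 180 ⊗ difference (N-ratio V U k (trunc-⊑ U x M)) ⊕ pos 9 ⊗ N-nonneg U k ⊗ difference few-cut ⊕ pos 180 ⊗ N-nonneg U k ⊗ difference v≤u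
       ⊕ N-nonneg U k ⊗ difference 9u≤10D ⊕ pos 10 ⊗ N-nonneg U k ⊗ pos k))

  -- The weak bound

  -- `Spread` makes one in 291600000 of the sets inside V good, and V retains 19/20 of all sets.
  -- Since u ≥ 10⁹ K, this proportion is larger than K / u.
  many-if-spread : ∀ (U : Subset n) x k T → 0ℤ < T → Bounded U x T → 0ℤ ≤ wt U x → + 1000000000 * + suc k ≤ size U →
    + 40 * + suc k * wt U (sq (clipped x T)) ≤ T * T * size U →
    T * T * size U ≤ + 160 * + suc k * wt U (sq (clipped x T)) →
    + suc k * N U (suc k) ≤ size U * ∑ (subs U (suc k)) (λ Z → nonneg (wt Z x))
  many-if-spread U x k T T>0 x≤T wt≥0 u-large Φ-upper Φ-lower = *-cancelˡ-≤ {+ 19} (+<+ (s≤s z≤n)) (by-difference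
      (solve 6 (λ K u N N′ G G′ → con (+ 19) :* (u :* G) := con (+ 19) :* (K :* N)
        :+ (con (+ 19) :* (u :- con (+ 1000000000) :* K) :* G :+ con (+ 19000000000) :* K :* (G :- G′) :+ con (+ 20) :* K :* (con (+ 291600000) :* G′ :- N′)
          :+ con (+ 13168000000) :* K :* G′ :+ K :* (con (+ 20) :* N′ :- con (+ 19) :* N))) refl K u (N U (suc k)) (N V (suc k)) G G′)
      (pos 19 ⊗ difference u-large ⊗ G≥0 ⊕ pos 19000000000 ⊗ pos (suc k) ⊗ difference G-mono
        ⊕ pos 20 ⊗ pos (suc k) ⊗ difference (Spread.many-nonneg V x (suc k) T T>0 v>0 (trunc-≤ U x T x≤T) (trunc-sq-≤ U x T x≤T) p≥0 3K≤v q-upper q-lower)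
        ⊕ pos 13168000000 ⊗ pos (suc k) ⊗ ∑-nonneg (subs V (suc k)) (λ _ → nonneg-nonneg _) ⊕ pos (suc k) ⊗ difference N-close))
    where
    V = trunc U x T
    u = size U ; v = size V ; K = + suc k ; p = wt V x ; q = wt V (sq x)
    good : Subset _ → ℤ
    good Z = nonneg (wt Z x)
    G = ∑ (subs U (suc k)) good
    G′ = ∑ (subs V (suc k)) good
    G≥0 : 0ℤ ≤ G
    G≥0 = ∑-nonneg (subs U (suc k)) (λ _ → nonneg-nonneg _)
    T≥0 = ℤₚ.<⇒≤ T>0
    q≥0 = wt-sq-nonneg V x
    K-1≥0 : 0ℤ ≤ K - 1ℤ
    K-1≥0 = difference (+≤+ (s≤s z≤n))
    G-mono : G′ ≤ G
    G-mono = ∑-subset-mono V U (suc k) good (trunc-⊑ U x T) (λ _ → nonneg-nonneg _)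
    v≤u : v ≤ u
    v≤u = size-mono {V = V} {U} (trunc-⊑ U x T)
    Φ-upper′ : + 40 * K * (q + (u - v) * (T * T)) ≤ T * T * u
    Φ-upper′ = subst (λ w → + 40 * K * w ≤ T * T * u) (trunc-sq U x T) Φ-upper
    Φ-lower′ : T * T * u ≤ + 160 * K * (q + (u - v) * (T * T))
    Φ-lower′ = subst (λ w → T * T * u ≤ + 160 * K * w) (trunc-sq U x T) Φ-lower
    few-cut : + 40 * K * (u - v) ≤ u
    few-cut = *-cancelˡ-≤ (*-pos T>0 T>0) (by-difference
      (solve 5 (λ T u v K q → T :* T :* u := T :* T :* (con (+ 40) :* K :* (u :- v))
        :+ ((T :* T :* u :- con (+ 40) :* K :* (q :+ (u :- v) :* (T :* T))) :+ con (+ 40) :* K :* q)) refl T u v K q)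
      (difference Φ-upper′ ⊕ pos 40 ⊗ pos (suc k) ⊗ q≥0))
    u≤2v : u ≤ + 2 * v
    u≤2v = *-cancelˡ-≤ {+ 20} (+<+ (s≤s z≤n)) (by-difference
      (solve 3 (λ u v K → con (+ 20) :* (con (+ 2) :* v) := con (+ 20) :* u :+ ((u :- con (+ 40) :* K :* (u :- v)) :+ con (+ 40) :* (K :- con 1ℤ) :* (u :- v) :+ con (+ 19) :* u)) refl u v K)
      (difference few-cut ⊕ pos 40 ⊗ K-1≥0 ⊗ difference v≤u ⊕ pos 19 ⊗ size-nonneg U))
    v>0 : 0ℤ < v
    v>0 = ℤₚ.≰⇒> λ v≤0 → suc≰0 (by-difference {+ 1000000000} {0ℤ}
      (solve 3 (λ u v K → con 0ℤ := con (+ 1000000000) :+ ((u :- con (+ 1000000000) :* K) :+ (con (+ 2) :* v :- u) :+ con (+ 2) :* (:- v) :+ con (+ 1000000000) :* (K :- con 1ℤ))) refl u v K)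
      (difference u-large ⊕ difference u≤2v ⊕ pos 2 ⊗ nonpos⇒neg-nonneg v≤0 ⊕ pos 1000000000 ⊗ K-1≥0))
    3K≤v : + 3 * K ≤ v
    3K≤v = *-cancelˡ-≤ {+ 2} (+<+ (s≤s z≤n)) (by-difference
      (solve 3 (λ u v K → con (+ 2) :* v := con (+ 2) :* (con (+ 3) :* K) :+ ((con (+ 2) :* v :- u) :+ (u :- con (+ 1000000000) :* K) :+ con (+ 999999994) :* K)) refl u v K)
      (difference u≤2v ⊕ difference u-large ⊕ pos 999999994 ⊗ pos (suc k)))
    cut-mass : 0ℤ ≤ p - (u - v) * T
    cut-mass = subst (0ℤ ≤_) (solve 3 (λ p w c → p :- (w :+ c) :+ w := p :- c) refl p (wt U x) ((u - v) * T)) (difference (trunc-wt U x T) ⊕ wt≥0)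
    p≥0 : 0ℤ ≤ p
    p≥0 = subst (0ℤ ≤_) (solve 2 (λ p c → p :- c :+ c := p) refl p ((u - v) * T)) (cut-mass ⊕ difference v≤u ⊗ T≥0)
    q-upper : + 20 * K * q ≤ T * T * v
    q-upper = *-cancelˡ-≤ {+ 2} (+<+ (s≤s z≤n)) (by-difference
      (solve 5 (λ T u v K q → con (+ 2) :* (T :* T :* v) := con (+ 2) :* (con (+ 20) :* K :* q)
        :+ ((T :* T :* u :- con (+ 40) :* K :* (q :+ (u :- v) :* (T :* T))) :+ T :* T :* (con (+ 2) :* v :- u) :+ con (+ 40) :* K :* ((u :- v) :* (T :* T)))) refl T u v K q)
      (difference Φ-upper′ ⊕ T≥0 ⊗ T≥0 ⊗ difference u≤2v ⊕ pos 40 ⊗ pos (suc k) ⊗ (difference v≤u ⊗ (T≥0 ⊗ T≥0))))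
    -- In `Φ-lower′` the cut elements account for (u - v) T². By `cut-mass` this is at most T p.
    q-lower : T * T * v ≤ + 160 * K * (q + T * p)
    q-lower = by-difference
      (solve 6 (λ T u v K q p → con (+ 160) :* K :* (q :+ T :* p) := T :* T :* v
        :+ ((con (+ 160) :* K :* (q :+ (u :- v) :* (T :* T)) :- T :* T :* u) :+ T :* T :* (u :- v) :+ con (+ 160) :* K :* T :* (p :- (u :- v) :* T))) refl T u v K q p)
      (difference Φ-lower′ ⊕ T≥0 ⊗ T≥0 ⊗ difference v≤u ⊕ pos 160 ⊗ pos (suc k) ⊗ T≥0 ⊗ cut-mass)
    N-close : + 19 * N U (suc k) ≤ + 20 * N V (suc k)
    N-close = *-cancelˡ-≤ (*-pos (+<+ {0} {2} (s≤s z≤n)) v>0) (by-difference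
      (solve 5 (λ u v K a b → con (+ 2) :* v :* (con (+ 20) :* b) := con (+ 2) :* v :* (con (+ 19) :* a)
        :+ (con (+ 40) :* (v :* b :+ (u :- v) :* (K :* a) :- v :* a) :+ a :* (con (+ 2) :* v :- u) :+ a :* (u :- con (+ 40) :* K :* (u :- v)))) refl u v K (N U (suc k)) (N V (suc k)))
      (pos 40 ⊗ difference (N-ratio V U (suc k) (trunc-⊑ U x T)) ⊕ N-nonneg U (suc k) ⊗ difference u≤2v ⊕ N-nonneg U (suc k) ⊗ difference few-cut))

  -- Choice of the scale, and the dichotomy between spread and dominant weights

  search : (P : ℕ → Set) → (∀ t → Dec (P t)) → ∀ a d → ¬ P a → P (d ℕ.+ a) → Σ ℕ λ t → a ℕ.≤ t × ¬ P t × P (suc t)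
  search P P? a zero    ¬Pa Pd = ⊥-elim (¬Pa Pd)
  search P P? a (suc d) ¬Pa Pd with P? (d ℕ.+ a)
  ... | yes p = search P P? a d ¬Pa p
  ... | no ¬p = d ℕ.+ a , ℕₚ.m≤n+m a d , ¬p , Pd

  argmax : ∀ (U : Subset n) x → (∀ a → lookup U a ≡ false) ⊎ Σ (Fin n) λ a → lookup U a ≡ true × Bounded U x (x a)
  argmax []          x = inj₁ λ ()
  argmax (b ∷ U) x with argmax U (λ a → x (suc a))
  argmax (false ∷ U) x | inj₁ none = inj₁ λ { zero → refl ; (suc a) → none a }
  argmax (false ∷ U) x | inj₂ (a , a∈U , m) = inj₂ (suc a , a∈U , λ { (suc b) h → m b h })
  argmax (true ∷ U)  x | inj₁ none = inj₂ (zero , refl , λ { zero _ → ≤-refl ; (suc b) h → ⊥-elim (contra b h) })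
    where
    contra : ∀ b → lookup U b ≡ true → ⊥
    contra b h with trans (sym h) (none b)
    ... | ()
  argmax (true ∷ U)  x | inj₂ (a , a∈U , m) with x zero ≤? x (suc a)
  ... | yes h = inj₂ (suc a , a∈U , λ { zero _ → h ; (suc b) h′ → m b h′ })
  ... | no  h = inj₂ (zero , refl , λ { zero _ → ≤-refl ; (suc b) h′ → ≤-trans (m b h′) (ℤₚ.<⇒≤ (ℤₚ.≰⇒> h)) })

  lookup-del : ∀ (U : Subset n) a b → lookup (del U a) b ≡ true → lookup U b ≡ true
  lookup-del (c ∷ U) zero    zero    ()
  lookup-del (c ∷ U) zero    (suc b) h = h
  lookup-del (c ∷ U) (suc a) zero    h = h
  lookup-del (c ∷ U) (suc a) (suc b) h = lookup-del U a b h

  χ-false : ∀ (U : Subset n) a → lookup U a ≡ false → χ U a ≡ 0ℤ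
  χ-false U a e = cong ind e

  -- Leaving out nonpositive weights cannot decrease the total.
  all-nonneg-if-nonpos : ∀ (U : Subset n) x k → 0ℤ ≤ wt U x → Bounded U x 0ℤ → ∑ (subs U k) (λ Z → nonneg (wt Z x)) ≡ N U k
  all-nonneg-if-nonpos {n} U x k wt≥0 x≤0 = ∑ˢ-cong U k at
    where
    at : ∀ Z → IsSub U k Z → nonneg (wt Z x) ≡ 1ℤ
    at Z (Z⊑U , _) with nonneg-cases (wt Z x)
    ... | inj₁ (_ , eq) = eq
    ... | inj₂ (h , _)  = ⊥-elim (ℤₚ.<⇒≱ h (≤-trans wt≥0 (∑-mono (fins n) pointwise)))
      where
      pointwise : ∀ a → χ U a * x a ≤ χ Z a * x a
      pointwise a with bool-cases (lookup U a)
      ... | inj₁ a∈U = by-difference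
              (solve 3 (λ u z x → z :* x := u :* x :+ (u :- z) :* (:- x)) refl (χ U a) (χ Z a) (x a))
              (difference (χ-mono {V = Z} {U} Z⊑U a) ⊗ nonpos⇒neg-nonneg (x≤0 a a∈U))
      ... | inj₂ a∉U = ≤-reflexive (cong (λ c → c * x a) (trans (χ-false U a a∉U)
              (sym (trans (sym (Z⊑U a)) (trans (cong (λ c → χ Z a * c) (χ-false U a a∉U)) (zeroʳ (χ Z a)))))))

  -- The sets containing a are represented by their remaining k elements.
  Dominant : Subset n → (Fin n → ℤ) → ℕ → Fin n → Set
  Dominant U x k a = lookup U a ≡ true ×
    + 4 * (N (del U a) k - ∑ (subs (del U a) k) (λ Z → nonneg (x a + wt Z x))) ≤ N (del U a) k

  size-positive : ∀ (U : Subset n) k → + 1000000000 * + suc k ≤ size U → 0ℤ < size U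
  size-positive U k u-large = ℤₚ.<-≤-trans (*-pos (+<+ {0} {1000000000} (s≤s z≤n)) (+<+ {0} {suc k} (s≤s z≤n))) u-large

  module Extremal (U : Subset n) (x : Fin n → ℤ) (k : ℕ) (u-large : + 1000000000 * + suc k ≤ size U) (wt≥0 : 0ℤ ≤ wt U x)
    (a : Fin n) (a∈U : lookup U a ≡ true) (x≤xa : Bounded U x (x a)) where

    u = size U ; K = + suc k
    K-1≥0 : 0ℤ ≤ K - 1ℤ
    K-1≥0 = difference (+≤+ (s≤s z≤n))
    good : Subset _ → ℤ
    good Z = nonneg (wt Z x)
    Φ : ℕ → ℤ
    Φ t = wt U (sq (clipped x (+ t)))
    -- The variance of a K-subset sum of the clipped weights is about K Φ t / u; the test asks that
    -- it be at most t² / 40.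
    P : ℕ → Set
    P t = + 40 * K * Φ t ≤ + t * + t * u
    P? : ∀ t → Dec (P t)
    P? t = _ ≤? _

    trivial : Bounded U x 0ℤ → K * N U (suc k) ≤ u * ∑ (subs U (suc k)) good
    trivial x≤0 = subst (λ w → K * N U (suc k) ≤ u * w) (sym (all-nonneg-if-nonpos U x (suc k) wt≥0 x≤0)) (by-difference
      (solve 3 (λ u K N → u :* N := K :* N :+ ((u :- con (+ 1000000000) :* K) :+ con (+ 999999999) :* K) :* N) refl u K (N U (suc k)))
      ((difference u-large ⊕ pos 999999999 ⊗ pos (suc k)) ⊗ N-nonneg U (suc k)))

    -- The scale `x a` itself passes the test. Deleting `a` costs one element of the size and
    -- shrinks `Φ`; relaxing 40 to 20 pays for the lost element. The remaining total plus `x a` is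
    -- the original total, hence nonnegative.
    dominant : ∀ m → x a ≡ + suc m → P (suc m) → Dominant U x k a
    dominant m eq Pm = a∈U , subst (λ M → + 4 * (N U′ k - ∑ (subs U′ k) (λ Z → nonneg (M + wt Z x))) ≤ N U′ k) (sym eq)
      (few-failures U′ x k M (+<+ (s≤s z≤n)) (λ b b∈ → subst (x b ≤_) eq (x≤xa b (lookup-del U a b b∈)))
        (subst (0ℤ ≤_) (sym (trans (cong (λ w → w + M) (wt-del U a x)) (trans (cong₂ (λ c y → wt U x - c * y + M) (cong ind a∈U) eq)
          (solve 2 (λ w M → w :- con 1ℤ :* M :+ M := w) refl (wt U x) M)))) wt≥0)
        (by-difference (trans (trans (size-del U a a∈U) (solve 2 (λ u K → u :- con 1ℤ := con (+ 100) :* K :+ ((u :- con (+ 1000000000) :* K) :+ con (+ 999999900) :* (K :- con 1ℤ) :+ con (+ 999999899))) refl u K))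
            (cong (λ c → + 100 * c + ((u - + 1000000000 * K) + + 999999900 * (K - 1ℤ) + + 999999899)) (pos-+ 1 k)))
          (difference u-large ⊕ pos 999999900 ⊗ K-1≥0 ⊕ pos 999999899))
        Φ-small)
      where
      U′ = del U a ; M = + suc m
      c² = sq (clipped x M) a
      Φ-small : + 20 * (1ℤ + + k) * wt U′ (sq (clipped x M)) ≤ M * M * size U′
      Φ-small = subst₂ _≤_ (cong₂ (λ c w → + 20 * c * w) (pos-+ 1 k) (sym (trans (wt-del U a (sq (clipped x M))) (cong (λ c → Φ (suc m) - c * c²) (cong ind a∈U)))))
        (cong (λ w → M * M * w) (sym (size-del U a a∈U)))
        (*-cancelˡ-≤ {+ 2} (+<+ (s≤s z≤n)) (by-difference
          (solve 5 (λ M u K f c → con (+ 2) :* (M :* M :* (u :- con 1ℤ)) := con (+ 2) :* (con (+ 20) :* K :* (f :- con 1ℤ :* c))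
            :+ ((M :* M :* u :- con (+ 40) :* K :* f) :+ M :* M :* ((u :- con (+ 1000000000) :* K) :+ con (+ 1000000000) :* (K :- con 1ℤ) :+ con (+ 999999998)) :+ con (+ 40) :* K :* c)) refl M u K (Φ (suc m)) c²)
          (difference Pm ⊕ square-nonneg M ⊗ (difference u-large ⊕ pos 1000000000 ⊗ K-1≥0 ⊕ pos 999999998) ⊕ pos 40 ⊗ pos (suc k) ⊗ square-nonneg (clipped x M a))))

    -- Clipping never increases the second moment, so a scale t with t ≥ q satisfies Φ t ≤ q ≤ t²,
    -- and u ≥ 10⁹ K far exceeds 40 K.
    P-eventually : ∀ m → P (ℤ.∣ wt U (sq x) ∣ ℕ.+ suc m)
    P-eventually m = by-difference
      (solve 5 (λ t u K f q → t :* t :* u := con (+ 40) :* K :* f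
         :+ (t :* t :* ((u :- con (+ 1000000000) :* K) :+ con (+ 999999960) :* K) :+ con (+ 40) :* K :* ((q :- f) :+ (t :- q) :+ t :* (t :- con 1ℤ)))) refl (+ t) u K (Φ t) q)
      (square-nonneg (+ t) ⊗ (difference u-large ⊕ pos 999999960 ⊗ pos (suc k))
        ⊕ pos 40 ⊗ pos (suc k) ⊗ (difference (wt-mono U (λ b → clip-sq-≤ (x b) (pos t))) ⊕ difference q≤t ⊕ pos t ⊗ difference (+≤+ (ℕₚ.≤-trans (s≤s z≤n) (ℕₚ.m≤n+m (suc m) ℤ.∣ q ∣)))))
      where
      q = wt U (sq x)
      t = ℤ.∣ q ∣ ℕ.+ suc m
      q≤t : q ≤ + t
      q≤t = ≤-trans (≤-reflexive (sym (ℤₚ.0≤i⇒+∣i∣≡i (wt-sq-nonneg U x)))) (+≤+ (ℕₚ.m≤m+n ℤ.∣ q ∣ (suc m)))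

    -- The test fails at t and holds at t + 1, the scale that is used. There the lower bound follows
    -- by monotonicity: 160 K Φ (t + 1) ≥ 4 (40 K Φ t) ≥ 4 t² u ≥ (t + 1)² u, as t ≥ 1. This is why
    -- 160 is 4 times 40.
    spread : ∀ m → x a ≡ + suc m → (Σ ℕ λ t → suc m ℕ.≤ t × ¬ P t × P (suc t)) → K * N U (suc k) ≤ u * ∑ (subs U (suc k)) good
    spread m eq (t , m<t , ¬Pt , Pt) = many-if-spread U x k (+ suc t) (+<+ (s≤s z≤n))
            (λ b b∈U → ≤-trans (x≤xa b b∈U) (≤-trans (≤-reflexive eq) (+≤+ (ℕₚ.m≤n⇒m≤1+n m<t)))) wt≥0 u-large Pt
            (by-difference
              (trans (solve 5 (λ t u K f f′ → con (+ 160) :* K :* f′ := (con 1ℤ :+ t) :* (con 1ℤ :+ t) :* u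
                  :+ (con (+ 160) :* K :* (f′ :- f) :+ con (+ 4) :* (con (+ 40) :* K :* f :- t :* t :* u) :+ (con (+ 3) :* (t :- con 1ℤ) :* (t :- con 1ℤ) :+ con (+ 4) :* (t :- con 1ℤ)) :* u)) refl (+ t) u K (Φ t) (Φ (suc t)))
                (cong (λ w → w * w * u + (+ 160 * K * (Φ (suc t) - Φ t) + + 4 * (+ 40 * K * Φ t - + t * + t * u) + (+ 3 * (+ t - 1ℤ) * (+ t - 1ℤ) + + 4 * (+ t - 1ℤ)) * u)) (sym (pos-+ 1 t))))
              (pos 160 ⊗ pos (suc k) ⊗ difference (wt-mono U (λ b → clip-sq-mono (x b) (pos t) (+≤+ (ℕₚ.n≤1+n t))))
                ⊕ pos 4 ⊗ difference (ℤₚ.<⇒≤ (ℤₚ.≰⇒> ¬Pt))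
                ⊕ (pos 3 ⊗ t-1≥0 ⊗ t-1≥0 ⊕ pos 4 ⊗ t-1≥0) ⊗ size-nonneg U))
      where
      t-1≥0 : 0ℤ ≤ + t - 1ℤ
      t-1≥0 = difference (+≤+ (ℕₚ.≤-trans (s≤s z≤n) m<t))

    by-sign : ∀ y → x a ≡ y → (K * N U (suc k) ≤ u * ∑ (subs U (suc k)) good) ⊎ Σ (Fin _) (Dominant U x k)
    by-sign -[1+ m ]  eq = inj₁ (trivial (λ b b∈U → ≤-trans (x≤xa b b∈U) (subst (_≤ 0ℤ) (sym eq) ℤ.-≤+)))
    by-sign (+ zero)  eq = inj₁ (trivial (λ b b∈U → ≤-trans (x≤xa b b∈U) (≤-reflexive eq)))
    by-sign (+ suc m) eq with P? (suc m)
    ... | yes Pm = inj₂ (a , dominant m eq Pm)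
    ... | no ¬Pm = inj₁ (spread m eq (search P P? (suc m) ℤ.∣ wt U (sq x) ∣ ¬Pm (P-eventually m)))


  spread-or-dominant : ∀ (U : Subset n) x k → + 1000000000 * + suc k ≤ size U → 0ℤ ≤ wt U x →
    (+ suc k * N U (suc k) ≤ size U * ∑ (subs U (suc k)) (λ Z → nonneg (wt Z x))) ⊎ Σ (Fin n) (Dominant U x k)
  spread-or-dominant {n} U x k u-large wt≥0 with argmax U x
  ... | inj₁ none = ⊥-elim (ℤₚ.<-irrefl (sym (trans (∑-cong (fins n) (λ a → χ-false U a (none a))) (∑-zero (fins n)))) (size-positive U k u-large))
  ... | inj₂ (a , a∈U , x≤xa) = Extremal.by-sign U x k u-large wt≥0 a a∈U x≤xa (x a) refl

  good-split : ∀ (U : Subset n) x a k → lookup U a ≡ true → ∑ (subs U (suc k)) (λ Z → nonneg (wt Z x)) ≡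
    ∑ (subs (del U a) k) (λ Z → nonneg (x a + wt Z x)) + ∑ (subs (del U a) (suc k)) (λ Z → nonneg (wt Z x))
  good-split U x a k a∈U = trans (∑-split U a k (λ Z → nonneg (wt Z x)) a∈U)
    (cong (λ w → w + ∑ (subs (del U a) (suc k)) (λ Z → nonneg (wt Z x))) (∑ˢ-cong (del U a) k λ Z (Z⊑ , _) → cong nonneg (trans (wt-ins Z a x)
      (trans (cong (λ c → wt Z x + (1ℤ - c) * x a) (χ-⊑-del U Z a Z⊑))
        (solve 2 (λ w y → w :+ (con 1ℤ :- con 0ℤ) :* y := y :+ w) refl (wt Z x) (x a))))))

  -- Spread weights give the inequality without the factor 3/4. For a dominant element, absorption
  -- turns `N (del U a) k` into K N / u, three quarters of these sets are good, and the good sets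
  -- avoiding it are discarded.
  weak-bound : ∀ (U : Subset n) x k → + 1000000000 * + suc k ≤ size U → 0ℤ ≤ wt U x →
    + 3 * (+ suc k * N U (suc k)) ≤ + 4 * (size U * ∑ (subs U (suc k)) (λ Z → nonneg (wt Z x)))
  weak-bound {n} U x k u-large wt≥0 = [ if-spread , if-dominant ]′ (spread-or-dominant U x k u-large wt≥0)
    where
    u = size U
    G = ∑ (subs U (suc k)) (λ Z → nonneg (wt Z x))
    if-spread : + suc k * N U (suc k) ≤ u * G → + 3 * (+ suc k * N U (suc k)) ≤ + 4 * (u * G)
    if-spread h = by-difference
      (solve 2 (λ a b → con (+ 4) :* b := con (+ 3) :* a :+ (con (+ 4) :* (b :- a) :+ a)) refl (+ suc k * N U (suc k)) (u * G))
      (pos 4 ⊗ difference h ⊕ pos (suc k) ⊗ N-nonneg U (suc k))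
    if-dominant : Σ (Fin n) (Dominant U x k) → + 3 * (+ suc k * N U (suc k)) ≤ + 4 * (u * G)
    if-dominant (a , a∈U , few) = subst₂ (λ y g → + 3 * y ≤ + 4 * (u * g)) (sym K*N≡) (sym (good-split U x a k a∈U)) (by-difference
      (solve 4 (λ u m c w → con (+ 4) :* (u :* (c :+ w)) := con (+ 3) :* (u :* m) :+ (u :* (m :- con (+ 4) :* (m :- c)) :+ con (+ 4) :* (u :* w))) refl u (N U′ k) G₁ G₂)
      (size-nonneg U ⊗ difference few ⊕ pos 4 ⊗ (size-nonneg U ⊗ ∑-nonneg (subs U′ (suc k)) (λ _ → nonneg-nonneg _))))
      where
      U′ = del U a
      G₁ = ∑ (subs U′ k) (λ Z → nonneg (x a + wt Z x))
      G₂ = ∑ (subs U′ (suc k)) (λ Z → nonneg (wt Z x))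
      K*N≡ : + suc k * N U (suc k) ≡ u * N U′ k
      K*N≡ = trans (cong (λ c → c * N U (suc k)) (pos-+ 1 k)) (N-absorption U a k a∈U)

  -- Variance over disjoint subsets

  N-zero : (U : Subset n) → N U 0 ≡ 1ℤ
  N-zero U = trans (N-C U 0) (cong +_ (nC0≡1 ∣ U ∣))

  positive-factor : ∀ {a b} → 0ℤ ≤ a → 0ℤ < a * b → 0ℤ < b
  positive-factor {a} {b} a≥0 ab>0 = ℤₚ.≰⇒> λ b≤0 → ℤₚ.<⇒≱ ab>0 (by-difference
    (solve 2 (λ a b → con 0ℤ := a :* b :+ a :* (:- b)) refl a b) (a≥0 ⊗ nonpos⇒neg-nonneg b≤0))

  N-positive : ∀ (U : Subset n) k → + k ≤ size U → 0ℤ < N U k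
  N-positive U zero    _    = subst (0ℤ <_) (sym (N-zero U)) (+<+ (s≤s z≤n))
  N-positive U (suc k) 1+k≤u = positive-factor (pos 1 ⊕ pos k) (subst (0ℤ <_) (sym (N-step U k))
    (*-pos (+1≤⇒< (by-difference (trans (solve 2 (λ u k → u :- k := con 0ℤ :+ con 1ℤ :+ (u :- (con 1ℤ :+ k))) refl (size U) (+ k))
        (cong (λ w → 0ℤ + 1ℤ + (size U - w)) (sym (pos-+ 1 k)))) (difference 1+k≤u)))
      (N-positive U k (≤-trans (+≤+ (ℕₚ.n≤1+n k)) 1+k≤u))))

  -- `f` is the indicator of a family of sets, expressed by idempotence so that f² can be replaced
  -- by f in a sum of squares.
  module Variance (k : ℕ) (k>0 : 0ℤ < + k) (f : Subset n → ℤ) (f≥0 : ∀ Z → 0ℤ ≤ f Z) (f²≡f : ∀ Z → f Z * f Z ≡ f Z) where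

    W : Subset n → ℤ
    W U = ∑ (subs U k) f

    W-nonneg : ∀ U → 0ℤ ≤ W U
    W-nonneg U = ∑-nonneg (subs U k) f≥0

    deleted : Subset n → Fin n → ℤ
    deleted U a = W (del U a)

    χ-deleted : ∀ U a → χ U a * W (del U a) ≡ χ U a * ∑ (subs U k) (λ Z → (1ℤ - χ Z a) * f Z)
    χ-deleted U a with bool-cases (lookup U a)
    ... | inj₁ a∈U = cong (λ w → χ U a * w) (sym (∑-avoiding U a k f a∈U))
    ... | inj₂ a∉U = trans (cong (λ c → c * W (del U a)) (χ-false U a a∉U)) (trans (zeroˡ _)
        (sym (trans (cong (λ c → c * ∑ (subs U k) (λ Z → (1ℤ - χ Z a) * f Z)) (χ-false U a a∉U)) (zeroˡ _))))

    wt-deleted : ∀ U → wt U (deleted U) ≡ (size U - + k) * W U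
    wt-deleted U = begin
      wt U (deleted U)                                                            ≡⟨ ∑-cong (fins n) (χ-deleted U) ⟩
      ∑ (fins n) (λ a → χ U a * ∑ (subs U k) (λ Z → (1ℤ - χ Z a) * f Z))           ≡⟨ ∑-cong (fins n) (λ a → sym (∑-* (subs U k) (χ U a) _)) ⟩
      ∑ (fins n) (λ a → ∑ (subs U k) (λ Z → χ U a * ((1ℤ - χ Z a) * f Z)))         ≡⟨ ∑-swap (fins n) (subs U k) _ ⟩
      ∑ (subs U k) (λ Z → ∑ (fins n) (λ a → χ U a * ((1ℤ - χ Z a) * f Z)))         ≡⟨ ∑ˢ-cong U k (λ Z s → trans (out-const U Z k (f Z) s) (*-comm (f Z) _)) ⟩
      ∑ (subs U k) (λ Z → (size U - + k) * f Z)                                   ≡⟨ ∑-* (subs U k) (size U - + k) f ⟩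
      (size U - + k) * W U ∎
      where open ≡-Reasoning

    module OneStep (U : Subset n) (U-large : + k < size U) where
      private
        m = size U ; K = + k ; D = size U - + k ; w = W U ; M = N U k
        e : Fin n → ℤ
        e a = m * deleted U a - D * w
        E₂ = wt U (sq e)
        SQ = wt U (sq (deleted U))
        D≥0 : 0ℤ ≤ D
        D≥0 = difference (ℤₚ.<⇒≤ U-large)
        m>0 : 0ℤ < m
        m>0 = ℤₚ.<-trans k>0 U-large
        M>0 : 0ℤ < M
        M>0 = N-positive U k (ℤₚ.<⇒≤ U-large)

        wt-e : wt U e ≡ 0ℤ
        wt-e = trans (wt-affine U m (D * w) (deleted U)) (trans (cong (λ v → m * v - D * w * m) (wt-deleted U))
          (solve 3 (λ m D w → m :* (D :* w) :- D :* w :* m := con 0ℤ) refl m D w))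

        E₂-expand : E₂ ≡ m * m * SQ - m * (D * D * (w * w))
        E₂-expand = begin
          E₂ ≡⟨ ∑-cong (fins n) (λ a → solve 4 (λ u m y c → u :* ((m :* y :- c) :* (m :* y :- c))
                  := m :* m :* (u :* (y :* y)) :+ ((:- (con (+ 2) :* m :* c)) :* (u :* y) :+ c :* c :* u)) refl (χ U a) m (deleted U a) (D * w)) ⟩
          ∑ (fins n) (λ a → m * m * (χ U a * sq (deleted U) a) + (- (+ 2 * m * (D * w)) * (χ U a * deleted U a) + D * w * (D * w) * χ U a))
             ≡⟨ trans (∑-+ (fins n) _ _) (cong₂ _+_ (∑-* (fins n) (m * m) _)
                  (trans (∑-+ (fins n) _ _) (cong₂ _+_ (∑-* (fins n) (- (+ 2 * m * (D * w))) _) (∑-* (fins n) (D * w * (D * w)) _)))) ⟩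
          m * m * SQ + (- (+ 2 * m * (D * w)) * wt U (deleted U) + D * w * (D * w) * m)
             ≡⟨ cong (λ v → m * m * SQ + (- (+ 2 * m * (D * w)) * v + D * w * (D * w) * m)) (wt-deleted U) ⟩
          m * m * SQ + (- (+ 2 * m * (D * w)) * (D * w) + D * w * (D * w) * m)
             ≡⟨ solve 4 (λ m D w s → m :* m :* s :+ ((:- (con (+ 2) :* m :* (D :* w))) :* (D :* w) :+ D :* w :* (D :* w) :* m)
                  := m :* m :* s :- m :* (D :* D :* (w :* w))) refl m D w SQ ⟩
          m * m * SQ - m * (D * D * (w * w)) ∎
          where open ≡-Reasoning

        -- Deleting `a` loses exactly the members of the family through `a`, so `deleted` falls as
        -- the degree of `a` grows. Weighting by `e` turns these degrees into -E₂; the constant part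
        -- vanishes by `wt-e`.
        correlation : m * ∑ (subs U k) (λ Z → wt Z e * f Z) ≡ - E₂
        correlation = begin
          m * ∑ (subs U k) (λ Z → wt Z e * f Z)
            ≡⟨ cong (λ v → m * v) (∑ˢ-cong U k expand) ⟩
          m * ∑ (subs U k) (λ Z → ∑ (fins n) (λ a → χ U a * e a * (f Z - (1ℤ - χ Z a) * f Z)))
            ≡⟨ cong (λ v → m * v) (∑-swap (subs U k) (fins n) _) ⟩
          m * ∑ (fins n) (λ a → ∑ (subs U k) (λ Z → χ U a * e a * (f Z - (1ℤ - χ Z a) * f Z)))
            ≡⟨ cong (λ v → m * v) (∑-cong (fins n) (λ a → trans (∑-* (subs U k) (χ U a * e a) _) (cong (λ v → χ U a * e a * v) (∑-minus (subs U k) f _)))) ⟩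
          m * ∑ (fins n) (λ a → χ U a * e a * (w - ∑ (subs U k) (λ Z → (1ℤ - χ Z a) * f Z)))
            ≡⟨ sym (∑-* (fins n) m _) ⟩
          ∑ (fins n) (λ a → m * (χ U a * e a * (w - ∑ (subs U k) (λ Z → (1ℤ - χ Z a) * f Z))))
            ≡⟨ ∑-cong (fins n) (λ a → trans
                 (solve 5 (λ m u e w s → m :* (u :* e :* (w :- s)) := m :* e :* (u :* w :- u :* s)) refl m (χ U a) (e a) w (∑ (subs U k) (λ Z → (1ℤ - χ Z a) * f Z)))
                 (trans (cong (λ v → m * e a * (χ U a * w - v)) (sym (χ-deleted U a)))
                 (solve 5 (λ m u D w y → m :* (m :* y :- D :* w) :* (u :* w :- u :* y)
                    := (m :* w :- D :* w) :* (u :* (m :* y :- D :* w)) :- u :* ((m :* y :- D :* w) :* (m :* y :- D :* w))) refl m (χ U a) D w (deleted U a)))) ⟩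
          ∑ (fins n) (λ a → (m * w - D * w) * (χ U a * e a) - χ U a * sq e a)
            ≡⟨ trans (∑-minus (fins n) _ _) (cong (λ v → v - E₂) (trans (∑-* (fins n) (m * w - D * w) _) (cong (λ v → (m * w - D * w) * v) wt-e))) ⟩
          (m * w - D * w) * 0ℤ - E₂
            ≡⟨ solve 2 (λ c e → c :* con 0ℤ :- e := :- e) refl (m * w - D * w) E₂ ⟩
          - E₂ ∎
          where
          open ≡-Reasoning
          expand : ∀ Z → IsSub U k Z → wt Z e * f Z ≡ ∑ (fins n) (λ a → χ U a * e a * (f Z - (1ℤ - χ Z a) * f Z))
          expand Z (p , _) = trans (*-comm (wt Z e) (f Z)) (trans (sym (∑-* (fins n) (f Z) _)) (∑-cong (fins n) (λ a →
            trans (cong (λ c → f Z * (c * e a)) (sym (p a)))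
              (solve 4 (λ y z u e → y :* (z :* u :* e) := u :* e :* (y :- (con 1ℤ :- z) :* y)) refl (f Z) (χ Z a) (χ U a) (e a)))))

        -- Cauchy-Schwarz between `f` and the statistic `wt Z e`, without division. `M₂-upper`
        -- bounds the mean square of that statistic by a multiple of the same `E₂`. With this `c`
        -- the cross term is -2 D M K E₂, the square term at most D M K E₂, and a linear bound on
        -- `E₂` remains.
        c = M * K * m

        square-sum : 0ℤ ≤ D * D * M₂ U e k + + 2 * D * c * ∑ (subs U k) (λ Z → wt Z e * f Z) + c * c * w
        square-sum = subst (0ℤ ≤_)
          (trans (∑-cong (subs U k) (λ Z → trans
              (solve 4 (λ D c l y → (D :* l :+ c :* y) :* (D :* l :+ c :* y) := D :* D :* (l :* l) :+ con (+ 2) :* D :* c :* (l :* y) :+ c :* c :* (y :* y)) refl D c (wt Z e) (f Z))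
              (cong (λ v → D * D * (wt Z e * wt Z e) + + 2 * D * c * (wt Z e * f Z) + c * c * v) (f²≡f Z))))
            (trans (∑-+ (subs U k) _ _) (cong₂ _+_ (trans (∑-+ (subs U k) _ _) (cong₂ _+_ (∑-* (subs U k) (D * D) _) (∑-* (subs U k) (+ 2 * D * c) _)))
              (∑-* (subs U k) (c * c) f))))
          (∑-nonneg (subs U k) (λ Z → square-nonneg (D * wt Z e + c * f Z)))

        E₂-bound : D * E₂ ≤ M * K * (m * m) * w
        E₂-bound = *-cancelˡ-≤ (*-pos M>0 k>0) (by-difference
          (trans (solve 7 (λ M K m D w E B → M :* K :* (M :* K :* (m :* m) :* w) := M :* K :* (D :* E)
              :+ ((D :* D :* B :+ con (+ 2) :* D :* (M :* K) :* (:- E) :+ M :* K :* m :* (M :* K :* m) :* w) :+ D :* (K :* E :* M :- D :* B))) refl M K m D w E₂ (M₂ U e k))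
            (cong (λ v → M * K * (D * E₂) + (v + D * (K * E₂ * M - D * M₂ U e k)))
              (trans (cong (λ v → D * D * M₂ U e k + + 2 * D * (M * K) * v + c * c * w) (sym correlation))
                (cong (λ v → D * D * M₂ U e k + v + c * c * w) (solve 5 (λ D M K m s → con (+ 2) :* D :* (M :* K) :* (m :* s) := con (+ 2) :* D :* (M :* K :* m) :* s) refl D M K m (∑ (subs U k) (λ Z → wt Z e * f Z)))))))
          (square-sum ⊕ D≥0 ⊗ difference (M₂-upper U e D k wt-e D≥0 (≤-reflexive (solve 2 (λ m K → m :- K :+ K := m) refl m K)))))

      -- In terms of the density w / M, whose mean is preserved under deletion, one random deletion
      -- raises the mean square by at most K m / D³ times the density. This increment is linear in
      -- the density, which matters for sparse families.
      one-step : D * m * SQ ≤ D * D * D * (w * w) + M * K * m * w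
      one-step = *-cancelˡ-≤ m>0 (by-difference
        (trans (solve 6 (λ m D w M K s → m :* (D :* D :* D :* (w :* w) :+ M :* K :* m :* w) := m :* (D :* m :* s)
            :+ (M :* K :* (m :* m) :* w :- D :* (m :* m :* s :- m :* (D :* D :* (w :* w))))) refl m D w M K SQ)
          (cong (λ v → m * (D * m * SQ) + (M * K * (m * m) * w - D * v)) (sym E₂-expand)))
        (difference E₂-bound))

  -- Density on the complement of a random set

  diff : Subset n → Subset n → Subset n
  diff = zipWith (λ u a → u ∧ not a)

  χ-diff : ∀ (U A : Subset n) a → χ (diff U A) a ≡ χ U a * (1ℤ - χ A a)
  χ-diff (true ∷ U)  (true ∷ A)  zero = solve 0 (con 0ℤ := con 1ℤ :* (con 1ℤ :- con 1ℤ)) refl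
  χ-diff (true ∷ U)  (false ∷ A) zero = solve 0 (con 1ℤ := con 1ℤ :* (con 1ℤ :- con 0ℤ)) refl
  χ-diff (false ∷ U) (b ∷ A)     zero = solve 1 (λ b → con 0ℤ := con 0ℤ :* (con 1ℤ :- b)) refl (ind b)
  χ-diff (_ ∷ U)     (_ ∷ A) (suc a)  = χ-diff U A a

  wt-diff : ∀ (U A : Subset n) e → A ⊑ U → wt (diff U A) e ≡ wt U e - wt A e
  wt-diff {n} U A e p = trans (∑-cong (fins n) (λ a → trans (cong (λ c → c * e a) (χ-diff U A a)) (*-assoc (χ U a) (1ℤ - χ A a) (e a)))) (∑-outside U A e p)

  size-diff : ∀ (U A : Subset n) j → IsSub U j A → size (diff U A) ≡ size U - + j
  size-diff {n} U A j s = trans (∑-cong (fins n) (χ-diff U A)) (∑-outside-1 U A j s)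

  diff-ins : ∀ (U A : Subset n) a → diff U (ins A a) ≡ del (diff U A) a
  diff-ins (true ∷ U)  (b ∷ A) zero    = refl
  diff-ins (false ∷ U) (b ∷ A) zero    = refl
  diff-ins (c ∷ U)     (b ∷ A) (suc a) = cong (λ t → (c ∧ not b) ∷ t) (diff-ins U A a)

  ∑-diff-zero : ∀ (U : Subset n) (g : Subset n → ℤ) → ∑ (subs U 0) (λ A → g (diff U A)) ≡ g U
  ∑-diff-zero []          g = +-identityʳ (g [])
  ∑-diff-zero (true ∷ U)  g = trans (∑-map (false ∷_) (subs U 0) _) (∑-diff-zero U (λ Z → g (true ∷ Z)))
  ∑-diff-zero (false ∷ U) g = trans (∑-map (false ∷_) (subs U 0) _) (∑-diff-zero U (λ Z → g (false ∷ Z)))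

  C-step : ∀ m k → (1ℤ + + k) * + (m C suc k) ≡ (+ m - + k) * + (m C k)
  C-step m k = subst₂ _≡_ (cong (λ w → (1ℤ + + k) * w) (N⊤ (suc k))) (cong₂ (λ s w → (s - + k) * w) (trans (size-∣∣ (⊤ {m})) (cong +_ (∣⊤∣≡n m))) (N⊤ k)) (N-step (⊤ {m}) k)
    where
    N⊤ : ∀ k → N (⊤ {m}) k ≡ + (m C k)
    N⊤ k = trans (N-C (⊤ {m}) k) (cong (λ l → + (l C k)) (∣⊤∣≡n m))

  C-delete : ∀ m k → + suc m * + (m C k) ≡ (+ suc m - + k) * + (suc m C k)
  C-delete m k = trans (sym (C-absorption m k)) (C-step (suc m) k)

  -- `r` is a common lower bound for u - j - k over all deletion steps j < k, so that the increments
  -- of the separate steps can be added.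
  module Concentration (k : ℕ) (k>0 : 0ℤ < + k) (f : Subset n → ℤ) (f≥0 : ∀ Z → 0ℤ ≤ f Z) (f²≡f : ∀ Z → f Z * f Z ≡ f Z)
    (U₀ : Subset n) (r : ℤ) (r≥0 : 0ℤ ≤ r) (r-small : r + + 2 * + k ≤ size U₀) (U₀-large : + 10 * + k ≤ size U₀) where

    open Variance k k>0 f f≥0 f²≡f

    u = size U₀ ; K = + k ; G = W U₀

    M : ℕ → ℤ
    M j = + ((∣ U₀ ∣ ℕ.∸ j) C k)

    c S Q : ℕ → ℤ
    c j = N U₀ j
    S j = ∑ (subs U₀ j) (λ A → W (diff U₀ A))
    Q j = ∑ (subs U₀ j) (λ A → W (diff U₀ A) * W (diff U₀ A))

    M-zero : M 0 ≡ N U₀ k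
    M-zero = sym (N-C U₀ k)

    ∣diff∣ : ∀ A j → IsSub U₀ j A → ∣ diff U₀ A ∣ ≡ ∣ U₀ ∣ ℕ.∸ j
    ∣diff∣ A j s = trans (sym (ℕₚ.m+n∸n≡m ∣ diff U₀ A ∣ j)) (cong (ℕ._∸ j) (ℤₚ.+-injective
      (trans (pos-+ _ j) (trans (cong (λ w → w + + j) (trans (sym (size-∣∣ (diff U₀ A))) (size-diff U₀ A j s)))
        (trans (solve 2 (λ u j → u :- j :+ j := u) refl u (+ j)) (size-∣∣ U₀))))))

    N-diff : ∀ A j → IsSub U₀ j A → N (diff U₀ A) k ≡ M j
    N-diff A j s = trans (N-C (diff U₀ A) k) (cong (λ l → + (l C k)) (∣diff∣ A j s))

    M-step : ∀ j → + suc j ≤ u → (u - + j) * M (suc j) ≡ (u - + j - K) * M j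
    M-step j j<u = subst₂ (λ m l → m * M (suc j) ≡ (m - K) * + (l C k)) m≡ eq (C-delete (∣ U₀ ∣ ℕ.∸ suc j) k)
      where
      j<∣U₀∣ : suc j ℕ.≤ ∣ U₀ ∣
      j<∣U₀∣ = ℤₚ.drop‿+≤+ (subst (+ suc j ≤_) (size-∣∣ U₀) j<u)
      eq : suc (∣ U₀ ∣ ℕ.∸ suc j) ≡ ∣ U₀ ∣ ℕ.∸ j
      eq = sym (ℕₚ.+-∸-assoc 1 j<∣U₀∣)
      m≡ : + suc (∣ U₀ ∣ ℕ.∸ suc j) ≡ u - + j
      m≡ = trans (cong +_ eq) (trans (solve 2 (λ a j → a := a :+ j :- j) refl (+ (∣ U₀ ∣ ℕ.∸ j)) (+ j))
        (cong (λ w → w - + j) (trans (sym (pos-+ _ j)) (trans (cong +_ (ℕₚ.m∸n+n≡m (ℕₚ.≤-trans (ℕₚ.n≤1+n j) j<∣U₀∣))) (sym (size-∣∣ U₀))))))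

    ∑-diff-exchange : ∀ j (g : Subset n → ℤ) →
      (1ℤ + + j) * ∑ (subs U₀ (suc j)) (λ A → g (diff U₀ A)) ≡ ∑ (subs U₀ j) (λ A → wt (diff U₀ A) (λ a → g (del (diff U₀ A) a)))
    ∑-diff-exchange j g = trans (∑-exchange U₀ j (λ A → g (diff U₀ A))) (∑-cong (subs U₀ j) λ A → ∑-cong (fins n) λ a →
      trans (sym (*-assoc (χ U₀ a) (1ℤ - χ A a) _)) (cong₂ _*_ (sym (χ-diff U₀ A a)) (cong g (diff-ins U₀ A a))))

    S-step : ∀ j → (1ℤ + + j) * S (suc j) ≡ (u - + j - K) * S j
    S-step j = trans (∑-diff-exchange j W) (trans
      (∑ˢ-cong U₀ j λ A s → trans (wt-deleted (diff U₀ A)) (cong (λ w → (w - K) * W (diff U₀ A)) (size-diff U₀ A j s)))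
      (∑-* (subs U₀ j) (u - + j - K) _))

    2k+j<u : ∀ {j} → j ℕ.< k → 0ℤ ≤ u - + j - + 2 * K - 1ℤ
    2k+j<u {j} j<k = subst (0ℤ ≤_)
      (solve 3 (λ u j K → (u :- con (+ 10) :* K) :+ (K :- (con 1ℤ :+ j)) :+ con (+ 7) :* K := u :- j :- con (+ 2) :* K :- con 1ℤ) refl u (+ j) K)
      (difference U₀-large ⊕ difference (subst (_≤ K) (pos-+ 1 j) (+≤+ j<k)) ⊕ pos 7 ⊗ pos k)

    -- Both the sum of `W` over the complements and the number of k-sets inside them are multiplied
    -- by the same factor at each step, so the mean density remains G / N.
    S-formula : ∀ j → j ℕ.≤ k → S j * N U₀ k ≡ c j * M j * G
    S-formula zero _ = trans (cong (λ s → s * N U₀ k) (∑-diff-zero U₀ W)) (trans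
      (solve 2 (λ g m → g :* m := con 1ℤ :* m :* g) refl G (N U₀ k)) (cong₂ (λ a b → a * b * G) (sym (N-zero U₀)) (sym M-zero)))
    S-formula (suc j) j<k = *-cancelˡ-≡ (0<1+ j) (begin
      J₁ * (S (suc j) * N₀)               ≡⟨ *-assoc J₁ (S (suc j)) N₀ ⟨
      J₁ * S (suc j) * N₀                 ≡⟨ cong (λ w → w * N₀) (S-step j) ⟩
      D * S j * N₀                        ≡⟨ *-assoc D (S j) N₀ ⟩
      D * (S j * N₀)                      ≡⟨ cong (λ w → D * w) (S-formula j (ℕₚ.<⇒≤ j<k)) ⟩
      D * (c j * M j * G)                 ≡⟨ solve 4 (λ D c m g → D :* (c :* m :* g) := c :* (D :* m) :* g) refl D (c j) (M j) G ⟩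
      c j * (D * M j) * G                 ≡⟨ cong (λ w → c j * w * G) (M-step j j<u) ⟨
      c j * ((u - + j) * M (suc j)) * G   ≡⟨ solve 4 (λ c v m g → c :* (v :* m) :* g := v :* c :* m :* g) refl (c j) (u - + j) (M (suc j)) G ⟩
      (u - + j) * c j * M (suc j) * G     ≡⟨ cong (λ w → w * M (suc j) * G) (N-step U₀ j) ⟨
      J₁ * c (suc j) * M (suc j) * G      ≡⟨ solve 4 (λ J c m g → J :* c :* m :* g := J :* (c :* m :* g)) refl J₁ (c (suc j)) (M (suc j)) G ⟩
      J₁ * (c (suc j) * M (suc j) * G) ∎)
      where
      open ≡-Reasoning
      J₁ = 1ℤ + + j ; N₀ = N U₀ k ; D = u - + j - K
      j<u : + suc j ≤ u
      j<u = by-difference (trans (solve 3 (λ u j K → u := con 1ℤ :+ j :+ ((u :- j :- con (+ 2) :* K :- con 1ℤ) :+ con (+ 2) :* K)) refl u (+ j) K)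
        (cong (λ w → w + ((u - + j - + 2 * K - 1ℤ) + + 2 * K)) (sym (pos-+ 1 j)))) (2k+j<u j<k ⊕ pos 2 ⊗ pos k)

    Y : ℕ → ℤ
    Y j = r * r * (G * G) + + 2 * + j * K * G * N U₀ k

    -- Iteration of `one-step`: since m ≤ 2 D and r ≤ D, each increment K m / D³ is at most 2 K /
    -- r², and j steps add 2 j K / r² times the mean density. `Y j` is this bound with denominators
    -- cleared.
    Q-bound : ∀ j → j ℕ.≤ k → Q j * (N U₀ k * N U₀ k) * (r * r) ≤ c j * (M j * M j) * Y j
    Q-bound zero _ = ≤-reflexive (trans (cong (λ q → q * (N U₀ k * N U₀ k) * (r * r)) (∑-diff-zero U₀ (λ U → W U * W U)))
      (trans (solve 4 (λ g m r K → g :* g :* (m :* m) :* (r :* r) := con 1ℤ :* (m :* m) :* (r :* r :* (g :* g) :+ con (+ 2) :* con 0ℤ :* K :* g :* m)) refl G (N U₀ k) r K)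
        (cong₂ (λ a b → a * (b * b) * Y 0) (sym (N-zero U₀)) (sym M-zero))))
    Q-bound (suc j) j<k = *-cancelˡ-≤ (*-pos (*-pos D>0 m>0) (0<1+ j)) (by-difference
      (begin
        D * m * J₁ * (c′ * (M′ * M′) * Y (suc j))
          ≡⟨ solve 6 (λ D m J c M Y → D :* m :* J :* (c :* (M :* M) :* Y) := D :* (J :* c) :* m :* (M :* M) :* Y) refl D m J₁ c′ M′ (Y (suc j)) ⟩
        D * (J₁ * c′) * m * (M′ * M′) * Y (suc j)
          ≡⟨ cong₂ (λ a b → D * a * m * (M′ * M′) * (r * r * (G * G) + + 2 * b * K * G * N₀)) (N-step U₀ j) (pos-+ 1 j) ⟩
        D * (m * c j) * m * (M′ * M′) * (r * r * (G * G) + + 2 * (1ℤ + + j) * K * G * N₀)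
          ≡⟨ solve 5 (λ D m c M Y → D :* (m :* c) :* m :* (M :* M) :* Y := D :* c :* ((m :* M) :* (m :* M)) :* Y) refl D m (c j) M′ _ ⟩
        D * c j * ((m * M′) * (m * M′)) * (r * r * (G * G) + + 2 * (1ℤ + + j) * K * G * N₀)
          ≡⟨ cong (λ w → D * c j * (w * w) * (r * r * (G * G) + + 2 * (1ℤ + + j) * K * G * N₀)) (M-step j j<u) ⟩
        D * c j * ((D * M j) * (D * M j)) * (r * r * (G * G) + + 2 * (1ℤ + + j) * K * G * N₀)
          ≡⟨ solve 13 (λ D m J c M r G K N₀ Q Q′ S j → D :* c :* ((D :* M) :* (D :* M)) :* (r :* r :* (G :* G) :+ con (+ 2) :* (con 1ℤ :+ j) :* K :* G :* N₀)
               := D :* m :* J :* (Q′ :* (N₀ :* N₀) :* (r :* r))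
               :+ (N₀ :* N₀ :* (r :* r) :* (D :* D :* D :* Q :+ M :* K :* m :* S :- D :* m :* (J :* Q′))
                :+ D :* D :* D :* (c :* (M :* M) :* (r :* r :* (G :* G) :+ con (+ 2) :* j :* K :* G :* N₀) :- Q :* (N₀ :* N₀) :* (r :* r))
                :+ M :* K :* m :* N₀ :* (r :* r) :* (c :* M :* G :- S :* N₀)
                :+ c :* (M :* M) :* K :* G :* N₀ :* ((con (+ 2) :* D :- m) :* (D :* D) :+ m :* ((D :- r) :* (D :+ r))))) refl
               D m J₁ (c j) (M j) r G K N₀ (Q j) (Q (suc j)) (S j) (+ j) ⟩
        D * m * J₁ * (Q (suc j) * (N₀ * N₀) * (r * r)) + rest ∎)
      (N₀≥0 ⊗ N₀≥0 ⊗ (r≥0 ⊗ r≥0) ⊗ difference summed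
        ⊕ D≥0 ⊗ D≥0 ⊗ D≥0 ⊗ difference (Q-bound j (ℕₚ.<⇒≤ j<k))
        ⊕ pos _ ⊗ pos k ⊗ m≥0 ⊗ N₀≥0 ⊗ (r≥0 ⊗ r≥0) ⊗ difference (≤-reflexive (S-formula j (ℕₚ.<⇒≤ j<k)))
        ⊕ N-nonneg U₀ j ⊗ (pos _ ⊗ pos _) ⊗ pos k ⊗ W-nonneg U₀ ⊗ N₀≥0 ⊗ (2D-m≥0 ⊗ (D≥0 ⊗ D≥0) ⊕ m≥0 ⊗ (D-r≥0 ⊗ (D≥0 ⊕ r≥0)))))
      where
      open ≡-Reasoning
      J₁ = 1ℤ + + j ; N₀ = N U₀ k ; m = u - + j ; D = u - + j - K ; c′ = c (suc j) ; M′ = M (suc j)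
      rest = N₀ * N₀ * (r * r) * (D * D * D * Q j + M j * K * m * S j - D * m * (J₁ * Q (suc j)))
         + D * D * D * (c j * (M j * M j) * Y j - Q j * (N₀ * N₀) * (r * r))
         + M j * K * m * N₀ * (r * r) * (c j * M j * G - S j * N₀)
         + c j * (M j * M j) * K * G * N₀ * ((+ 2 * D - m) * (D * D) + m * ((D - r) * (D + r)))
      N₀≥0 = N-nonneg U₀ k
      gap = 2k+j<u j<k
      2D-m≥0 : 0ℤ ≤ + 2 * D - m
      2D-m≥0 = subst (0ℤ ≤_) (solve 3 (λ u j K → u :- j :- con (+ 2) :* K :- con 1ℤ :+ con 1ℤ := con (+ 2) :* (u :- j :- K) :- (u :- j)) refl u (+ j) K) (gap ⊕ pos 1)
      D>0 : 0ℤ < D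
      D>0 = +1≤⇒< (by-difference (solve 3 (λ u j K → u :- j :- K := con 0ℤ :+ con 1ℤ :+ ((u :- j :- con (+ 2) :* K :- con 1ℤ) :+ K)) refl u (+ j) K) (gap ⊕ pos k))
      m>0 : 0ℤ < m
      m>0 = +1≤⇒< (by-difference (solve 3 (λ u j K → u :- j := con 0ℤ :+ con 1ℤ :+ ((u :- j :- con (+ 2) :* K :- con 1ℤ) :+ con (+ 2) :* K)) refl u (+ j) K) (gap ⊕ pos 2 ⊗ pos k))
      D≥0 = ℤₚ.<⇒≤ D>0
      m≥0 = ℤₚ.<⇒≤ m>0
      D-r≥0 : 0ℤ ≤ D - r
      D-r≥0 = subst (0ℤ ≤_) (solve 4 (λ u j K r → (u :- (r :+ con (+ 2) :* K)) :+ (K :- j) := u :- j :- K :- r) refl u (+ j) K r)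
        (difference r-small ⊕ difference (+≤+ (ℕₚ.<⇒≤ j<k)))
      j<u : + suc j ≤ u
      j<u = by-difference (trans (solve 3 (λ u j K → u := con 1ℤ :+ j :+ ((u :- j :- con (+ 2) :* K :- con 1ℤ) :+ con (+ 2) :* K)) refl u (+ j) K)
        (cong (λ w → w + ((u - + j - + 2 * K - 1ℤ) + + 2 * K)) (sym (pos-+ 1 j)))) (gap ⊕ pos 2 ⊗ pos k)
      at : ∀ A → IsSub U₀ j A → D * m * wt (diff U₀ A) (sq (deleted (diff U₀ A))) ≤ D * D * D * (W (diff U₀ A) * W (diff U₀ A)) + M j * K * m * W (diff U₀ A)
      at A s = subst₂ (λ s m′ → (s - K) * s * wt (diff U₀ A) (sq (deleted (diff U₀ A))) ≤ (s - K) * (s - K) * (s - K) * (W (diff U₀ A) * W (diff U₀ A)) + m′ * K * s * W (diff U₀ A))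
        (size-diff U₀ A j s) (N-diff A j s)
        (OneStep.one-step (diff U₀ A) (subst (K <_) (sym (size-diff U₀ A j s)) (+1≤⇒< (by-difference
          (solve 3 (λ u j K → u :- j := K :+ con 1ℤ :+ ((u :- j :- con (+ 2) :* K :- con 1ℤ) :+ K)) refl u (+ j) K) (gap ⊕ pos k)))))
      summed : D * m * (J₁ * Q (suc j)) ≤ D * D * D * Q j + M j * K * m * S j
      summed = subst₂ _≤_
        (trans (∑-* (subs U₀ j) (D * m) _) (cong (λ w → D * m * w) (sym (∑-diff-exchange j (λ U → W U * W U)))))
        (trans (∑-+ (subs U₀ j) _ _) (cong₂ _+_ (∑-* (subs U₀ j) (D * D * D) _) (∑-* (subs U₀ j) (M j * K * m) _)))
        (∑ˢ-mono U₀ j at)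

  -- The bound for integer weights

  nonneg-idempotent : ∀ t → nonneg t * nonneg t ≡ nonneg t
  nonneg-idempotent t with nonneg-cases t
  ... | inj₁ (_ , eq) = subst (λ w → w * w ≡ w) (sym eq) (*-identityˡ 1ℤ)
  ... | inj₂ (_ , eq) = subst (λ w → w * w ≡ w) (sym eq) (zeroˡ 0ℤ)

  C-positive : ∀ {m k} → k ℕ.≤ m → 0ℤ < + (m C k)
  C-positive {m} {k} k≤m = subst (0ℤ <_) (trans (N-C (⊤ {m}) k) (cong (λ l → + (l C k)) (∣⊤∣≡n m)))
    (N-positive (⊤ {m}) k (subst (+ k ≤_) (sym (trans (size-∣∣ (⊤ {m})) (cong +_ (∣⊤∣≡n m)))) (+≤+ k≤m)))

  -- The constant is twice that of `weak-bound`, which is applied to what remains of `U` after `a`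
  -- and k further elements have been removed.
  module DominantCase (U : Subset n) (x : Fin n → ℤ) (k : ℕ) (wt≥0 : 0ℤ ≤ wt U x) (a : Fin n) (a∈U : lookup U a ≡ true)
    (U-large : + 2000000000 * + suc k ≤ size U)
    (few : + 4 * (N (del U a) k - ∑ (subs (del U a) k) (λ Z → nonneg (x a + wt Z x))) ≤ N (del U a) k) where

    private
      good : Subset n → ℤ
      good Z = nonneg (wt Z x)
      U₀ = del U a ; K = + suc k ; κ = + k ; u = size U₀ ; m = size U₀ - + k ; r = size U₀ - + 2 * + suc k
      K-1≥0 : 0ℤ ≤ K - 1ℤ
      K-1≥0 = difference (+≤+ (s≤s z≤n))
      κ≡ : κ ≡ K - 1ℤ
      κ≡ = trans (solve 1 (λ k → k := con 1ℤ :+ k :- con 1ℤ) refl κ) (cong (λ w → w - 1ℤ) (sym (pos-+ 1 k)))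
      u-large : 0ℤ ≤ u - + 1999999999 * K
      u-large = subst (0ℤ ≤_) (trans (solve 2 (λ u K → u :- con (+ 2000000000) :* K :+ (K :- con 1ℤ) := u :- con 1ℤ :- con (+ 1999999999) :* K) refl (size U) K)
        (cong (λ w → w - + 1999999999 * K) (sym (size-del U a a∈U)))) (difference U-large ⊕ K-1≥0)
      r≥0 : 0ℤ ≤ r
      r≥0 = subst (0ℤ ≤_) (solve 2 (λ u K → u :- con (+ 1999999999) :* K :+ con (+ 1999999997) :* K := u :- con (+ 2) :* K) refl u K) (u-large ⊕ pos 1999999997 ⊗ pos (suc k))

      module Conc = Concentration (suc k) (+<+ (s≤s z≤n)) good (λ _ → nonneg-nonneg _) (λ _ → nonneg-idempotent _) U₀ r r≥0
        (≤-reflexive (solve 2 (λ u K → u :- con (+ 2) :* K :+ con (+ 2) :* K := u) refl u K))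
        (by-difference (solve 2 (λ u K → u := con (+ 10) :* K :+ (u :- con (+ 1999999999) :* K :+ con (+ 1999999989) :* K)) refl u K) (u-large ⊕ pos 1999999989 ⊗ pos (suc k)))
      W : Subset n → ℤ
      W V = ∑ (subs V (suc k)) good
      G₁ = ∑ (subs U₀ k) (λ Z → nonneg (x a + wt Z x))
      G₂ = W U₀
      c = N U₀ k ; N₀ = N U₀ (suc k) ; M = Conc.M k ; F = c - G₁ ; S = Conc.S k ; Q = Conc.Q k

      m>0 : 0ℤ < m
      m>0 = +1≤⇒< (by-difference (trans (cong (λ w → u - w) κ≡)
          (solve 2 (λ u K → u :- (K :- con 1ℤ) := con 0ℤ :+ con 1ℤ :+ (u :- con (+ 1999999999) :* K :+ con (+ 1999999998) :* K)) refl u K))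
        (u-large ⊕ pos 1999999998 ⊗ pos (suc k)))
      c>0 : 0ℤ < c
      c>0 = N-positive U₀ k (by-difference (solve 2 (λ u k → u := k :+ (u :- k)) refl u κ) (ℤₚ.<⇒≤ m>0))
      M>0 : 0ℤ < M
      M>0 = C-positive (ℕₚ.m+n≤o⇒m≤o∸n (suc k) (ℤₚ.drop‿+≤+ (subst (+ (suc k ℕ.+ k) ≤_) (size-∣∣ U₀) (by-difference
        (trans (solve 3 (λ u K κ → u := K :+ κ :+ (u :- con (+ 1999999999) :* K :+ con (+ 1999999997) :* K :+ (K :- κ))) refl u K κ)
          (cong (λ w → w + (u - + 1999999999 * K + + 1999999997 * K + (K - κ))) (sym (pos-+ (suc k) k))))
        (u-large ⊕ pos 1999999997 ⊗ pos (suc k) ⊕ difference (+≤+ (ℕₚ.n≤1+n k)))))))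

      KN₀≡mc : K * N₀ ≡ m * c
      KN₀≡mc = trans (cong (λ w → w * N₀) (pos-+ 1 k)) (N-step U₀ k)

      wt-rest : ∀ A → IsSub U₀ k A → wt (diff U₀ A) x ≡ wt U x - (x a + wt A x)
      wt-rest A (p , _) = trans (wt-diff U₀ A x p) (trans (cong (λ w → w - wt A x) (trans (wt-del U a x) (cong (λ i → wt U x - i * x a) (cong ind a∈U))))
        (solve 3 (λ w y s → w :- con 1ℤ :* y :- s := w :- (y :+ s)) refl (wt U x) (x a) (wt A x)))

      -- A failing set A ∪ {a} leaves a complement of nonnegative weight, to which the weak bound applies.
      rest-rich : ∀ A → IsSub U₀ k A → x a + wt A x < 0ℤ → + 3 * (c * M) ≤ + 4 * (N₀ * W (diff U₀ A))
      rest-rich A s h = *-cancelˡ-≤ m>0 (by-difference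
        (trans (solve 5 (λ m M N₀ w K → m :* (con (+ 4) :* (N₀ :* w)) := con (+ 3) :* (K :* N₀) :* M :+ N₀ :* (con (+ 4) :* (m :* w) :- con (+ 3) :* (K :* M))) refl m M N₀ w K)
          (trans (cong (λ v → + 3 * v * M + N₀ * (+ 4 * (m * w) - + 3 * (K * M))) KN₀≡mc)
            (cong (λ v → v + N₀ * (+ 4 * (m * w) - + 3 * (K * M))) (solve 3 (λ m c M → con (+ 3) :* (m :* c) :* M := m :* (con (+ 3) :* (c :* M))) refl m c M))))
        (N-nonneg U₀ (suc k) ⊗ difference (subst₂ (λ v t → + 3 * (K * v) ≤ + 4 * (t * w)) (Conc.N-diff A k s) (size-diff U₀ A k s)
          (weak-bound (diff U₀ A) x k
            (subst (+ 1000000000 * K ≤_) (sym (size-diff U₀ A k s)) (by-difference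
              (solve 3 (λ u K κ → u :- κ := con (+ 1000000000) :* K :+ (u :- con (+ 1999999999) :* K :+ con (+ 999999998) :* K :+ (K :- κ))) refl u K κ)
              (u-large ⊕ pos 999999998 ⊗ pos (suc k) ⊕ difference (+≤+ (ℕₚ.n≤1+n k)))))
            (subst (0ℤ ≤_) (sym (wt-rest A s)) (wt≥0 ⊕ nonpos⇒neg-nonneg (ℤₚ.<⇒≤ h)))))))
        where w = W (diff U₀ A)

    module _ (G₂<F : G₂ < F) where
      private
        -- For a failing set, 4 N₀ W ≥ 3 c M by `rest-rich`, while 4 G₂ < 4 F ≤ c. Hence N₀ W
        -- exceeds its mean M G₂ by at least c M / 2, and squaring this half gives the factor 4.
        deviation : ∀ A → IsSub U₀ k A → c * M * (c * M) * (1ℤ - nonneg (x a + wt A x)) ≤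
          + 4 * ((N₀ * W (diff U₀ A) - M * G₂) * (N₀ * W (diff U₀ A) - M * G₂))
        deviation A s = cases (nonneg-cases (x a + wt A x))
          where
          w = W (diff U₀ A)
          dev = + 4 * ((N₀ * w - M * G₂) * (N₀ * w - M * G₂))
          cases : _ → c * M * (c * M) * (1ℤ - nonneg (x a + wt A x)) ≤ dev
          cases (inj₁ (_ , eq)) = subst (λ v → c * M * (c * M) * (1ℤ - v) ≤ dev) (sym eq)
            (subst (λ v → v ≤ dev) (solve 1 (λ t → con 0ℤ := t :* (con 1ℤ :- con 1ℤ)) refl (c * M * (c * M))) (pos 4 ⊗ square-nonneg (N₀ * w - M * G₂)))
          cases (inj₂ (h , eq)) = subst (λ v → c * M * (c * M) * (1ℤ - v) ≤ dev) (sym eq)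
            (subst₂ _≤_ (solve 1 (λ t → t :* t := t :* t :* (con 1ℤ :- con 0ℤ)) refl (c * M)) (solve 1 (λ t → con (+ 2) :* t :* (con (+ 2) :* t) := con (+ 4) :* (t :* t)) refl (N₀ * w - M * G₂))
              (square-mono (ℤₚ.<⇒≤ (*-pos c>0 M>0)) (*-cancelˡ-≤ {+ 2} (+<+ (s≤s z≤n)) (by-difference
                (solve 6 (λ N₀ w M G c F → con (+ 2) :* (con (+ 2) :* (N₀ :* w :- M :* G)) := con (+ 2) :* (c :* M)
                   :+ ((con (+ 4) :* (N₀ :* w) :- con (+ 3) :* (c :* M)) :+ con (+ 4) :* M :* (F :- G :- con 1ℤ) :+ con (+ 4) :* M :+ M :* (c :- con (+ 4) :* F))) refl N₀ w M G₂ c F)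
                (difference (rest-rich A s h) ⊕ pos 4 ⊗ pos _ ⊗ difference< G₂<F ⊕ pos 4 ⊗ pos _ ⊕ pos _ ⊗ difference few)))))

        deviation-sum : c * M * (c * M) * F ≤ + 4 * (N₀ * N₀ * Q - + 2 * (M * G₂) * (S * N₀) + M * G₂ * (M * G₂) * c)
        deviation-sum = subst₂ _≤_
          (trans (∑-* (subs U₀ k) (c * M * (c * M)) _) (cong (λ v → c * M * (c * M) * v) (∑-complement U₀ k (λ A → nonneg (x a + wt A x)))))
          (trans (∑-* (subs U₀ k) (+ 4) _) (cong (λ v → + 4 * v) (trans
            (∑-cong (subs U₀ k) (λ A → solve 3 (λ N₀ w g → (N₀ :* w :- g) :* (N₀ :* w :- g) := N₀ :* N₀ :* (w :* w) :- con (+ 2) :* g :* N₀ :* w :+ g :* g) refl N₀ (W (diff U₀ A)) (M * G₂)))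
            (trans (∑-+ (subs U₀ k) _ _) (cong₂ _+_
              (trans (∑-minus (subs U₀ k) _ _) (cong₂ _-_ (∑-* (subs U₀ k) (N₀ * N₀) _)
                (trans (∑-* (subs U₀ k) (+ 2 * (M * G₂) * N₀) _) (solve 3 (λ g N₀ s → con (+ 2) :* g :* N₀ :* s := con (+ 2) :* g :* (s :* N₀)) refl (M * G₂) N₀ S))))
              (∑-const (subs U₀ k) (M * G₂ * (M * G₂))))))))
          (∑ˢ-mono U₀ k deviation)

        k≤1+k : k ℕ.≤ suc k
        k≤1+k = ℕₚ.n≤1+n k

        -- By `S-formula` the squared mean cancels from `deviation-sum`, so only the variance term
        -- of `Q-bound` is left. It carries a factor G₂, and `KN₀≡mc` rewrites its K N₀ as m c.
        few-failures-compared : r * r * F ≤ + 8 * κ * m * G₂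
        few-failures-compared = *-cancelˡ-≤ (*-pos (*-pos c>0 M>0) (*-pos c>0 M>0)) (by-difference
          (trans (solve 5 (λ c M κ m G → c :* M :* (c :* M) :* (con (+ 8) :* κ :* m :* G) := con (+ 8) :* κ :* (c :* M) :* M :* G :* (m :* c)) refl c M κ m G₂)
          (trans (cong (λ v → + 8 * κ * (c * M) * M * G₂ * v) (sym KN₀≡mc))
          (trans (solve 9 (λ c M κ G K N₀ r F Q → con (+ 8) :* κ :* (c :* M) :* M :* G :* (K :* N₀) := c :* M :* (c :* M) :* (r :* r :* F)
              :+ (r :* r :* (con (+ 4) :* (N₀ :* N₀ :* Q :- con (+ 2) :* (M :* G) :* (c :* M :* G) :+ M :* G :* (M :* G) :* c) :- c :* M :* (c :* M) :* F)
               :+ con (+ 4) :* (c :* (M :* M) :* (r :* r :* (G :* G) :+ con (+ 2) :* κ :* K :* G :* N₀) :- Q :* (N₀ :* N₀) :* (r :* r)))) refl c M κ G₂ K N₀ r F Q)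
            (cong (λ v → c * M * (c * M) * (r * r * F)
               + (r * r * (+ 4 * (N₀ * N₀ * Q - + 2 * (M * G₂) * v + M * G₂ * (M * G₂) * c) - c * M * (c * M) * F)
                 + + 4 * (c * (M * M) * Conc.Y k - Q * (N₀ * N₀) * (r * r)))) (sym (Conc.S-formula k k≤1+k))))))
          (r≥0 ⊗ r≥0 ⊗ difference deviation-sum ⊕ pos 4 ⊗ difference (Conc.Q-bound k k≤1+k)))

      absurd : ⊥
      absurd = suc≰0 {0} (by-difference
        (trans (solve 4 (λ u K F G → con 0ℤ := con 1ℤ
            :+ ((con (+ 8) :* (K :- con 1ℤ) :* (u :- (K :- con 1ℤ)) :* G :- (u :- con (+ 2) :* K) :* (u :- con (+ 2) :* K) :* F)
             :+ con (+ 8) :* (K :- con 1ℤ) :* (u :- con (+ 100) :* K :+ con (+ 99) :* K :+ con 1ℤ) :* (F :- G)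
             :+ (con 1ℤ :+ ((u :- con (+ 100) :* K) :* (u :- con (+ 100) :* K) :+ con (+ 188) :* K :* (u :- con (+ 100) :* K) :+ con (+ 8) :* (u :- con (+ 100) :* K) :+ con (+ 8812) :* (K :* K) :+ con (+ 784) :* K :+ con (+ 7))) :* (F :- con 1ℤ)
             :+ ((u :- con (+ 100) :* K) :* (u :- con (+ 100) :* K) :+ con (+ 188) :* K :* (u :- con (+ 100) :* K) :+ con (+ 8) :* (u :- con (+ 100) :* K) :+ con (+ 8812) :* (K :* K) :+ con (+ 784) :* K :+ con (+ 7)))) refl u K F G₂)
          (cong (λ v → 1ℤ + ((+ 8 * v * (u - v) * G₂ - r * r * F) + + 8 * (K - 1ℤ) * (t + + 99 * K + 1ℤ) * (F - G₂) + (1ℤ + R) * (F - 1ℤ) + R)) (sym κ≡)))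
        (difference few-failures-compared ⊕ pos 8 ⊗ K-1≥0 ⊗ (t≥0 ⊕ pos 99 ⊗ pos (suc k) ⊕ pos 1) ⊗ difference (ℤₚ.<⇒≤ G₂<F)
          ⊕ (pos 1 ⊕ R≥0) ⊗ difference F≥1 ⊕ R≥0))
        where
        t = u - + 100 * K
        t≥0 : 0ℤ ≤ t
        t≥0 = subst (0ℤ ≤_) (solve 2 (λ u K → u :- con (+ 1999999999) :* K :+ con (+ 1999999899) :* K := u :- con (+ 100) :* K) refl u K) (u-large ⊕ pos 1999999899 ⊗ pos (suc k))
        -- `1 + R` is `r * r - + 8 * κ * m` expressed in `t` and `K`, where every coefficient is
        -- positive. Together with G₂ < F this contradicts `few-failures-compared`.
        R = t * t + + 188 * K * t + + 8 * t + + 8812 * (K * K) + + 784 * K + + 7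
        R≥0 : 0ℤ ≤ R
        R≥0 = t≥0 ⊗ t≥0 ⊕ pos 188 ⊗ pos (suc k) ⊗ t≥0 ⊕ pos 8 ⊗ t≥0 ⊕ pos 8812 ⊗ (pos (suc k) ⊗ pos (suc k)) ⊕ pos 784 ⊗ pos (suc k) ⊕ pos 7
        F≥1 : 1ℤ ≤ F
        F≥1 = ≤-trans (by-difference (solve 1 (λ g → g :+ con 1ℤ := con 1ℤ :+ g) refl G₂) (∑-nonneg (subs U₀ (suc k)) (λ _ → nonneg-nonneg _))) (<⇒+1≤ G₂<F)

    dominant-bound : N U₀ k ≤ ∑ (subs U (suc k)) good
    dominant-bound = subst (c ≤_) (sym (good-split U x a k a∈U)) (ℤₚ.≮⇒≥ λ h → absurd (+1≤⇒< (by-difference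
      (solve 3 (λ c g h → c :- g := h :+ con 1ℤ :+ (c :- (g :+ h) :- con 1ℤ)) refl c G₁ G₂) (difference< h))))

  -- In the spread case absorption writes K N as u times the required binomial coefficient, and u
  -- cancels.
  integer-bound : ∀ (U : Subset n) x k a → lookup U a ≡ true → + 2000000000 * + suc k ≤ size U → 0ℤ ≤ wt U x →
    + ((∣ U ∣ ℕ.∸ 1) C k) ≤ ∑ (subs U (suc k)) (λ Z → nonneg (wt Z x))
  integer-bound {n} U x k a a∈U U-large wt≥0 = [ if-spread , if-dominant ]′ (spread-or-dominant U x k U-large′ wt≥0)
    where
    u = size U
    U-large′ : + 1000000000 * + suc k ≤ u
    U-large′ = by-difference (solve 2 (λ u K → u := con (+ 1000000000) :* K :+ (u :- con (+ 2000000000) :* K :+ con (+ 1000000000) :* K)) refl u (+ suc k))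
      (difference U-large ⊕ pos 1000000000 ⊗ pos (suc k))
    count : ∀ b → lookup U b ≡ true → N (del U b) k ≡ + ((∣ U ∣ ℕ.∸ 1) C k)
    count b b∈U = trans (N-C (del U b) k) (cong (λ l → + (l C k)) (sym (cong (ℕ._∸ 1) (ℤₚ.+-injective (trans (sym (size-∣∣ U)) (trans
      (solve 1 (λ u → u := con 1ℤ :+ (u :- con 1ℤ)) refl u) (trans (cong (λ w → 1ℤ + w) (trans (sym (size-del U b b∈U)) (size-∣∣ (del U b)))) (sym (pos-+ 1 _)))))))))
    G = ∑ (subs U (suc k)) (λ Z → nonneg (wt Z x))
    if-spread : + suc k * N U (suc k) ≤ u * G → + ((∣ U ∣ ℕ.∸ 1) C k) ≤ G
    if-spread h = subst (λ w → w ≤ G) (count a a∈U) (*-cancelˡ-≤ (size-positive U k U-large′)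
      (subst (λ w → w ≤ u * G) (trans (cong (λ w → w * N U (suc k)) (pos-+ 1 k)) (N-absorption U a k a∈U)) h))
    if-dominant : Σ (Fin n) (Dominant U x k) → + ((∣ U ∣ ℕ.∸ 1) C k) ≤ G
    if-dominant (b , b∈U , few) = subst (λ w → w ≤ G) (count b b∈U) (DominantCase.dominant-bound U x k wt≥0 b b∈U U-large few)

  -- Gordan's alternative over the integers

  infixl 6 _⊞_
  _⊞_ : Vec ℤ n → Vec ℤ n → Vec ℤ n
  _⊞_ = zipWith _+_

  -- Note the shift: m ⊡ r is (m + 1) r.
  infixl 7 _⊡_
  _⊡_ : ℕ → Vec ℤ n → Vec ℤ n
  m ⊡ r = V.map (λ i → + suc m * i) r

  dot : Vec ℤ n → Vec ℤ n → ℤ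
  dot []      []      = 0ℤ
  dot (i ∷ r) (j ∷ y) = i * j + dot r y

  dot-⊞ : ∀ (r s y : Vec ℤ n) → dot (r ⊞ s) y ≡ dot r y + dot s y
  dot-⊞ []      []      []      = sym (+-identityˡ 0ℤ)
  dot-⊞ (i ∷ r) (j ∷ s) (k ∷ y) = trans (cong (λ w → (i + j) * k + w) (dot-⊞ r s y))
    (solve 5 (λ i j k a b → (i :+ j) :* k :+ (a :+ b) := i :* k :+ a :+ (j :* k :+ b)) refl i j k (dot r y) (dot s y))

  dot-⊡ : ∀ m (r y : Vec ℤ n) → dot (m ⊡ r) y ≡ + suc m * dot r y
  dot-⊡ m []      []      = sym (zeroʳ (+ suc m))
  dot-⊡ m (i ∷ r) (j ∷ y) = trans (cong (λ w → + suc m * i * j + w) (dot-⊡ m r y))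
    (solve 4 (λ m i j a → m :* i :* j :+ m :* a := m :* (i :* j :+ a)) refl (+ suc m) i j (dot r y))

  dot-scale : ∀ (c : ℤ) (r y : Vec ℤ n) → dot r (V.map (c *_) y) ≡ c * dot r y
  dot-scale c []      []      = sym (zeroʳ c)
  dot-scale c (i ∷ r) (j ∷ y) = trans (cong (λ w → i * (c * j) + w) (dot-scale c r y))
    (solve 4 (λ c i j a → i :* (c :* j) :+ c :* a := c :* (i :* j :+ a)) refl c i j (dot r y))

  -- There is no constructor for the empty combination and `mul` scales by a positive factor, so a
  -- derivation of the zero vector is a nontrivial relation.
  data Cone (R : List (Vec ℤ n)) : Vec ℤ n → Set where
    gen : ∀ {r} → r ∈ R → Cone R r
    add : ∀ {r s} → Cone R r → Cone R s → Cone R (r ⊞ s)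
    mul : ∀ m {r} → Cone R r → Cone R (m ⊡ r)

  -- (m , t) stands for a row with first coordinate ±(m + 1) and remaining coordinates t.
  Row : ℕ → Set
  Row n = ℕ × Vec ℤ n

  zeros : List (Vec ℤ (suc n)) → List (Vec ℤ n)
  zeros []                 = []
  zeros ((+ zero ∷ t) ∷ R) = t ∷ zeros R
  zeros ((_ ∷ t) ∷ R)      = zeros R

  positives negatives : List (Vec ℤ (suc n)) → List (Row n)
  positives []                     = []
  positives ((+ suc m ∷ t) ∷ R)    = (m , t) ∷ positives R
  positives ((_ ∷ t) ∷ R)          = positives R
  negatives []                     = []
  negatives ((-[1+ m ] ∷ t) ∷ R)   = (m , t) ∷ negatives R
  negatives ((_ ∷ t) ∷ R)          = negatives R

  zeros-∈ : ∀ (R : List (Vec ℤ (suc n))) {t} → t ∈ zeros R → (0ℤ ∷ t) ∈ R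
  zeros-∈ ((+ zero ∷ t) ∷ R)    (here refl) = here refl
  zeros-∈ ((+ zero ∷ t) ∷ R)    (there p)   = there (zeros-∈ R p)
  zeros-∈ ((+ suc m ∷ t) ∷ R)   p           = there (zeros-∈ R p)
  zeros-∈ ((-[1+ m ] ∷ t) ∷ R)  p           = there (zeros-∈ R p)

  positives-∈ : ∀ (R : List (Vec ℤ (suc n))) {m t} → (m , t) ∈ positives R → (+ suc m ∷ t) ∈ R
  positives-∈ ((+ zero ∷ t) ∷ R)    p           = there (positives-∈ R p)
  positives-∈ ((+ suc m ∷ t) ∷ R)   (here refl) = here refl
  positives-∈ ((+ suc m ∷ t) ∷ R)   (there p)   = there (positives-∈ R p)
  positives-∈ ((-[1+ m ] ∷ t) ∷ R)  p           = there (positives-∈ R p)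

  negatives-∈ : ∀ (R : List (Vec ℤ (suc n))) {m t} → (m , t) ∈ negatives R → (-[1+ m ] ∷ t) ∈ R
  negatives-∈ ((+ zero ∷ t) ∷ R)    p           = there (negatives-∈ R p)
  negatives-∈ ((+ suc m ∷ t) ∷ R)   p           = there (negatives-∈ R p)
  negatives-∈ ((-[1+ m ] ∷ t) ∷ R)  (here refl) = here refl
  negatives-∈ ((-[1+ m ] ∷ t) ∷ R)  (there p)   = there (negatives-∈ R p)

  -- One Fourier–Motzkin step: each pair of rows with opposite signs in the
  -- first coordinate is combined so that this coordinate cancels.
  combine : Row n → Row n → Vec ℤ n
  combine (m , t) (l , s) = l ⊡ t ⊞ m ⊡ s

  eliminate : List (Vec ℤ (suc n)) → List (Vec ℤ n)
  eliminate R = zeros R ++ cartesianProductWith combine (positives R) (negatives R)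

  eliminate-cone : ∀ (R : List (Vec ℤ (suc n))) {t} → t ∈ eliminate R → Cone R (0ℤ ∷ t)
  eliminate-cone R t∈ with ∈-++⁻ (zeros R) t∈
  ... | inj₁ p = gen (zeros-∈ R p)
  ... | inj₂ p with ∈-cartesianProductWith⁻ combine (positives R) (negatives R) p
  ...   | (m , t) , (l , s) , p₁ , p₂ , refl = subst (Cone R) (cong (_∷ (l ⊡ t ⊞ m ⊡ s)) cancel)
            (add (mul l (gen (positives-∈ R p₁))) (mul m (gen (negatives-∈ R p₂))))
    where
    cancel : + suc l * + suc m + + suc m * -[1+ l ] ≡ 0ℤ
    cancel = trans (cong (λ w → + suc l * + suc m + + suc m * w) (neg-ℤ (+ suc l)))
      (solve 2 (λ l m → l :* m :+ m :* (:- l) := con 0ℤ) refl (+ suc l) (+ suc m))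

  lift-cone : ∀ (R : List (Vec ℤ (suc n))) {t} → Cone (eliminate R) t → Cone R (0ℤ ∷ t)
  lift-cone R (gen p)                 = eliminate-cone R p
  lift-cone R (add {r} {s} p q)       = subst (λ c → Cone R (c ∷ (r ⊞ s))) (+-identityˡ 0ℤ) (add (lift-cone R p) (lift-cone R q))
  lift-cone R (mul m {r} p)           = subst (λ c → Cone R (c ∷ (m ⊡ r))) (zeroʳ (+ suc m)) (mul m (lift-cone R p))

  module Extremal-ratio (value : Row n → ℤ) where
    den : Row n → ℤ
    den ρ = + suc (proj₁ ρ)

    den>0 : ∀ ρ → 0ℤ < den ρ
    den>0 ρ = +<+ (s≤s z≤n)

    infix 4 _≼_
    -- The order of the ratios value / den, cross-multiplied.
    _≼_ : Row n → Row n → Set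
    ρ ≼ σ = den σ * value ρ ≤ den ρ * value σ

    minimal : ∀ ρ L → Σ (Row n) λ μ → μ ∈ (ρ ∷ L) × All (μ ≼_) (ρ ∷ L)
    minimal ρ []      = ρ , here refl , ≤-refl ∷ []
    minimal ρ (σ ∷ L) with minimal σ L
    ... | μ , μ∈ , μ≼ with (den ρ * value μ) ≤? (den μ * value ρ)
    ...   | yes μ≼ρ = μ , there μ∈ , μ≼ρ ∷ μ≼
    ...   | no  μ⋠ρ = ρ , here refl , ≤-refl ∷ All.map (λ {τ} → through {τ}) μ≼
      where
      through : ∀ {τ} → μ ≼ τ → ρ ≼ τ
      through {τ} μ≼τ = *-cancelˡ-≤ (den>0 μ) (by-difference
        (solve 6 (λ a b c α β γ → b :* (a :* γ) := b :* (c :* α) :+ (a :* (b :* γ :- c :* β) :+ c :* (a :* β :- b :* α))) refl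
          (den ρ) (den μ) (den τ) (value ρ) (value μ) (value τ))
        (pos _ ⊗ difference μ≼τ ⊕ pos _ ⊗ difference (ℤₚ.<⇒≤ (ℤₚ.≰⇒> μ⋠ρ))))

  module Interval (y : Vec ℤ n) where
    value : Row n → ℤ
    value (_ , t) = dot t y

    open Extremal-ratio value

    -- The new coordinate is the fraction t / s. Rows in `P` bound it below by -value / den, and
    -- rows in `Q` bound it above by value / den.
    Fits : List (Row n) → List (Row n) → Set
    Fits P Q = Σ ℤ λ s → Σ ℤ λ t → 0ℤ < s × All (λ ρ → 0ℤ < den ρ * t + s * value ρ) P × All (λ ρ → 0ℤ < s * value ρ - den ρ * t) Q

    <-by-difference : ∀ {b c d} → b ≡ c + d → 0ℤ < c → 0ℤ ≤ d → 0ℤ < b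
    <-by-difference eq c>0 d≥0 = ℤₚ.<-≤-trans c>0 (by-difference eq d≥0)

    fit : ∀ P Q → (∀ {ρ σ} → ρ ∈ P → σ ∈ Q → 0ℤ < den σ * value ρ + den ρ * value σ) → Fits P Q
    fit [] [] h = 1ℤ , 0ℤ , +<+ (s≤s z≤n) , [] , []
    fit (ρ ∷ P) [] h with minimal ρ P
    ... | μ , _ , μ≼ = den μ , 1ℤ - value μ , den>0 μ , All.map (λ {σ} μ≼σ → <-by-difference
            (solve 4 (λ a b α β → b :* (con 1ℤ :- α) :+ a :* β := b :+ (a :* β :- b :* α)) refl (den μ) (den σ) (value μ) (value σ)) (den>0 σ) (difference μ≼σ)) μ≼ , []
    fit [] (ρ ∷ Q) h with minimal ρ Q
    ... | μ , _ , μ≼ = den μ , value μ - 1ℤ , den>0 μ , [] , All.map (λ {σ} μ≼σ → <-by-difference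
            (solve 4 (λ a b α β → a :* β :- b :* (α :- con 1ℤ) := b :+ (a :* β :- b :* α)) refl (den μ) (den σ) (value μ) (value σ)) (den>0 σ) (difference μ≼σ)) μ≼
    fit (ρ ∷ P) (σ ∷ Q) h with minimal ρ P | minimal σ Q
    -- `μ` gives the tightest lower bound and `ν` the tightest upper one; t / s is their midpoint,
    -- and `h` at this pair says that the interval is nonempty.
    ... | μ , μ∈ , μ≼ | ν , ν∈ , ν≼ = + 2 * den μ * den ν , den μ * value ν - den ν * value μ , *-pos (*-pos (+<+ (s≤s z≤n)) (den>0 μ)) (den>0 ν) ,
        All.map (λ {τ} μ≼τ → <-by-difference
          (solve 6 (λ a b c α β γ → c :* (a :* β :- b :* α) :+ con (+ 2) :* a :* b :* γ := c :* (b :* α :+ a :* β) :+ con (+ 2) :* b :* (a :* γ :- c :* α)) refl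
            (den μ) (den ν) (den τ) (value μ) (value ν) (value τ))
          (*-pos (den>0 τ) (h μ∈ ν∈)) (pos 2 ⊗ pos _ ⊗ difference μ≼τ)) μ≼ ,
        All.map (λ {τ} ν≼τ → <-by-difference
          (solve 6 (λ a b c α β γ → con (+ 2) :* a :* b :* γ :- c :* (a :* β :- b :* α) := c :* (b :* α :+ a :* β) :+ con (+ 2) :* a :* (b :* γ :- c :* β)) refl
            (den μ) (den ν) (den τ) (value μ) (value ν) (value τ))
          (*-pos (den>0 τ) (h μ∈ ν∈)) (pos 2 ⊗ pos _ ⊗ difference ν≼τ)) ν≼

  Positive : List (Vec ℤ n) → Vec ℤ n → Set
  Positive R y = All (λ r → 0ℤ < dot r y) R

  -- The old solution is multiplied by the denominator `s` of the new coordinate, which keeps the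
  -- vector integral and preserves strict positivity.
  extend : ∀ (R : List (Vec ℤ (suc n))) y → Positive (eliminate R) y → Σ (Vec ℤ (suc n)) (Positive R)
  extend R y R′>0 with Interval.fit y (positives R) (negatives R) cross
    where
    cross : ∀ {ρ σ} → ρ ∈ positives R → σ ∈ negatives R → 0ℤ < + suc (proj₁ σ) * dot (proj₂ ρ) y + + suc (proj₁ ρ) * dot (proj₂ σ) y
    cross {m , t} {l , s} p q = subst (0ℤ <_) (trans (dot-⊞ (l ⊡ t) (m ⊡ s) y) (cong₂ _+_ (dot-⊡ l t y) (dot-⊡ m s y)))
      (All.lookup R′>0 (∈-++⁺ʳ (zeros R) (∈-cartesianProductWith⁺ combine p q)))
  ... | s , t , s>0 , P>0 , Q>0 = t ∷ V.map (s *_) y , check R (Allₚ.++⁻ˡ (zeros R) R′>0) P>0 Q>0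
    where
    check : ∀ R → Positive (zeros R) y → All (λ ρ → 0ℤ < + suc (proj₁ ρ) * t + s * dot (proj₂ ρ) y) (positives R) →
      All (λ ρ → 0ℤ < s * dot (proj₂ ρ) y - + suc (proj₁ ρ) * t) (negatives R) → Positive R (t ∷ V.map (s *_) y)
    check []                   zs ps ns = []
    check ((+ zero ∷ r) ∷ R)   (z ∷ zs) ps ns = subst (0ℤ <_)
      (trans (solve 2 (λ t w → w := con 0ℤ :* t :+ w) refl t (s * dot r y)) (cong (λ w → 0ℤ * t + w) (sym (dot-scale s r y)))) (*-pos s>0 z) ∷ check R zs ps ns
    check ((+ suc m ∷ r) ∷ R)  zs (p ∷ ps) ns = subst (0ℤ <_) (cong (λ w → + suc m * t + w) (sym (dot-scale s r y))) p ∷ check R zs ps ns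
    check ((-[1+ m ] ∷ r) ∷ R) zs ps (q ∷ ns) = subst (0ℤ <_)
      (trans (solve 3 (λ a t w → w :- a :* t := (:- a) :* t :+ w) refl (+ suc m) t (s * dot r y))
        (cong₂ (λ a w → a * t + w) (sym (neg-ℤ (+ suc m))) (sym (dot-scale s r y)))) q ∷ check R zs ps ns

  -- Induction on the number of coordinates. In dimension zero the empty vector is the zero vector,
  -- so any row at all is already a relation.
  gordan : ∀ (R : List (Vec ℤ n)) → Σ (Vec ℤ n) (Positive R) ⊎ Cone R (V.replicate n 0ℤ)
  gordan {zero}  []       = inj₁ ([] , [])
  gordan {zero}  ([] ∷ R) = inj₂ (gen (here refl))
  gordan {suc n} R with gordan (eliminate R)
  ... | inj₁ (y , p) = inj₁ (extend R y p)
  ... | inj₂ p       = inj₂ (lift-cone R p)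

  -- From integers to ordered fields

  dot-∑ : ∀ (r y : Vec ℤ n) → dot r y ≡ ∑ (fins n) (λ i → lookup r i * lookup y i)
  dot-∑ []      []      = refl
  dot-∑ (i ∷ r) (j ∷ y) = trans (cong (λ w → i * j + w) (dot-∑ r y)) (sym (∑-fins (λ l → lookup (i ∷ r) l * lookup (j ∷ y) l)))

  row : Subset n → Vec ℤ n
  row = V.map ind

  dot-row : ∀ (A : Subset n) y → dot (row A) y ≡ wt A (lookup y)
  dot-row {n} A y = trans (dot-∑ (row A) y) (∑-cong (fins n) (λ i → cong (λ w → w * lookup y i) (lookup-map i ind A)))

  neg-row : Subset n → Vec ℤ n
  neg-row = V.map (λ b → - ind b)

  dot-neg-row : ∀ (A : Subset n) y → dot (neg-row A) y ≡ - wt A (lookup y)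
  dot-neg-row {n} A y = trans (dot-∑ (neg-row A) y) (trans
    (∑-cong (fins n) (λ i → trans (cong (λ w → w * lookup y i) (lookup-map i (λ b → - ind b) A))
      (solve 2 (λ c z → (:- c) :* z := :- (c :* z)) refl (χ A i) (lookup y i))))
    (∑-neg (fins n) (λ i → χ A i * lookup y i)))

  nat : Bool → ℕ
  nat true  = 1
  nat false = 0

  ind-nat : ∀ b → ind b ≡ + nat b
  ind-nat true  = refl
  ind-nat false = refl

  cover : List (Subset n) → Fin n → ℕ
  cover []      i = 0
  cover (A ∷ L) i = nat (lookup A i) ℕ.+ cover L i

  cover-++ : ∀ (L L′ : List (Subset n)) i → cover (L ++ L′) i ≡ cover L i ℕ.+ cover L′ i
  cover-++ []      L′ i = refl
  cover-++ (A ∷ L) L′ i = trans (cong (nat (lookup A i) ℕ.+_) (cover-++ L L′ i)) (sym (ℕₚ.+-assoc (nat (lookup A i)) _ _))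

  -- A cone element as `t` copies of the full set minus the sets in `L`; the bound on
  -- `t ℕ.+ length L` records that the combination is nontrivial.
  Certificate : List (Subset n) → (Fin n → ℤ) → Set
  Certificate {n} 𝓝 g = Σ ℕ λ t → Σ (List (Subset n)) λ L →
    All (_∈ 𝓝) L × (1 ℕ.≤ t ℕ.+ length L) × (∀ i → g i ≡ + t - + cover L i)

  certificate-add : ∀ {𝓝 : List (Subset n)} {g h} → Certificate 𝓝 g → Certificate 𝓝 h → Certificate 𝓝 (λ i → g i + h i)
  certificate-add {g = g} {h} (t , L , L⊆ , t+L≥1 , eq) (t′ , L′ , L′⊆ , _ , eq′) = t ℕ.+ t′ , L ++ L′ , Allₚ.++⁺ L⊆ L′⊆ ,
    ℕₚ.≤-trans t+L≥1 (ℕₚ.+-mono-≤ (ℕₚ.m≤m+n t t′) (ℕₚ.≤-trans (ℕₚ.m≤m+n (length L) (length L′)) (ℕₚ.≤-reflexive (sym (length-++ L))))) ,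
    λ i → trans (cong₂ _+_ (eq i) (eq′ i)) (trans
      (solve 4 (λ a b c d → a :- b :+ (c :- d) := a :+ c :- (b :+ d)) refl (+ t) (+ cover L i) (+ t′) (+ cover L′ i))
      (cong₂ _-_ (sym (pos-+ t t′)) (trans (sym (pos-+ _ _)) (cong +_ (sym (cover-++ L L′ i))))))

  certificate-cong : ∀ {𝓝 : List (Subset n)} {g h} → (∀ i → h i ≡ g i) → Certificate 𝓝 g → Certificate 𝓝 h
  certificate-cong h≡g (t , L , L⊆ , t+L≥1 , eq) = t , L , L⊆ , t+L≥1 , λ i → trans (h≡g i) (eq i)

  certificate-mul : ∀ {𝓝 : List (Subset n)} {g} m → Certificate 𝓝 g → Certificate 𝓝 (λ i → + suc m * g i)
  certificate-mul {g = g} zero    p = certificate-cong (λ i → *-identityˡ (g i)) p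
  certificate-mul {g = g} (suc m) p = certificate-cong (λ i → trans (cong (λ w → w * g i) (pos-+ 1 (suc m)))
    (solve 2 (λ m g → (con 1ℤ :+ m) :* g := g :+ m :* g) refl (+ suc m) (g i))) (certificate-add p (certificate-mul m p))

  cone-certificate : ∀ (𝓝 : List (Subset n)) {r} → Cone (row ⊤ ∷ map neg-row 𝓝) r → Certificate 𝓝 (lookup r)
  cone-certificate 𝓝 (gen (here refl)) = 1 , [] , [] , s≤s z≤n , λ i → trans (lookup-map i ind ⊤) (trans (cong ind (lookup-replicate i true))
    (solve 0 (con 1ℤ := con 1ℤ :- con 0ℤ) refl))
  cone-certificate 𝓝 (gen (there p)) with ∈-map⁻ neg-row p
  ... | A , A∈ , refl = 0 , A ∷ [] , A∈ ∷ [] , s≤s z≤n , λ i → trans (lookup-map i (λ b → - ind b) A) (trans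
          (solve 1 (λ c → :- c := con 0ℤ :- c) refl (χ A i)) (cong (λ w → 0ℤ - w) (trans (ind-nat (lookup A i)) (cong +_ (sym (ℕₚ.+-identityʳ _))))))
  cone-certificate 𝓝 (add {r} {s} p q) = certificate-cong (λ i → lookup-zipWith _+_ i r s) (certificate-add (cone-certificate 𝓝 p) (cone-certificate 𝓝 q))
  cone-certificate 𝓝 (mul m {r} p)     = certificate-cong (λ i → lookup-map i (λ j → + suc m * j) r) (certificate-mul m (cone-certificate 𝓝 p))

  count : (Subset n → Bool) → ℕ → ℤ
  count b k = ∑ (subs ⊤ k) (λ A → ind (b A))

  UniformCover : List (Subset n) → Set
  UniformCover {n} 𝓝 = Σ ℕ λ t → Σ (Subset n) λ A → Σ (List (Subset n)) λ L →
    All (_∈ 𝓝) (A ∷ L) × (∀ i → cover (A ∷ L) i ≡ t)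

  -- The integer bound for the weights y provided by Gordan's alternative shows
  -- that 𝓝 cannot consist of sets that are negative for a common weighting.
  many-or-cover : ∀ (k : ℕ) (b : Subset (suc n) → Bool) → + 2000000000 * + suc k ≤ + suc n →
    (+ (n C k) ≤ count b (suc k)) ⊎ UniformCover (filter (λ A → b A Bool.≟ false) (subs (⊤ {suc n}) (suc k)))
  many-or-cover {n} k b n-large = [ (λ { (y , p ∷ ps) → inj₁ (if-solvable y p ps) }) , (λ c → inj₂ (if-cone (cone-certificate 𝓝 c))) ]′
      (gordan (row ⊤ ∷ map neg-row 𝓝))
    where
    𝓝 = filter (λ A → b A Bool.≟ false) (subs (⊤ {suc n}) (suc k))
    size-⊤ : size (⊤ {suc n}) ≡ + suc n
    size-⊤ = trans (size-∣∣ (⊤ {suc n})) (cong +_ (∣⊤∣≡n (suc n)))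

    if-solvable : ∀ y → 0ℤ < dot (row ⊤) y → Positive (map neg-row 𝓝) y → + (n C k) ≤ count b (suc k)
    if-solvable y p ps = ≤-trans
      (subst (λ m → + ((m ℕ.∸ 1) C k) ≤ ∑ (subs ⊤ (suc k)) (λ Z → nonneg (wt Z (lookup y)))) (∣⊤∣≡n (suc n))
        (integer-bound (⊤ {suc n}) (lookup y) k zero refl (subst (+ 2000000000 * + suc k ≤_) (sym size-⊤) n-large)
          (ℤₚ.<⇒≤ (subst (0ℤ <_) (dot-row ⊤ y) p))))
      (∑-mono-All (All.tabulate at))
      where
      at : ∀ {Z} → Z ∈ subs (⊤ {suc n}) (suc k) → nonneg (wt Z (lookup y)) ≤ ind (b Z)
      at {Z} Z∈ with bool-cases (b Z)
      ... | inj₁ bZ = subst (λ c → nonneg (wt Z (lookup y)) ≤ ind c) (sym bZ) (nonneg≤1 _)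
      ... | inj₂ bZ with nonneg-cases (wt Z (lookup y))
      ...   | inj₂ (_ , eq) = subst (λ w → w ≤ ind (b Z)) (sym eq) (subst (λ c → 0ℤ ≤ ind c) (sym bZ) ≤-refl)
      ...   | inj₁ (wt≥0 , _) = ⊥-elim (ℤₚ.<⇒≱ negative (by-difference (solve 1 (λ w → con 0ℤ := (:- w) :+ w) refl (wt Z (lookup y))) wt≥0))
        where
        negative : 0ℤ < - wt Z (lookup y)
        negative = subst (0ℤ <_) (dot-neg-row Z y) (All.lookup ps (∈-map⁺ neg-row (∈-filter⁺ (λ A → b A Bool.≟ false) Z∈ bZ)))

    if-cone : Certificate 𝓝 (lookup (V.replicate (suc n) 0ℤ)) → UniformCover 𝓝
    if-cone (t , L , L⊆ , t+L≥1 , eq) = nonempty L L⊆ t+L≥1 covers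
      where
      covers : ∀ i → cover L i ≡ t
      covers i = ℤₚ.+-injective (trans (solve 2 (λ t c → c := t :- (t :- c)) refl (+ t) (+ cover L i))
        (trans (cong (λ w → + t - w) (trans (sym (eq i)) (lookup-replicate i 0ℤ))) (solve 1 (λ t → t :- con 0ℤ := t) refl (+ t))))
      nonempty : ∀ L → All (_∈ 𝓝) L → 1 ℕ.≤ t ℕ.+ length L → (∀ i → cover L i ≡ t) → UniformCover 𝓝
      -- Without sets the cover is 0 everywhere, so `t` is 0 and the combination would be trivial.
      nonempty []      _  h c = ⊥-elim (ℕₚ.<-irrefl (trans (c zero) (sym (ℕₚ.+-identityʳ t))) h)
      nonempty (A ∷ L) L⊆ _ c = t , A , L , L⊆ , c

  subs-unique : ∀ (U : Subset n) k → Unique (subs U k)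
  subs-unique []          zero    = [] ∷ []
  subs-unique []          (suc k) = []
  subs-unique (false ∷ U) k       = Uniqueₚ.map⁺ ∷-injectiveʳ (subs-unique U k)
  subs-unique (true ∷ U)  zero    = Uniqueₚ.map⁺ ∷-injectiveʳ (subs-unique U 0)
  subs-unique (true ∷ U)  (suc k) = Uniqueₚ.++⁺ (Uniqueₚ.map⁺ ∷-injectiveʳ (subs-unique U k)) (Uniqueₚ.map⁺ ∷-injectiveʳ (subs-unique U (suc k)))
    λ { (p , q) → disjoint (∈-map⁻ (true ∷_) p) (∈-map⁻ (false ∷_) q) }
    where
    disjoint : ∀ {Z : Subset (suc _)} {xs ys} → (∃ λ A → A ∈ xs × Z ≡ true ∷ A) → (∃ λ A → A ∈ ys × Z ≡ false ∷ A) → ⊥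
    disjoint (_ , _ , refl) (_ , _ , ())

  ∑-ind : ∀ {A : Set} (b : A → Bool) xs → ∑ xs (λ x → ind (b x)) ≡ + length (filter (λ x → b x Bool.≟ true) xs)
  ∑-ind b []       = refl
  ∑-ind b (x ∷ xs) with b x
  ... | true  = trans (cong (λ w → 1ℤ + w) (∑-ind b xs)) (sym (pos-+ 1 _))
  ... | false = trans (+-identityˡ _) (∑-ind b xs)

  ∑-mono-strict : ∀ {A : Set} {xs : List A} {f g : A → ℤ} {x} → (∀ x → f x ≤ g x) → x ∈ xs → f x + 1ℤ ≤ g x → ∑ xs f + 1ℤ ≤ ∑ xs g
  ∑-mono-strict {xs = y ∷ xs} {f} {g} f≤g (here refl) h = subst (λ w → w ≤ ∑ (y ∷ xs) g)
    (solve 2 (λ a b → a :+ con 1ℤ :+ b := a :+ b :+ con 1ℤ) refl (f y) (∑ xs f)) (+-mono-≤ h (∑-mono xs f≤g))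
  ∑-mono-strict {xs = y ∷ xs} {f} {g} f≤g (there p) h = subst (λ w → w ≤ ∑ (y ∷ xs) g)
    (sym (+-assoc (f y) (∑ xs f) 1ℤ)) (+-mono-≤ (f≤g y) (∑-mono-strict f≤g p h))

  -- Subset sums and sign labellings in an ordered field

  module Weighted {c ℓ₁ ℓ₂} (F : OrderedField c ℓ₁ ℓ₂) where
    open OrderedField F using (Carrier; 0#; _≈_; setoid; +-monoid)
      renaming (_+_ to _+ᶠ_; _≤_ to _≤ᶠ_; +-cong to +ᶠ-cong; +-identityˡ to +ᶠ-identityˡ; +-identityʳ to +ᶠ-identityʳ; +-comm to +ᶠ-comm; +-assoc to +ᶠ-assoc)
    module ≤ᶠ = IsTotalOrder (OrderedField.isTotalOrder F)
    module ≈ = Setoid setoid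
    open MonoidMult +-monoid using (×-homo-+) renaming (_×_ to _×ᶠ_)
    open SetoidReasoning setoid

    +ᶠ-mono : ∀ {x y z w} → x ≤ᶠ y → z ≤ᶠ w → (x +ᶠ z) ≤ᶠ (y +ᶠ w)
    +ᶠ-mono {x} {y} {z} {w} p q = ≤ᶠ.trans (OrderedField.+-monoˡ-≤ F z p)
      (≤ᶠ.≤-respʳ-≈ (+ᶠ-comm w y) (≤ᶠ.≤-respˡ-≈ (+ᶠ-comm z y) (OrderedField.+-monoˡ-≤ F y q)))

    sumAll-cong : {x y : Fin n → Carrier} → (∀ i → x i ≈ y i) → sumAll F x ≈ sumAll F y
    sumAll-cong {zero}  h = ≈.refl
    sumAll-cong {suc n} h = +ᶠ-cong (h zero) (sumAll-cong (λ i → h (suc i)))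

    interchange : ∀ a b d e → ((a +ᶠ b) +ᶠ (d +ᶠ e)) ≈ ((a +ᶠ d) +ᶠ (b +ᶠ e))
    interchange a b d e = begin
      (a +ᶠ b) +ᶠ (d +ᶠ e) ≈⟨ +ᶠ-assoc a b (d +ᶠ e) ⟩
      a +ᶠ (b +ᶠ (d +ᶠ e)) ≈⟨ +ᶠ-cong ≈.refl (≈.trans (≈.sym (+ᶠ-assoc b d e)) (≈.trans (+ᶠ-cong (+ᶠ-comm b d) ≈.refl) (+ᶠ-assoc d b e))) ⟩
      a +ᶠ (d +ᶠ (b +ᶠ e)) ≈⟨ +ᶠ-assoc a d (b +ᶠ e) ⟨
      (a +ᶠ d) +ᶠ (b +ᶠ e) ∎

    sumAll-+ : (x y : Fin n → Carrier) → sumAll F (λ i → x i +ᶠ y i) ≈ (sumAll F x +ᶠ sumAll F y)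
    sumAll-+ {zero}  x y = ≈.sym (+ᶠ-identityˡ 0#)
    sumAll-+ {suc n} x y = ≈.trans (+ᶠ-cong ≈.refl (sumAll-+ (λ i → x (suc i)) (λ i → y (suc i)))) (interchange _ _ _ _)

    sumAll-0 : ∀ n → sumAll F {n} (λ _ → 0#) ≈ 0#
    sumAll-0 zero    = ≈.refl
    sumAll-0 (suc n) = ≈.trans (+ᶠ-identityˡ _) (sumAll-0 n)

    sumAll-× : ∀ t (x : Fin n → Carrier) → sumAll F (λ i → t ×ᶠ x i) ≈ (t ×ᶠ sumAll F x)
    sumAll-× {n} zero x = sumAll-0 n
    sumAll-× (suc t) x  = ≈.trans (sumAll-+ x (λ i → t ×ᶠ x i)) (+ᶠ-cong ≈.refl (sumAll-× t x))

    sumOver-sumAll : ∀ (A : Subset n) x → sumOver F A x ≈ sumAll F (λ i → nat (lookup A i) ×ᶠ x i)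
    sumOver-sumAll []          x = ≈.refl
    sumOver-sumAll (true ∷ A)  x = +ᶠ-cong (≈.sym (+ᶠ-identityʳ (x zero))) (sumOver-sumAll A (λ i → x (suc i)))
    sumOver-sumAll (false ∷ A) x = ≈.trans (sumOver-sumAll A (λ i → x (suc i))) (≈.sym (+ᶠ-identityˡ _))

    total : List (Subset n) → (Fin n → Carrier) → Carrier
    total []      x = 0#
    total (A ∷ L) x = sumOver F A x +ᶠ total L x

    total-cover : ∀ (L : List (Subset n)) x → total L x ≈ sumAll F (λ i → cover L i ×ᶠ x i)
    total-cover {n} [] x      = ≈.sym (sumAll-0 n)
    total-cover     (A ∷ L) x = ≈.trans (+ᶠ-cong (sumOver-sumAll A x) (total-cover L x)) (≈.trans (≈.sym (sumAll-+ (λ i → nat (lookup A i) ×ᶠ x i) (λ i → cover L i ×ᶠ x i)))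
      (sumAll-cong (λ i → ≈.sym (×-homo-+ (x i) (nat (lookup A i)) (cover L i)))))

    ×ᶠ-nonneg : ∀ t {y} → 0# ≤ᶠ y → 0# ≤ᶠ (t ×ᶠ y)
    ×ᶠ-nonneg zero    h = ≤ᶠ.refl
    ×ᶠ-nonneg (suc t) h = ≤ᶠ.≤-respˡ-≈ (+ᶠ-identityˡ 0#) (+ᶠ-mono h (×ᶠ-nonneg t h))

    total-nonpos : ∀ {L : List (Subset n)} {x} → All (λ A → sumOver F A x ≤ᶠ 0#) L → total L x ≤ᶠ 0#
    total-nonpos []       = ≤ᶠ.refl
    total-nonpos (p ∷ ps) = ≤ᶠ.≤-respʳ-≈ (+ᶠ-identityˡ 0#) (+ᶠ-mono p (total-nonpos ps))

    -- A uniform cover by sets of nonpositive weight adds up to a nonnegative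
    -- multiple of the total weight, so all these weights vanish.
    cover-nonneg : ∀ t (A : Subset n) L x → (∀ i → cover (A ∷ L) i ≡ t) → 0# ≤ᶠ sumAll F x →
      All (λ B → sumOver F B x ≤ᶠ 0#) L → 0# ≤ᶠ sumOver F A x
    cover-nonneg t A L x covers S≥0 L≤0 = ≤ᶠ.≤-respʳ-≈ (+ᶠ-identityʳ _) (≤ᶠ.trans
      (≤ᶠ.≤-respʳ-≈ (≈.sym (≈.trans (total-cover (A ∷ L) x) (≈.trans (sumAll-cong (λ i → ≈.reflexive (cong (_×ᶠ x i) (covers i)))) (sumAll-× t x)))) (×ᶠ-nonneg t S≥0))
      (+ᶠ-mono ≤ᶠ.refl (total-nonpos L≤0)))

    module _ (k : ℕ) (n-large : + 2000000000 * + suc k ≤ + suc n) (x : Fin (suc n) → Carrier) (S≥0 : 0# ≤ᶠ sumAll F x) where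

      -- The order of F is not assumed decidable: a labelling records one valid
      -- sign for each subset sum, and zero sums may be labelled either way.
      record Labelling : Set (c ⊔ ℓ₁ ⊔ ℓ₂) where
        field
          label    : Subset (suc n) → Bool
          true⇒≥0  : ∀ A → label A ≡ true → 0# ≤ᶠ sumOver F A x
          false⇒≤0 : ∀ A → label A ≡ false → sumOver F A x ≤ᶠ 0#
      open Labelling

      initial : Labelling
      initial = record { label = λ A → sign (sgn A) ; true⇒≥0 = λ A → sign-true (sgn A) ; false⇒≤0 = λ A → sign-false (sgn A) }
        where
        sgn : ∀ A → (0# ≤ᶠ sumOver F A x) ⊎ (sumOver F A x ≤ᶠ 0#)
        sgn A = ≤ᶠ.total 0# (sumOver F A x)
        sign : ∀ {P Q : Set ℓ₂} → P ⊎ Q → Bool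
        sign (inj₁ _) = true
        sign (inj₂ _) = false
        sign-true : ∀ {P Q : Set ℓ₂} (s : P ⊎ Q) → sign s ≡ true → P
        sign-true (inj₁ p) _ = p
        sign-false : ∀ {P Q : Set ℓ₂} (s : P ⊎ Q) → sign s ≡ false → Q
        sign-false (inj₂ q) _ = q

      relabel : (λᵇ : Labelling) (A₀ : Subset (suc n)) → 0# ≤ᶠ sumOver F A₀ x → Labelling
      relabel λᵇ A₀ A₀≥0 = record { label = b′ ; true⇒≥0 = to ; false⇒≤0 = from }
        where
        b′ : Subset (suc n) → Bool
        b′ A = does (≡-dec Bool._≟_ A A₀) ∨ label λᵇ A
        to : ∀ A → b′ A ≡ true → 0# ≤ᶠ sumOver F A x
        to A h with ≡-dec Bool._≟_ A A₀
        ... | yes refl = A₀≥0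
        ... | no  _    = true⇒≥0 λᵇ A h
        from : ∀ A → b′ A ≡ false → sumOver F A x ≤ᶠ 0#
        from A h with ≡-dec Bool._≟_ A A₀
        ... | no  _    = false⇒≤0 λᵇ A h

      relabel-count : ∀ λᵇ A₀ A₀≥0 → A₀ ∈ subs ⊤ (suc k) → label λᵇ A₀ ≡ false →
        count (label λᵇ) (suc k) + 1ℤ ≤ count (label (relabel λᵇ A₀ A₀≥0)) (suc k)
      relabel-count λᵇ A₀ A₀≥0 A₀∈ eq = ∑-mono-strict pointwise A₀∈ at-A₀
        where
        b′ = label (relabel λᵇ A₀ A₀≥0)
        pointwise : ∀ A → ind (label λᵇ A) ≤ ind (b′ A)
        pointwise A with ≡-dec Bool._≟_ A A₀ | label λᵇ A
        ... | yes _ | true  = ≤-refl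
        ... | yes _ | false = pos 1
        ... | no  _ | _     = ≤-refl
        at-A₀ : ind (label λᵇ A₀) + 1ℤ ≤ ind (b′ A₀)
        at-A₀ rewrite eq with ≡-dec Bool._≟_ A₀ A₀
        ... | yes _ = ≤-reflexive (+-identityˡ 1ℤ)
        ... | no ≢  = ⊥-elim (≢ refl)

      -- All sets in the cover are labelled as nonpositive, yet `cover-nonneg` shows the first of
      -- them to be nonnegative as well. Relabelling it is valid and raises the count.
      improve : (λᵇ : Labelling) → (+ (n C k) ≤ count (label λᵇ) (suc k)) ⊎
        Σ Labelling λ λᵇ′ → count (label λᵇ) (suc k) + 1ℤ ≤ count (label λᵇ′) (suc k)
      improve λᵇ = [ inj₁ , (λ c → inj₂ (from-cover c)) ]′ (many-or-cover k (label λᵇ) n-large)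
        where
        from-cover : _ → Σ Labelling λ λᵇ′ → count (label λᵇ) (suc k) + 1ℤ ≤ count (label λᵇ′) (suc k)
        from-cover (t , A , L , A∈ ∷ L∈ , covers) = relabel λᵇ A A≥0 , relabel-count λᵇ A A≥0 (proj₁ (split A∈)) (proj₂ (split A∈))
          where
          split : ∀ {B} → B ∈ filter (λ A → label λᵇ A Bool.≟ false) (subs ⊤ (suc k)) → B ∈ subs ⊤ (suc k) × label λᵇ B ≡ false
          split = ∈-filter⁻ (λ A → label λᵇ A Bool.≟ false)
          A≥0 : 0# ≤ᶠ sumOver F A x
          A≥0 = cover-nonneg t A L x covers S≥0 (All.map (λ {B} B∈ → false⇒≤0 λᵇ B (proj₂ (split B∈))) L∈)

      -- The fuel bounds the number of sets still missing; every improvement supplies at least one.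
      saturate : ∀ fuel (λᵇ : Labelling) → + (n C k) ≤ count (label λᵇ) (suc k) + + fuel →
        Σ Labelling λ λᵇ′ → + (n C k) ≤ count (label λᵇ′) (suc k)
      saturate zero       λᵇ h = λᵇ , subst (+ (n C k) ≤_) (+-identityʳ _) h
      saturate (suc fuel) λᵇ h = [ (λ done → λᵇ , done) , (λ { (λᵇ′ , more) → saturate fuel λᵇ′ (≤-trans h (by-difference
          (trans (solve 3 (λ a b f → b :+ f := a :+ (con 1ℤ :+ f) :+ (b :- (a :+ con 1ℤ))) refl (count (label λᵇ) (suc k)) (count (label λᵇ′) (suc k)) (+ fuel))
            (cong (λ w → count (label λᵇ) (suc k) + w + (count (label λᵇ′) (suc k) - (count (label λᵇ) (suc k) + 1ℤ))) (sym (pos-+ 1 fuel))))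
          (difference more))) }) ]′ (improve λᵇ)

      many-nonneg-sets : Σ (List (Subset (suc n))) λ L →
        Unique L × All (λ A → (∣ A ∣ ≡ suc k) × (0# ≤ᶠ sumOver F A x)) L × (n C k ℕ.≤ length L)
      many-nonneg-sets = collect (saturate (n C k) initial (by-difference (+-comm (count (label initial) (suc k)) _)
          (∑-nonneg (subs ⊤ (suc k)) (λ A → ind-nonneg (label initial A)))))
        where
        ind-nonneg : ∀ b → 0ℤ ≤ ind b
        ind-nonneg true  = pos 1
        ind-nonneg false = pos 0
        collect : (Σ Labelling λ λᵇ → + (n C k) ≤ count (label λᵇ) (suc k)) → _
        collect (λᵇ , h) = filter P? (subs ⊤ (suc k)) , Uniqueₚ.filter⁺ P? (subs-unique ⊤ (suc k)) ,
          All.zipWith (λ { {A} (p , q) → ℤₚ.+-injective (trans (sym (size-∣∣ A)) (proj₂ p)) , true⇒≥0 λᵇ A q })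
            (Allₚ.filter⁺ P? (subs-spec ⊤ (suc k)) , Allₚ.all-filter P? (subs ⊤ (suc k))) ,
          ℤₚ.drop‿+≤+ (subst (+ (n C k) ≤_) (∑-ind (label λᵇ) (subs ⊤ (suc k))) h)
          where
          P? : ∀ A → Dec (label λᵇ A ≡ true)
          P? A = label λᵇ A Bool.≟ true

  large-enough : ∀ k n → (10 ℕ.^ 46) ℕ.* suc k ℕ.≤ suc n → + 2000000000 * + suc k ≤ + suc n
  large-enough k n h = subst (λ w → w ≤ + suc n) (pos-* 2000000000 (suc k))
    (+≤+ (ℕₚ.≤-trans (ℕₚ.*-monoˡ-≤ (suc k) (ℕₚ.≤ᵇ⇒≤ 2000000000 (10 ℕ.^ 46) tt)) h))

open import Defs
open import Data.Nat using (ℕ; _*_; _^_; _∸_; _≤_)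
open import Data.Nat.Combinatorics using (_C_)
open import Data.Fin using (Fin)
open import Data.Fin.Subset using (Subset; ∣_∣)
open import Data.List using (List; length)
open import Data.List.Relation.Unary.All using (All)
open import Data.List.Relation.Unary.Unique.Propositional using (Unique)
open import Data.Product using (Σ; _×_)
open import Relation.Binary.PropositionalEquality using (_≡_)
open import Data.Nat using (suc)

theorem1 : ∀ {c ℓ₁ ℓ₂} (F : OrderedField c ℓ₁ ℓ₂) (k n : ℕ) → 1 ≤ k → 1 ≤ n → (10 ^ 46) * k ≤ n →
           (x : Fin n → OrderedField.Carrier F) → OrderedField._≤_ F (OrderedField.0# F) (sumAll F x) →
           Σ (List (Subset n)) λ L → Unique L × All (λ A → (∣ A ∣ ≡ k) × OrderedField._≤_ F (OrderedField.0# F) (sumOver F A x)) L × ((n ∸ 1) C (k ∸ 1) ≤ length L)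
theorem1 F (suc k) (suc n) _ _ n-large x S≥0 =
  NonnegativeSums.Weighted.many-nonneg-sets F k (NonnegativeSums.large-enough k n n-large) x S≥0
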